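{- Fix an integer $k \ge 2$. For a positive integer $N$, let $E_k(N)$ be the number of $k$-tuples $(n_1,\ldots,n_k)\in[1,N]^k$ of integers with $n_1<n_2<\cdots<n_k$ such that the polynomial $F(x) = 1 + x^{n_1}+\cdots+x^{n_k}$, removed of its cyclotomic factors, is reducible over $\mathbb{Q}$. Then $E_k(N) = o(N^k)$ as $N\to\infty$. In other words, for almost all choices of positive integers $n_1<\cdots<n_k$, the polynomial $F(x)$ removed of its cyclotomic factors is irreducible.
   Context: "Removed of its cyclotomic factors" means $F(x)$ divided by the product of all its cyclotomic-polynomial factors (with multiplicity) in $\mathbb{Z}[x]$. -}

module Defs where

open import Algebra.Bundles.Raw using (RawRing; RawSemiring)
import Algebra.Definitions.RawSemiring as RawSemiringDefs
open import Data.Bool.Base using (if_then_else_)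
open import Data.Empty using (⊥-elim)
import Data.Integer.Base as ℤ
import Data.Integer.Properties as ℤ
open import Data.List.Base as List using (List; []; _∷_; length; cartesianProductWith; upTo)
open import Data.List.Membership.Propositional using (_∈_)
open import Data.List.Membership.Propositional.Properties using (∈-cartesianProductWith⁺; ∈-upTo⁺)
open import Data.List.Membership.Propositional.Properties.WithK using (unique∧set⇒bag)
open import Data.List.Relation.Binary.BagAndSetEquality using (∼bag⇒↭)
open import Data.List.Relation.Binary.Permutation.Propositional.Properties using (↭-length)
import Data.List.Relation.Unary.All as ListAll
open import Data.List.Relation.Unary.AllPairs using ([]; _∷_)
open import Data.List.Relation.Unary.Any using (here; there)
open import Data.List.Relation.Unary.Unique.Propositional using (Unique)
open import Data.List.Relation.Unary.Unique.Propositional.Properties using (cartesianProductWith⁺; upTo⁺)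
open import Data.Nat.Base using (ℕ; zero; suc; _∸_; _*_; _^_; _≤_; _<_; s≤s; NonZero)
open import Data.Nat.Divisibility using (_∣?_)
open import Data.Product.Base using (∃; _×_; _,_; proj₁; proj₂)
import Data.Rational.Base as ℚ
open import Data.Vec.Base using (Vec; []; _∷_)
open import Data.Vec.Properties using (∷-injective)
open import Data.Vec.Relation.Unary.All using (All; []; _∷_)
open import Data.Vec.Relation.Unary.Linked using (Linked)
open import Function.Base using (_∘_)
open import Function.Bundles using (_⇔_; mk⇔; Equivalence)
open import Function.Properties.Equivalence using () renaming (sym to ⇔-sym; trans to ⇔-trans)
open import Level using (0ℓ)
open import Relation.Binary.PropositionalEquality using (_≡_; refl)
open import Relation.Nullary using (¬_; yes; no; does)
open import Relation.Nullary.Decidable using (¬¬-excluded-middle)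

------------------------------------------------------------------------
-- Univariate polynomials

-- A polynomial is its list of coefficients, constant term first.  Trailing
-- zeros are allowed, so equality of polynomials is _≈_, not _≡_.
module Polynomial (R : RawRing 0ℓ 0ℓ) where
  private module R = RawRing R

  Poly : Set
  Poly = List R.Carrier

  coeff : Poly → ℕ → R.Carrier
  coeff []      _       = R.0#
  coeff (a ∷ _) zero    = a
  coeff (_ ∷ p) (suc i) = coeff p i

  infix  4 _≈_
  infixl 6 _+_ _-_
  infixl 7 _·_ _⊛_

  _≈_ : Poly → Poly → Set
  p ≈ q = ∀ i → coeff p i R.≈ coeff q i

  _+_ : Poly → Poly → Poly
  []      + q       = q
  (a ∷ p) + []      = a ∷ p
  (a ∷ p) + (b ∷ q) = (a R.+ b) ∷ (p + q)

  _·_ : R.Carrier → Poly → Poly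
  c · p = List.map (c R.*_) p

  _-_ : Poly → Poly → Poly
  p - q = p + (R.- R.1#) · q

  _⊛_ : Poly → Poly → Poly
  []      ⊛ q = []
  (a ∷ p) ⊛ q = a · q + (R.0# ∷ p ⊛ q)

  0ₚ 1ₚ : Poly
  0ₚ = []
  1ₚ = R.1# ∷ []

  X^_ : ℕ → Poly
  X^ n = List.replicate n R.0# List.++ 1ₚ

  prod : List Poly → Poly
  prod = List.foldr _⊛_ 1ₚ

  rawSemiring : RawSemiring 0ℓ 0ℓ
  rawSemiring = record
    { Carrier = Poly ; _≈_ = _≈_ ; _+_ = _+_ ; _*_ = _⊛_ ; 0# = 0ₚ ; 1# = 1ₚ }

  open RawSemiringDefs rawSemiring public using (_∣_; _∤_; Irreducible)

  Reducible : Poly → Set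
  Reducible p = ¬ (p ≈ 0ₚ) × ∃ λ g → ∃ λ h → p ≈ g ⊛ h × g ∤ 1ₚ × h ∤ 1ₚ

  -- Long division of p by d, correct when d is monic of degree m: from
  -- p = q d + r one gets a + X p = (c + X q) d + ((a + X r) - c d), where c
  -- is the coefficient of X^m in a + X r.
  divMonic : (m : ℕ) (d p : Poly) → Poly × Poly
  divMonic m d []      = 0ₚ , 0ₚ
  divMonic m d (a ∷ p) =
    let (q , r) = divMonic m d p
        c       = coeff (a ∷ r) m
    in (c ∷ q) , ((a ∷ r) - c · d)

module ℤ[X] = Polynomial ℤ.+-*-rawRing
module ℚ[X] = Polynomial ℚ.+-*-rawRing

toℚ[X] : ℤ[X].Poly → ℚ[X].Poly
toℚ[X] = List.map (ℚ._/ 1)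

------------------------------------------------------------------------
-- Cyclotomic polynomials

open ℤ[X] using (X^_; _⊛_; 1ₚ; prod; divMonic)

dropTrailingZeros : ℤ[X].Poly → ℤ[X].Poly
dropTrailingZeros []      = []
dropTrailingZeros (a ∷ p) with dropTrailingZeros p | a ℤ.≟ ℤ.0ℤ
... | []     | yes _ = []
... | []     | no  _ = a ∷ []
... | b ∷ p′ | _     = a ∷ b ∷ p′

degree : ℤ[X].Poly → ℕ
degree p = length (dropTrailingZeros p) ∸ 1

-- Φ n = (X^n - 1) / ∏_{d ∣ n, d < n} Φ d for n ≥ 1; the value Φ 0 is junk.
-- ∏Φ n j is the product of Φ d over the divisors d of n with 1 ≤ d ≤ j.
mutual
  Φ : ℕ → ℤ[X].Poly
  Φ zero    = 1ₚ
  Φ (suc n) = proj₁ (divMonic (degree D) D ((X^ suc n) ℤ[X].- 1ₚ))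
    where D = ∏Φ (suc n) n

  ∏Φ : ℕ → ℕ → ℤ[X].Poly
  ∏Φ n zero    = 1ₚ
  ∏Φ n (suc j) = if does (suc j ∣? n) then Φ (suc j) ⊛ ∏Φ n j else ∏Φ n j

Cyclotomic : ℤ[X].Poly → Set
Cyclotomic p = ∃ λ n → NonZero n × p ℤ[X].≈ Φ n

-- g is f removed of its cyclotomic factors: cs lists all the cyclotomic
-- factors of f, with multiplicity.
record RemovedOfCyclotomicFactors (f g : ℤ[X].Poly) : Set where
  field
    cs         : List ℤ[X].Poly
    cyclotomic : ListAll.All Cyclotomic cs
    quotient   : f ℤ[X].≈ prod cs ⊛ g
    exhausted  : ∀ c → Cyclotomic c → c ℤ[X].∤ g

------------------------------------------------------------------------
-- The exceptional tuples

F : ∀ {k} → Vec ℕ k → ℤ[X].Poly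
F ns = 1ₚ ℤ[X].+ sumX ns
  where
  sumX : ∀ {k} → Vec ℕ k → ℤ[X].Poly
  sumX []       = ℤ[X].0ₚ
  sumX (n ∷ ns) = (X^ n) ℤ[X].+ sumX ns

IncreasingIn[1,_] : ℕ → ∀ {k} → Vec ℕ k → Set
IncreasingIn[1, N ] ns = All (λ n → 1 ≤ n × n ≤ N) ns × Linked _<_ ns

ReducibleNoncyclotomicPart : ∀ {k} → Vec ℕ k → Set
ReducibleNoncyclotomicPart ns =
  ∃ λ g → RemovedOfCyclotomicFactors (F ns) g × ℚ[X].Reducible (toℚ[X] g)

IrreducibleNoncyclotomicPart : ∀ {k} → Vec ℕ k → Set
IrreducibleNoncyclotomicPart ns =
  ∃ λ g → RemovedOfCyclotomicFactors (F ns) g × ℚ[X].Irreducible (toℚ[X] g)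

------------------------------------------------------------------------
-- Counting

HasCardinality : {A : Set} → (A → Set) → ℕ → Set
HasCardinality P c =
  ∃ λ xs → Unique xs × (∀ x → x ∈ xs ⇔ P x) × length xs ≡ c

-- Number k N P c: exactly c of the k-tuples 1 ≤ n₁ < ⋯ < n_k ≤ N satisfy P.
-- A relation rather than a function of N, because P need not come with a
-- decision procedure; `number-unique` and `number-exists` show that it
-- determines a number.
Number : ∀ k → ℕ → (Vec ℕ k → Set) → ℕ → Set
Number k N P = HasCardinality λ ns → IncreasingIn[1, N ] ns × P ns

E : ℕ → ℕ → ℕ → Set
E k N = Number k N ReducibleNoncyclotomicPart

-- f(N) = o(N^k) for a function f given by its graph, with ε = 1/m.
_=o[N^_] : (ℕ → ℕ → Set) → ℕ → Set
f =o[N^ k ] =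
  ∀ m → NonZero m → ∃ λ N₀ → ∀ N → N₀ ≤ N → ∀ c → f N c → m * c ≤ N ^ k

-- The tuples failing P have density zero among all increasing k-tuples, of
-- which there are (N choose k) ~ N^k / k! in [1,N].
ForAlmostAllTuples : ∀ k → (Vec ℕ k → Set) → Set
ForAlmostAllTuples k P = (λ N → Number k N (¬_ ∘ P)) =o[N^ k ]

number-unique : ∀ {k N P c d} → Number k N P c → Number k N P d → c ≡ d
number-unique (xs , xs! , xs⇔ , refl) (ys , ys! , ys⇔ , refl) =
  ↭-length (∼bag⇒↭ (unique∧set⇒bag xs! ys! λ {x} → ⇔-trans (xs⇔ x) (⇔-sym (ys⇔ x))))

private
  -- Every subset of a finite set has, up to double negation, a cardinality.
  subset-card : {A : Set} (P : A → Set) (xs : List A) → Unique xs →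
                (∀ x → P x → x ∈ xs) → ¬ ¬ ∃ (HasCardinality P)
  subset-card {A} P xs xs! P⊆xs none = go xs xs! λ (ys , ys! , ys⇔) →
    none (length ys , ys , ys! , (λ x → mk⇔ (proj₂ ∘ Equivalence.to (ys⇔ x))
      (λ px → Equivalence.from (ys⇔ x) (P⊆xs x px , px))) , refl)
    where
    go : ∀ xs → Unique xs →
         ¬ ¬ ∃ λ ys → Unique ys × ∀ x → x ∈ ys ⇔ (x ∈ xs × P x)
    go []       _           k = k ([] , [] , λ x → mk⇔ (λ ()) (λ ()))
    go (z ∷ zs) (z∉zs ∷ zs!) k = go zs zs! λ (ys , ys! , ys⇔) →
      ¬¬-excluded-middle λ where
        (yes pz) → k (z ∷ ys
          , ListAll.tabulate (λ {y} y∈ → ListAll.lookup z∉zs (proj₁ (Equivalence.to (ys⇔ y) y∈))) ∷ ys!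
          , λ x → mk⇔
              (λ { (here refl) → here refl , pz
                 ; (there x∈)  → let (x∈zs , px) = Equivalence.to (ys⇔ x) x∈ in there x∈zs , px })
              (λ { (here refl , _)   → here refl
                 ; (there x∈zs , px) → there (Equivalence.from (ys⇔ x) (x∈zs , px)) }))
        (no ¬pz) → k (ys , ys! , λ x → mk⇔
              (λ x∈ → let (x∈zs , px) = Equivalence.to (ys⇔ x) x∈ in there x∈zs , px)
              (λ { (here refl , px)  → ⊥-elim (¬pz px)
                 ; (there x∈zs , px) → Equivalence.from (ys⇔ x) (x∈zs , px) }))

  tuples : ∀ k → ℕ → List (Vec ℕ k)
  tuples zero    N = [] ∷ []
  tuples (suc k) N = cartesianProductWith _∷_ (upTo (suc N)) (tuples k N)

  tuples-unique : ∀ k N → Unique (tuples k N)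
  tuples-unique zero    N = ListAll.[] ∷ []
  tuples-unique (suc k) N =
    cartesianProductWith⁺ _∷_ ∷-injective (upTo⁺ (suc N)) (tuples-unique k N)

  ∈-tuples : ∀ {k N} {ns : Vec ℕ k} → All (λ n → 1 ≤ n × n ≤ N) ns → ns ∈ tuples k N
  ∈-tuples []              = here refl
  ∈-tuples ((_ , n≤N) ∷ b) =
    ∈-cartesianProductWith⁺ _∷_ (∈-upTo⁺ (s≤s n≤N)) (∈-tuples b)

number-exists : ∀ k N P → ¬ ¬ ∃ (Number k N P)
number-exists k N P = subset-card _ (tuples k N) (tuples-unique k N)
  λ _ → ∈-tuples ∘ proj₁ ∘ proj₁

{-# OPTIONS --safe #-}

-- Idea.  A tuple is called generic if its exponents satisfy no linear relation with coefficients in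
-- [-3,3], not even modulo a large fixed prime p; all but a small proportion of the tuples are generic.
--
-- Let the noncyclotomic part of F factor as u v, so F = c u v with c a product of cyclotomic
-- polynomials, and write ~ for reciprocals.  Ljunggren's G = c u v~ satisfies G G~ = F F~, hence ±G has
-- coefficients 0 and 1 and its exponents have the same differences as those of F; for a generic tuple
-- this forces ±G to be F or F~.  Thus u or v is a common factor h of F and F~ without cyclotomic factors.
--
-- Such a common factor is rare. Fix n₂, …, n_k, put A = 1 + X^{n₂} + ⋯ + X^{n_k}, and let n₁ vary.
-- Then h divides P = A A~ - X^{n_k}, which does not depend on n₁, and the h for different n₁ are
-- coprime: a common root would be a root of unity, and h would be divisible by a cyclotomic
-- polynomial, these being irreducible. So the product of all the h divides P, of degree 2 n_k ≤ 2N. At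
-- most 2N/T of them have degree ≥ T. If more than k² of those of degree < T agree modulo p, then P
-- lies in a high power of the ideal (h, p); applying X d/dX - e for all exponents e of P but one shows
-- that h divides a monomial modulo p, which is impossible. Hence there are O(p^T) of the latter.
module Submission where

open import Algebra.Bundles using (CommutativeRing)
import Algebra.Definitions.RawMagma as RawMagma
open import Algebra.Definitions.RawSemiring using (mkIrred)
import Algebra.Solver.Ring
import Algebra.Solver.Ring.AlmostCommutativeRing as ACR
open import Algebra.Structures using (IsCommutativeRing)
open import Data.Bool.Base using (if_then_else_)
open import Data.Empty using (⊥; ⊥-elim)
open import Data.Fin.Base as Fin using (Fin; toℕ; fromℕ; inject₁)
import Data.Fin.Properties as Fin
open import Data.Integer.Base as ℤ using (ℤ; +_; -[1+_]; ∣_∣)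
import Data.Integer.DivMod as ℤ
import Data.Integer.Divisibility.Signed as ℤ
import Data.Integer.Properties as ℤ
import Data.Integer.Solver
open import Data.List.Base as List using (List; []; _∷_; length; map; _++_; cartesianProductWith; upTo)
import Data.List.Membership.DecPropositional as DecMembership
open import Data.List.Membership.Propositional using (_∈_; _∉_)
open import Data.List.Membership.Propositional.Properties
  using (∈-cartesianProductWith⁺; ∈-cartesianProductWith⁻; ∈-map⁺; ∈-map⁻; ∈-upTo⁺; ∈-++⁻)
import Data.List.Properties as List
open import Data.List.Relation.Unary.All as All using (All; []; _∷_)
import Data.List.Relation.Unary.All.Properties as All
open import Data.List.Relation.Unary.AllPairs as AllPairs using (AllPairs; []; _∷_)
import Data.List.Relation.Unary.AllPairs.Properties as AllPairs
open import Data.List.Relation.Unary.Any using (here; there)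
open import Data.List.Relation.Unary.Unique.Propositional using (Unique)
open import Data.Maybe.Base using (Maybe; just; nothing)
open import Data.Nat.Base as ℕ using (ℕ; zero; suc; _≤_; _<_; z≤n; s≤s; _!)
open import Data.Nat.Combinatorics using (nCk≡n!/k![n-k]!; nCn≡1) renaming (_C_ to _choose_)
import Data.Nat.Combinatorics.Specification as Spec
open import Data.Nat.Divisibility as ℕ∣ using (_∣?_) renaming (_∣_ to _ℕ∣_)
open import Data.Nat.DivMod
  using (_/_; _%_; m≡m%n+[m/n]*n; m%n<n; m/n*n≡m; m/n*n≤m; m*n/n≡m; /-mono-≤; /-monoˡ-≤)
open import Data.Nat.GCD
  using (gcd; gcd[m,n]∣m; gcd[m,n]∣n; gcd-GCD; gcd-greatest; c*gcd[m,n]≡gcd[cm,cn]; module Bézout)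
open import Data.Nat.Induction using (<-rec)
open import Data.Nat.ListAction using (sum; product)
open import Data.Nat.ListAction.Properties using (∈⇒∣product)
open import Data.Nat.Primality
  using (Prime; euclidsLemma; prime⇒nonZero; prime⇒nonTrivial; prime⇒irreducible)
open import Data.Nat.Primality.Factorisation using (PrimeFactorisation; factorise)
import Data.Nat.Properties as ℕ
import Data.Nat.Solver
open import Data.Product.Base using (∃; _×_; _,_; proj₁; proj₂)
open import Data.Rational.Base as ℚ using (ℚ; 0ℚ; 1ℚ; toℚᵘ; ↥_; ↧_)
import Data.Rational.Properties as ℚ
open import Data.Rational.Unnormalised.Base as ℚᵘ using (mkℚᵘ; _≃_; *≡*)
import Data.Rational.Unnormalised.Properties as ℚᵘ
open import Data.Sum.Base as Sum using (_⊎_; inj₁; inj₂)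
open import Data.Vec.Base as Vec using (Vec; []; _∷_; lookup; toList; tabulate)
import Data.Vec.Properties as Vec
import Data.Vec.Relation.Unary.All as VAll
import Data.Vec.Relation.Unary.All.Properties as VAll
open import Data.Vec.Relation.Unary.Linked using (Linked; []; [-]; _∷_)
open import Function.Base using (_∘_)
open import Function.Bundles using (Equivalence)
open import Level using (0ℓ)
open import Relation.Binary.Definitions using (tri<; tri≈; tri>)
open import Relation.Binary.PropositionalEquality as ≡ using (_≡_; _≢_)
open import Relation.Nullary using (¬_; Dec; yes; no; does; ¬?)
open import Relation.Nullary.Decidable using (dec-true; dec-false; _×-dec_; ¬¬-excluded-middle)
open import Defs

open Data.Integer.Solver.+-*-Solver using () renaming
  (solve to solveℤ; _:+_ to _ℤ:+_; _:-_ to _ℤ:-_; _:*_ to _ℤ:*_; :-_ to ℤ:neg_; _:=_ to _ℤ:=_; con to ℤcon)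
open Data.Nat.Solver.+-*-Solver using () renaming
  (solve to solveℕ; _:+_ to _ℕ:+_; _:*_ to _ℕ:*_; _:=_ to _ℕ:=_; con to ℕcon)

-- Polynomials over a commutative ring

-- Everything stays inside ℤ[X]: no roots, field extensions or finite fields are constructed.
-- Coprimality is a Bézout relation with a nonzero integer constant, which monic divisors absorb,
-- and the conjugate roots of `Φ` are replaced by the residues `X^a` modulo a divisor of it.
--
-- The factors `h` of small degree are the obstacle. They are coprime over ℚ but may coincide modulo
-- p. There are only p^T reductions, and a coincidence becomes a high multiplicity of P modulo p,
-- which a polynomial with few terms cannot have away from 0 if its exponents are sufficiently
-- distinct modulo p. As X d/dX sees exponents only modulo p, genericity over ℤ would not do.
--
-- The constants p and T are fixed before N: nongeneric tuples cost a small multiple of N/p and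
-- factors of large degree one of N/T, while p^T no longer grows.
--
-- The properties counted come without decision procedures. Hence all bounds concern duplicate-free
-- lists, and double negations are harmless because the final inequality is decidable.

module PolyRing (R : CommutativeRing 0ℓ 0ℓ) where
  private module R = CommutativeRing R
  open import Algebra.Properties.Ring R.ring using (-1*x≈-x; -0#≈0#)
  open Polynomial R.rawRing public
    using (Poly; coeff; _+_; _·_; _-_; _⊛_; 0ₚ; 1ₚ; X^_; prod; divMonic)

  -- Unlike _≈_, a record type lets Agda infer p and q.
  infix 4 _≋_
  record _≋_ (p q : Poly) : Set where
    constructor mk≋
    field at : ∀ i → coeff p i R.≈ coeff q i
  open _≋_ public

  ≋-refl : ∀ {p} → p ≋ p
  ≋-refl .at i = R.refl

  ≋-sym : ∀ {p q} → p ≋ q → q ≋ p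
  ≋-sym e .at i = R.sym (at e i)

  ≋-trans : ∀ {p q r} → p ≋ q → q ≋ r → p ≋ r
  ≋-trans e f .at i = R.trans (at e i) (at f i)

  infixr 5 _∷≋_
  _∷≋_ : ∀ {a b p q} → a R.≈ b → p ≋ q → (a ∷ p) ≋ (b ∷ q)
  (e ∷≋ f) .at zero    = e
  (e ∷≋ f) .at (suc i) = at f i

  tail≋ : ∀ {a b p q} → (a ∷ p) ≋ (b ∷ q) → p ≋ q
  tail≋ e .at i = at e (suc i)

  tail≋0 : ∀ {a p} → (a ∷ p) ≋ [] → p ≋ []
  tail≋0 e .at i = at e (suc i)

  0∷[]≋[] : ∀ {a} → a R.≈ R.0# → (a ∷ []) ≋ []
  0∷[]≋[] e .at zero    = e
  0∷[]≋[] e .at (suc i) = R.refl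

  coeff-+ : ∀ p q i → coeff (p + q) i R.≈ coeff p i R.+ coeff q i
  coeff-+ []      q       i       = R.sym (R.+-identityˡ _)
  coeff-+ (a ∷ p) []      zero    = R.sym (R.+-identityʳ _)
  coeff-+ (a ∷ p) []      (suc i) = R.sym (R.+-identityʳ _)
  coeff-+ (a ∷ p) (b ∷ q) zero    = R.refl
  coeff-+ (a ∷ p) (b ∷ q) (suc i) = coeff-+ p q i

  coeff-· : ∀ c p i → coeff (c · p) i R.≈ c R.* coeff p i
  coeff-· c []      i       = R.sym (R.zeroʳ c)
  coeff-· c (a ∷ p) zero    = R.refl
  coeff-· c (a ∷ p) (suc i) = coeff-· c p i

  coeff-⊛-0 : ∀ p q → coeff (p ⊛ q) 0 R.≈ coeff p 0 R.* coeff q 0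
  coeff-⊛-0 []      q = R.sym (R.zeroˡ _)
  coeff-⊛-0 (a ∷ p) q = R.trans (coeff-+ (a · q) _ 0)
    (R.trans (R.+-cong (coeff-· a q 0) R.refl) (R.+-identityʳ _))

  coeff-⊛-suc : ∀ a p q i →
    coeff ((a ∷ p) ⊛ q) (suc i) R.≈ a R.* coeff q (suc i) R.+ coeff (p ⊛ q) i
  coeff-⊛-suc a p q i = R.trans (coeff-+ (a · q) _ (suc i)) (R.+-congʳ (coeff-· a q (suc i)))

  infix 8 -ₚ_
  -ₚ_ : Poly → Poly
  -ₚ p = (R.- R.1#) · p

  +-cong : ∀ {p p′ q q′} → p ≋ p′ → q ≋ q′ → p + q ≋ p′ + q′
  +-cong {p} {p′} {q} {q′} e f .at i = R.trans (coeff-+ p q i)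
    (R.trans (R.+-cong (at e i) (at f i)) (R.sym (coeff-+ p′ q′ i)))

  ·-cong : ∀ {a b p q} → a R.≈ b → p ≋ q → a · p ≋ b · q
  ·-cong {a} {b} {p} {q} e f .at i = R.trans (coeff-· a p i)
    (R.trans (R.*-cong e (at f i)) (R.sym (coeff-· b q i)))

  +-assoc : ∀ p q r → (p + q) + r ≋ p + (q + r)
  +-assoc p q r .at i = R.trans (coeff-+ (p + q) r i)
    (R.trans (R.+-congʳ (coeff-+ p q i))
    (R.trans (R.+-assoc _ _ _)
    (R.trans (R.+-congˡ (R.sym (coeff-+ q r i))) (R.sym (coeff-+ p (q + r) i)))))

  +-comm : ∀ p q → p + q ≋ q + p
  +-comm p q .at i = R.trans (coeff-+ p q i) (R.trans (R.+-comm _ _) (R.sym (coeff-+ q p i)))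

  +-identityʳ : ∀ p → p + [] ≋ p
  +-identityʳ []      = ≋-refl
  +-identityʳ (a ∷ p) = ≋-refl

  -‿inverseˡ : ∀ p → -ₚ p + p ≋ []
  -‿inverseˡ p .at i = R.trans (coeff-+ (-ₚ p) p i)
    (R.trans (R.+-congʳ (R.trans (coeff-· _ p i) (-1*x≈-x _))) (R.-‿inverseˡ _))

  ·-distrib-+ : ∀ c p q → c · (p + q) ≋ c · p + c · q
  ·-distrib-+ c p q .at i = R.trans (coeff-· c (p + q) i)
    (R.trans (R.*-congˡ (coeff-+ p q i))
    (R.trans (R.distribˡ _ _ _)
    (R.trans (R.+-cong (R.sym (coeff-· c p i)) (R.sym (coeff-· c q i)))
      (R.sym (coeff-+ (c · p) (c · q) i)))))

  ·-assoc : ∀ a b p → (a R.* b) · p ≋ a · (b · p)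
  ·-assoc a b p .at i = R.trans (coeff-· (a R.* b) p i) (R.trans (R.*-assoc _ _ _)
    (R.sym (R.trans (coeff-· a (b · p) i) (R.*-congˡ (coeff-· b p i)))))

  ·-zeroˡ : ∀ p → R.0# · p ≋ []
  ·-zeroˡ p .at i = R.trans (coeff-· R.0# p i) (R.zeroˡ _)

  ·-identityˡ : ∀ p → R.1# · p ≋ p
  ·-identityˡ p .at i = R.trans (coeff-· R.1# p i) (R.*-identityˡ _)

  +-swapˡ : ∀ p q r → p + (q + r) ≋ q + (p + r)
  +-swapˡ p q r = ≋-trans (≋-sym (+-assoc p q r))
    (≋-trans (+-cong (+-comm p q) ≋-refl) (+-assoc q p r))

  +-inter : ∀ p q r s → (p + q) + (r + s) ≋ (p + r) + (q + s)
  +-inter p q r s = ≋-trans (+-assoc p q (r + s))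
    (≋-trans (+-cong (≋-refl {p}) (+-swapˡ q r s)) (≋-sym (+-assoc p r (q + s))))

  0∷-+ : ∀ p q → (R.0# ∷ (p + q)) ≋ (R.0# ∷ p) + (R.0# ∷ q)
  0∷-+ p q = R.sym (R.+-identityˡ _) ∷≋ ≋-refl

  ⊛-zeroˡ : ∀ {p} q → p ≋ [] → p ⊛ q ≋ []
  ⊛-zeroˡ {[]}    q e = ≋-refl
  ⊛-zeroˡ {a ∷ p} q e = ≋-trans
    (+-cong (≋-trans (·-cong (at e 0) ≋-refl) (·-zeroˡ q)) ≋-refl)
    (≋-trans (R.refl ∷≋ ⊛-zeroˡ q (tail≋0 e)) (0∷[]≋[] R.refl))

  ⊛-congˡ : ∀ p {q q′} → q ≋ q′ → p ⊛ q ≋ p ⊛ q′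
  ⊛-congˡ []      e = ≋-refl
  ⊛-congˡ (a ∷ p) e = +-cong (·-cong R.refl e) (R.refl ∷≋ ⊛-congˡ p e)

  ⊛-congʳ : ∀ {p p′} q → p ≋ p′ → p ⊛ q ≋ p′ ⊛ q
  ⊛-congʳ {[]}    {p′}      q e = ≋-sym (⊛-zeroˡ q (≋-sym e))
  ⊛-congʳ {a ∷ p} {[]}      q e = ⊛-zeroˡ q e
  ⊛-congʳ {a ∷ p} {b ∷ p′} q e =
    +-cong (·-cong (at e 0) ≋-refl) (R.refl ∷≋ ⊛-congʳ q (tail≋ e))

  ⊛-cong : ∀ {p p′ q q′} → p ≋ p′ → q ≋ q′ → p ⊛ q ≋ p′ ⊛ q′
  ⊛-cong {p′ = p′} {q} e f = ≋-trans (⊛-congʳ q e) (⊛-congˡ p′ f)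

  ⊛-distribˡ : ∀ p q r → p ⊛ (q + r) ≋ p ⊛ q + p ⊛ r
  ⊛-distribˡ []      q r = ≋-refl
  ⊛-distribˡ (a ∷ p) q r = ≋-trans
    (+-cong (·-distrib-+ a q r) (≋-trans (R.refl ∷≋ ⊛-distribˡ p q r) (0∷-+ (p ⊛ q) (p ⊛ r))))
    (+-inter (a · q) (a · r) (R.0# ∷ p ⊛ q) (R.0# ∷ p ⊛ r))

  ⊛-zeroʳ : ∀ p → p ⊛ [] ≋ []
  ⊛-zeroʳ []      = ≋-refl
  ⊛-zeroʳ (a ∷ p) = ≋-trans (R.refl ∷≋ ⊛-zeroʳ p) (0∷[]≋[] R.refl)

  ⊛-∷ʳ : ∀ p b q → p ⊛ (b ∷ q) ≋ b · p + (R.0# ∷ p ⊛ q)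
  ⊛-∷ʳ []      b q = ≋-sym (0∷[]≋[] R.refl)
  ⊛-∷ʳ (a ∷ p) b q = R.+-congʳ (R.*-comm a b) ∷≋
    ≋-trans (+-cong ≋-refl (⊛-∷ʳ p b q)) (+-swapˡ (a · q) (b · p) (R.0# ∷ p ⊛ q))

  ⊛-comm : ∀ p q → p ⊛ q ≋ q ⊛ p
  ⊛-comm []      q = ≋-sym (⊛-zeroʳ q)
  ⊛-comm (a ∷ p) q = ≋-trans (+-cong ≋-refl (R.refl ∷≋ ⊛-comm p q)) (≋-sym (⊛-∷ʳ q a p))

  ⊛-distribʳ : ∀ p q r → (q + r) ⊛ p ≋ q ⊛ p + r ⊛ p
  ⊛-distribʳ p q r = ≋-trans (⊛-comm (q + r) p)
    (≋-trans (⊛-distribˡ p q r) (+-cong (⊛-comm p q) (⊛-comm p r)))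

  ·-⊛ : ∀ c p q → (c · p) ⊛ q ≋ c · (p ⊛ q)
  ·-⊛ c []      q = ≋-refl
  ·-⊛ c (a ∷ p) q = ≋-trans
    (+-cong (·-assoc c a q) (R.sym (R.zeroʳ c) ∷≋ ·-⊛ c p q))
    (≋-sym (·-distrib-+ c (a · q) (R.0# ∷ p ⊛ q)))

  0∷-⊛ : ∀ p q → (R.0# ∷ p) ⊛ q ≋ R.0# ∷ (p ⊛ q)
  0∷-⊛ p q = +-cong (·-zeroˡ q) ≋-refl

  ⊛-assoc : ∀ p q r → (p ⊛ q) ⊛ r ≋ p ⊛ (q ⊛ r)
  ⊛-assoc []      q r = ≋-refl
  ⊛-assoc (a ∷ p) q r = ≋-trans (⊛-distribʳ r (a · q) (R.0# ∷ p ⊛ q))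
    (+-cong (·-⊛ a q r) (≋-trans (0∷-⊛ (p ⊛ q) r) (R.refl ∷≋ ⊛-assoc p q r)))

  ⊛-identityˡ : ∀ p → 1ₚ ⊛ p ≋ p
  ⊛-identityˡ p = ≋-trans (+-cong (·-identityˡ p) (0∷[]≋[] R.refl)) (+-identityʳ p)

  polyRing : CommutativeRing 0ℓ 0ℓ
  polyRing = record
    { Carrier = Poly ; _≈_ = _≋_ ; _+_ = _+_ ; _*_ = _⊛_ ; -_ = -ₚ_ ; 0# = 0ₚ ; 1# = 1ₚ
    ; isCommutativeRing = record
      { isRing = record
        { +-isAbelianGroup = record
          { isGroup = record
            { isMonoid = record
              { isSemigroup = record
                { isMagma = record
                  { isEquivalence = record { refl = ≋-refl ; sym = ≋-sym ; trans = ≋-trans }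
                  ; ∙-cong = +-cong }
                ; assoc = +-assoc }
              ; identity = (λ p → ≋-refl) , +-identityʳ }
            ; inverse = -‿inverseˡ , λ p → ≋-trans (+-comm p (-ₚ p)) (-‿inverseˡ p)
            ; ⁻¹-cong = ·-cong R.refl }
          ; comm = +-comm }
        ; *-cong = ⊛-cong
        ; *-assoc = ⊛-assoc
        ; *-identity = ⊛-identityˡ , λ p → ≋-trans (⊛-comm p 1ₚ) (⊛-identityˡ p)
        ; distrib = ⊛-distribˡ , ⊛-distribʳ }
      ; *-comm = ⊛-comm } }

  coeff-neg : ∀ p i → coeff (-ₚ p) i R.≈ R.- coeff p i
  coeff-neg p i = R.trans (coeff-· _ p i) (-1*x≈-x _)

  Deg< : ℕ → Poly → Set
  Deg< n p = ∀ i → n ≤ i → coeff p i R.≈ R.0#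

  Deg<-length : ∀ p → Deg< (length p) p
  Deg<-length []      i       _       = R.refl
  Deg<-length (a ∷ p) (suc i) (s≤s l) = Deg<-length p i l

  Deg<-mono : ∀ {m n p} → m ≤ n → Deg< m p → Deg< n p
  Deg<-mono m≤n d i n≤i = d i (ℕ.≤-trans m≤n n≤i)

  Deg<-resp : ∀ {n p q} → p ≋ q → Deg< n p → Deg< n q
  Deg<-resp e d i n≤i = R.trans (R.sym (at e i)) (d i n≤i)

  Deg<0⇒≋0 : ∀ {p} → Deg< 0 p → p ≋ []
  Deg<0⇒≋0 d .at i = d i z≤n

  Deg<-+ : ∀ {n} p q → Deg< n p → Deg< n q → Deg< n (p + q)
  Deg<-+ p q d e i l = R.trans (coeff-+ p q i) (R.trans (R.+-cong (d i l) (e i l)) (R.+-identityˡ _))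

  Deg<-pred : ∀ {n p} → Deg< (suc n) p → coeff p n R.≈ R.0# → Deg< n p
  Deg<-pred {n} d z i n≤i with n ℕ.≟ i
  ... | yes ≡.refl = z
  ... | no n≢i     = d i (ℕ.≤∧≢⇒< n≤i n≢i)

  coeff-⊛-top : ∀ p q a b → Deg< (suc a) p → Deg< (suc b) q →
                coeff (p ⊛ q) (a ℕ.+ b) R.≈ coeff p a R.* coeff q b
  coeff-⊛-top []      q a       b dp dq = R.sym (R.zeroˡ _)
  coeff-⊛-top (x ∷ p) q zero    zero    dp dq = coeff-⊛-0 (x ∷ p) q
  coeff-⊛-top (x ∷ p) q zero    (suc b) dp dq = R.trans (coeff-⊛-suc x p q b)
    (R.trans (R.+-congˡ (at (⊛-zeroˡ {p} q (Deg<0⇒≋0 λ i _ → dp (suc i) (s≤s z≤n))) b)) (R.+-identityʳ _))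
  coeff-⊛-top (x ∷ p) q (suc a) b dp dq = R.trans (coeff-⊛-suc x p q (a ℕ.+ b))
    (R.trans (R.+-cong (R.trans (R.*-congˡ (dq _ (s≤s (ℕ.m≤n+m b a)))) (R.zeroʳ x))
                       (coeff-⊛-top p q a b (λ i l → dp (suc i) (s≤s l)) dq))
             (R.+-identityˡ _))

  Deg<-⊛ : ∀ p q a b → Deg< (suc a) p → Deg< (suc b) q → Deg< (suc (a ℕ.+ b)) (p ⊛ q)
  Deg<-⊛ []      q a b dp dq i       l = R.refl
  Deg<-⊛ (x ∷ p) q a b dp dq (suc i) (s≤s l) = R.trans (coeff-⊛-suc x p q i)
    (R.trans (R.+-cong (R.trans (R.*-congˡ (dq _ (s≤s (ℕ.≤-trans (ℕ.m≤n+m b a) l)))) (R.zeroʳ x))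
                       (rest a dp l))
             (R.+-identityˡ _))
    where
    rest : ∀ a → Deg< (suc a) (x ∷ p) → a ℕ.+ b ≤ i → coeff (p ⊛ q) i R.≈ R.0#
    rest zero    dp l = at (⊛-zeroˡ {p} q (Deg<0⇒≋0 λ i _ → dp (suc i) (s≤s z≤n))) i
    rest (suc a) dp l = Deg<-⊛ p q a b (λ i l → dp (suc i) (s≤s l)) dq i l

  record Monic (d : ℕ) (p : Poly) : Set where
    constructor monic
    field
      lead  : coeff p d R.≈ R.1#
      above : Deg< (suc d) p
  open Monic public

  Monic-resp : ∀ {d p q} → p ≋ q → Monic d p → Monic d q
  Monic-resp {d} e (monic l a) = monic (R.trans (R.sym (at e d)) l) (Deg<-resp e a)

  Monic-⊛ : ∀ {c d p q} → Monic c p → Monic d q → Monic (c ℕ.+ d) (p ⊛ q)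
  Monic-⊛ {c} {d} {p} {q} (monic l a) (monic l′ a′) = monic
    (R.trans (coeff-⊛-top p q c d a a′) (R.trans (R.*-cong l l′) (R.*-identityˡ _)))
    (Deg<-⊛ p q c d a a′)

  Monic-1 : Monic 0 1ₚ
  Monic-1 = monic R.refl (λ { (suc i) _ → R.refl })

  Monic0⇒≋1 : ∀ {p} → Monic 0 p → p ≋ 1ₚ
  Monic0⇒≋1 (monic l a) .at zero    = l
  Monic0⇒≋1 (monic l a) .at (suc i) = a (suc i) (s≤s z≤n)

  divMonic-spec : ∀ {m d} → Monic m d → ∀ p →
    let (q , r) = divMonic m d p in p ≋ q ⊛ d + r × Deg< m r
  divMonic-spec {m} {d} M []      = ≋-refl , λ _ _ → R.refl
  divMonic-spec {m} {d} M (a ∷ p) with divMonic-spec M p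
  ... | e , dr = ≋-sym quot , low
    where
    module G = CommutativeRing polyRing
    open import Algebra.Properties.AbelianGroup G.+-abelianGroup using (xyx⁻¹≈y)
    q = proj₁ (divMonic m d p)
    r = proj₂ (divMonic m d p)
    c = coeff (a ∷ r) m
    u = c · d
    Z = R.0# ∷ q ⊛ d
    Y = a ∷ r
    quot : (u + Z) + (Y + -ₚ u) ≋ a ∷ p
    quot = ≋-trans (≋-sym (+-assoc (u + Z) Y (-ₚ u)))
      (≋-trans (+-cong (+-assoc u Z Y) ≋-refl)
      (≋-trans (xyx⁻¹≈y u (Z + Y)) (R.+-identityˡ a ∷≋ ≋-sym e)))
    low : Deg< m (Y + -ₚ u)
    low i m≤i = R.trans (coeff-+ Y (-ₚ u) i)
      (R.trans (R.+-congˡ (R.trans (coeff-neg u i) (R.-‿cong (coeff-· c d i)))) (go i m≤i))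
      where
      go : ∀ i → m ≤ i → coeff Y i R.+ R.- (c R.* coeff d i) R.≈ R.0#
      go i m≤i with m ℕ.≟ i
      ... | yes ≡.refl = R.trans (R.+-congˡ (R.-‿cong (R.trans (R.*-congˡ (lead M)) (R.*-identityʳ c))))
                           (R.-‿inverseʳ c)
      go zero    m≤i | no m≢i = ⊥-elim (m≢i (ℕ.n≤0⇒n≡0 m≤i))
      go (suc i) m≤i | no m≢i = R.trans
        (R.+-cong (dr i (ℕ.≤-pred m<i))
          (R.trans (R.-‿cong (R.trans (R.*-congˡ (above M (suc i) m<i)) (R.zeroʳ c))) -0#≈0#))
        (R.+-identityˡ _)
        where m<i = ℕ.≤∧≢⇒< m≤i m≢i

  -- Descends on a degree bound of `q`: its coefficient in degree `n` reappears in degree `n + m` of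
  -- the product, multiplied by the leading 1 of `d`, and there `low` makes it vanish.
  monic-low : ∀ {m d} → Monic m d → ∀ q → Deg< m (q ⊛ d) → q ≋ []
  monic-low {m} {d} M q low = Deg<0⇒≋0 (go (length q) (Deg<-length q))
    where
    go : ∀ n → Deg< n q → Deg< 0 q
    go zero    dq = dq
    go (suc n) dq = go n (Deg<-pred {p = q} dq (R.trans (R.sym (R.*-identityʳ _))
      (R.trans (R.*-congˡ (R.sym (lead M))) (R.trans (R.sym (coeff-⊛-top q d n m dq (above M)))
        (low (n ℕ.+ m) (ℕ.m≤n+m m n))))))

  Deg<-X^ : ∀ n → Deg< (suc n) (X^ n)
  Deg<-X^ zero    (suc i) _       = R.refl
  Deg<-X^ (suc n) (suc i) (s≤s l) = Deg<-X^ n i l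

  Monic-X^ : ∀ n → Monic n (X^ n)
  Monic-X^ n = monic (go n) (Deg<-X^ n)
    where
    go : ∀ n → coeff (X^ n) n R.≈ R.1#
    go zero    = R.refl
    go (suc n) = go n

-- The ring ℤ[X]

module Z = PolyRing ℤ.+-*-commutativeRing
open Z using (_≋_; mk≋; at; ≋-refl; ≋-sym; ≋-trans; Deg<; Deg<-mono; Deg<-pred; Deg<-resp;
  Monic; monic; lead; above; Monic-resp; Monic0⇒≋1)
open ℤ[X] using () renaming (Poly to Pol; coeff to co)

-- Opaque, so that implicit arguments under these operations can be inferred.
opaque
  infixl 6 _⊕_
  infixl 7 _⊗_
  infix  8 ⊖_
  _⊕_ _⊗_ : Pol → Pol → Pol
  _⊕_ = ℤ[X]._+_
  _⊗_ = ℤ[X]._⊛_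

  ⊖_ : Pol → Pol
  ⊖_ = Z.-ₚ_

  C : ℤ → Pol
  C a = a ∷ []

  X : ℕ → Pol
  X n = ℤ[X].X^ n

  𝟘 : Pol
  𝟘 = []

𝟙 : Pol
𝟙 = C (+ 1)

opaque
  unfolding _⊕_
  ZX-isCommutativeRing : IsCommutativeRing _≋_ _⊕_ _⊗_ ⊖_ 𝟘 𝟙
  ZX-isCommutativeRing = CommutativeRing.isCommutativeRing Z.polyRing

  ⊕-def : ∀ f g → f ℤ[X].+ g ≡ f ⊕ g
  ⊕-def f g = ≡.refl

  ⊗-def : ∀ f g → f ℤ[X].⊛ g ≡ f ⊗ g
  ⊗-def f g = ≡.refl

  X-def : ∀ n → ℤ[X].X^ n ≡ X n
  X-def n = ≡.refl

  𝟙-def : ℤ[X].1ₚ ≡ 𝟙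
  𝟙-def = ≡.refl

  C-def : ∀ a → a ∷ [] ≡ C a
  C-def a = ≡.refl

  𝟘-def : [] ≡ 𝟘
  𝟘-def = ≡.refl

  X^n-1-def : ∀ n → (ℤ[X].X^ n) ℤ[X].- ℤ[X].1ₚ ≡ X n ⊕ ⊖ 𝟙
  X^n-1-def n = ≡.refl

  co-⊕ : ∀ f g i → co (f ⊕ g) i ≡ co f i ℤ.+ co g i
  co-⊕ = Z.coeff-+

  co-⊖ : ∀ f i → co (⊖ f) i ≡ ℤ.- co f i
  co-⊖ = Z.coeff-neg

  co-⊗-0 : ∀ f g → co (f ⊗ g) 0 ≡ co f 0 ℤ.* co g 0
  co-⊗-0 = Z.coeff-⊛-0

  co-C⊗ : ∀ a f i → co (C a ⊗ f) i ≡ a ℤ.* co f i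
  co-C⊗ a f i = ≡.trans (Z.coeff-+ (a ℤ[X].· f) (+ 0 ∷ []) i)
    (≡.trans (≡.cong₂ ℤ._+_ (Z.coeff-· a f i) (at (Z.0∷[]≋[] {+ 0} ≡.refl) i)) (ℤ.+-identityʳ _))

  co-𝟘 : ∀ i → co 𝟘 i ≡ + 0
  co-𝟘 i = ≡.refl

  co-C-0 : ∀ a → co (C a) 0 ≡ a
  co-C-0 a = ≡.refl

  co-C-suc : ∀ a i → co (C a) (suc i) ≡ + 0
  co-C-suc a i = ≡.refl

  co-X≡ : ∀ n → co (X n) n ≡ + 1
  co-X≡ n = Z.lead (Z.Monic-X^ n)

  co-X≢ : ∀ n i → n ≢ i → co (X n) i ≡ + 0
  co-X≢ zero    zero    ne = ⊥-elim (ne ≡.refl)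
  co-X≢ zero    (suc i) ne = ≡.refl
  co-X≢ (suc n) zero    ne = ≡.refl
  co-X≢ (suc n) (suc i) ne = co-X≢ n i (λ e → ne (≡.cong suc e))

  Monic-X : ∀ n → Monic n (X n)
  Monic-X = Z.Monic-X^

  Monic-𝟙 : Monic 0 𝟙
  Monic-𝟙 = Z.Monic-1

  Monic-⊗ : ∀ {c d f g} → Monic c f → Monic d g → Monic (c ℕ.+ d) (f ⊗ g)
  Monic-⊗ = Z.Monic-⊛

  Deg<-⊕ : ∀ {n} f g → Deg< n f → Deg< n g → Deg< n (f ⊕ g)
  Deg<-⊕ = Z.Deg<-+

  Deg<-⊗ : ∀ f g a b → Deg< (suc a) f → Deg< (suc b) g → Deg< (suc (a ℕ.+ b)) (f ⊗ g)
  Deg<-⊗ = Z.Deg<-⊛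

  co-⊗-top : ∀ f g a b → Deg< (suc a) f → Deg< (suc b) g →
             co (f ⊗ g) (a ℕ.+ b) ≡ co f a ℤ.* co g b
  co-⊗-top = Z.coeff-⊛-top

  ∷-def : ∀ a f → a ∷ f ≋ C a ⊕ X 1 ⊗ f
  ∷-def a f = ≋-sym (≋-trans (Z.+-cong (≋-refl {a ∷ []}) (Z.0∷-⊛ (+ 1 ∷ []) f))
    (ℤ.+-identityʳ a Z.∷≋ Z.⊛-identityˡ f))

  C-+ : ∀ a b → C (a ℤ.+ b) ≋ C a ⊕ C b
  C-+ a b = ≋-refl

  C-* : ∀ a b → C (a ℤ.* b) ≋ C a ⊗ C b
  C-* a b = ≡.sym (ℤ.+-identityʳ _) Z.∷≋ ≋-refl

  C-neg : ∀ a → C (ℤ.- a) ≋ ⊖ C a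
  C-neg a = ≡.sym (ℤ.-1*i≡-i a) Z.∷≋ ≋-refl

  C-0 : C (+ 0) ≋ 𝟘
  C-0 = Z.0∷[]≋[] ≡.refl

  X-0 : X 0 ≋ 𝟙
  X-0 = ≋-refl

  X-+ : ∀ m n → X (m ℕ.+ n) ≋ X m ⊗ X n
  X-+ zero    n = ≋-sym (Z.⊛-identityˡ (X n))
  X-+ (suc m) n = ≋-sym (≋-trans (Z.0∷-⊛ (X m) (X n)) (≡.refl Z.∷≋ ≋-sym (X-+ m n)))

  divMonic-correct : ∀ {m d} → Monic m d → ∀ f →
    let (q , r) = ℤ[X].divMonic m d f in f ≋ q ⊗ d ⊕ r × Deg< m r
  divMonic-correct M f = Z.divMonic-spec M f

  monic-low : ∀ {m d} → Monic m d → ∀ q → Deg< m (q ⊗ d) → q ≋ 𝟘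
  monic-low M q low = Z.monic-low M q low

ZX : CommutativeRing 0ℓ 0ℓ
ZX = record { isCommutativeRing = ZX-isCommutativeRing }

module ZX = CommutativeRing ZX

private
  C-morphism : ℤ.+-*-rawRing ACR.-Raw-AlmostCommutative⟶ ACR.fromCommutativeRing ZX
  C-morphism = record
    { ⟦_⟧ = C ; +-homo = C-+ ; *-homo = C-* ; -‿homo = C-neg ; 0-homo = C-0 ; 1-homo = ≋-refl }

  C-≟ : ∀ a b → Maybe (C a ≋ C b)
  C-≟ a b with a ℤ.≟ b
  ... | yes ≡.refl = just ≋-refl
  ... | no _       = nothing

module Solver = Algebra.Solver.Ring ℤ.+-*-rawRing (ACR.fromCommutativeRing ZX) C-morphism C-≟
open Solver using (solve; _:=_; _:+_; _:*_; :-_; con)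

open import Relation.Binary.Reasoning.Setoid ZX.setoid using (begin_; step-≈-⟩; step-≈-⟨; _∎)
open import Algebra.Properties.Semiring.Exp ZX.semiring using (_^_; ^-congˡ; ^-homo-*)

≡⇒≋ : ∀ {f g : Pol} → f ≡ g → f ≋ g
≡⇒≋ ≡.refl = ≋-refl

⊕-cong : ∀ {f f′ g g′} → f ≋ f′ → g ≋ g′ → f ⊕ g ≋ f′ ⊕ g′
⊕-cong = ZX.+-cong

⊗-cong : ∀ {f f′ g g′} → f ≋ f′ → g ≋ g′ → f ⊗ g ≋ f′ ⊗ g′
⊗-cong = ZX.*-cong

⊖-cong : ∀ {f f′} → f ≋ f′ → ⊖ f ≋ ⊖ f′
⊖-cong = ZX.-‿cong

⊕-congˡ : ∀ {f g g′} → g ≋ g′ → f ⊕ g ≋ f ⊕ g′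
⊕-congˡ = ⊕-cong ≋-refl
⊕-congʳ : ∀ {f f′ g} → f ≋ f′ → f ⊕ g ≋ f′ ⊕ g
⊕-congʳ e = ⊕-cong e ≋-refl
⊗-congˡ : ∀ {f g g′} → g ≋ g′ → f ⊗ g ≋ f ⊗ g′
⊗-congˡ = ⊗-cong ≋-refl
⊗-congʳ : ∀ {f f′ g} → f ≋ f′ → f ⊗ g ≋ f′ ⊗ g
⊗-congʳ e = ⊗-cong e ≋-refl

x-y≋𝟘⇒x≋y : ∀ f g → f ⊕ ⊖ g ≋ 𝟘 → f ≋ g
x-y≋𝟘⇒x≋y f g e = begin
  f             ≈⟨ solve 2 (λ f g → f := (f :+ :- g) :+ g) ≋-refl f g ⟩
  f ⊕ ⊖ g ⊕ g   ≈⟨ ⊕-congʳ e ⟩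
  𝟘 ⊕ g         ≈⟨ ZX.+-identityˡ g ⟩
  g             ∎

C-injective : ∀ {a b} → C a ≋ C b → a ≡ b
C-injective {a} {b} e = ≡.trans (≡.sym (co-C-0 a)) (≡.trans (at e 0) (co-C-0 b))

C≋𝟘⇒≡0 : ∀ {a} → C a ≋ 𝟘 → a ≡ + 0
C≋𝟘⇒≡0 e = C-injective (≋-trans e (≋-sym C-0))

-- Divisibility, degrees and coprimality in ℤ[X]

infix 4 _∣ₚ_
record _∣ₚ_ (f g : Pol) : Set where
  constructor divides
  field
    quo : Pol
    eqn : quo ⊗ f ≋ g

∣ₚ-refl : ∀ {f} → f ∣ₚ f
∣ₚ-refl {f} = divides 𝟙 (ZX.*-identityˡ f)

∣ₚ-trans : ∀ {f g h} → f ∣ₚ g → g ∣ₚ h → f ∣ₚ h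
∣ₚ-trans {f} {g} {h} (divides q e) (divides q′ e′) = divides (q′ ⊗ q)
  (≋-trans (ZX.*-assoc q′ q f) (≋-trans (⊗-congˡ e) e′))

∣ₚ-respʳ : ∀ {f g h} → g ≋ h → f ∣ₚ g → f ∣ₚ h
∣ₚ-respʳ e (divides q e′) = divides q (≋-trans e′ e)

∣ₚ-respˡ : ∀ {f g h} → f ≋ g → f ∣ₚ h → g ∣ₚ h
∣ₚ-respˡ e (divides q e′) = divides q (≋-trans (⊗-congˡ (≋-sym e)) e′)

∣ₚ-⊗ˡ : ∀ {f g} h → f ∣ₚ g → f ∣ₚ h ⊗ g
∣ₚ-⊗ˡ {f} h (divides q e) = divides (h ⊗ q) (≋-trans (ZX.*-assoc h q f) (⊗-congˡ e))

∣ₚ-⊗ʳ : ∀ {f g} h → f ∣ₚ g → f ∣ₚ g ⊗ h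
∣ₚ-⊗ʳ {g = g} h d = ∣ₚ-respʳ (ZX.*-comm h g) (∣ₚ-⊗ˡ h d)

f∣ₚf⊗g : ∀ f g → f ∣ₚ f ⊗ g
f∣ₚf⊗g f g = ∣ₚ-⊗ʳ g ∣ₚ-refl

g∣ₚf⊗g : ∀ f g → g ∣ₚ f ⊗ g
g∣ₚf⊗g f g = ∣ₚ-⊗ˡ f ∣ₚ-refl

∣ₚ-⊕ : ∀ {f g h} → f ∣ₚ g → f ∣ₚ h → f ∣ₚ g ⊕ h
∣ₚ-⊕ {f} (divides q e) (divides q′ e′) = divides (q ⊕ q′)
  (≋-trans (ZX.distribʳ f q q′) (⊕-cong e e′))

∣ₚ-⊖ : ∀ {f g} → f ∣ₚ g → f ∣ₚ ⊖ g
∣ₚ-⊖ {f} {g} (divides q e) = divides (⊖ q)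
  (≋-trans (solve 2 (λ q f → (:- q) :* f := :- (q :* f)) ≋-refl q f) (⊖-cong e))

∣ₚ-𝟘 : ∀ {f} → f ∣ₚ 𝟘
∣ₚ-𝟘 {f} = divides 𝟘 (ZX.zeroˡ f)

∣ₚ-⊕-cancelˡ : ∀ {f g h} → f ∣ₚ g → f ∣ₚ g ⊕ h → f ∣ₚ h
∣ₚ-⊕-cancelˡ {f} {g} {h} d e = ∣ₚ-respʳ
  (solve 2 (λ g h → (g :+ h) :+ :- g := h) ≋-refl g h) (∣ₚ-⊕ e (∣ₚ-⊖ d))

Deg<-⊖ : ∀ {n} f → Deg< n f → Deg< n (⊖ f)
Deg<-⊖ f d i l = ≡.trans (co-⊖ f i) (≡.cong ℤ.-_ (d i l))

Deg<-C⊗ : ∀ {n} a f → Deg< n f → Deg< n (C a ⊗ f)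
Deg<-C⊗ a f d i l = ≡.trans (co-C⊗ a f i) (≡.trans (≡.cong (a ℤ.*_) (d i l)) (ℤ.*-zeroʳ a))

Deg<0⇒≋𝟘 : ∀ {f} → Deg< 0 f → f ≋ 𝟘
Deg<0⇒≋𝟘 d .at i = ≡.trans (d i z≤n) (≡.sym (co-𝟘 i))

HasDegree : Pol → ℕ → Set
HasDegree f d = co f d ≢ + 0 × Deg< (suc d) f

degreeView : ∀ f → f ≋ 𝟘 ⊎ ∃ (HasDegree f)
degreeView f = go (length f) (Z.Deg<-length f)
  where
  go : ∀ n → Deg< n f → f ≋ 𝟘 ⊎ ∃ (HasDegree f)
  go zero    d = inj₁ (Deg<0⇒≋𝟘 d)
  go (suc n) d with co f n ℤ.≟ + 0
  ... | yes z = go n (Deg<-pred {p = f} d z)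
  ... | no nz = inj₂ (n , nz , d)

Monic⇒HasDegree : ∀ {d f} → Monic d f → HasDegree f d
Monic⇒HasDegree (monic l a) = (λ z → case (≡.trans (≡.sym l) z)) , a
  where
  case : + 1 ≢ + 0
  case ()

HasDegree-unique : ∀ {f d e} → HasDegree f d → HasDegree f e → d ≡ e
HasDegree-unique {f} {d} {e} (nd , ad) (ne , ae) with ℕ.<-cmp d e
... | tri< l _ _ = ⊥-elim (ne (ad e l))
... | tri≈ _ eq _ = eq
... | tri> _ _ l = ⊥-elim (nd (ae d l))

HasDegree-⊗ : ∀ {f g a b} → HasDegree f a → HasDegree g b → HasDegree (f ⊗ g) (a ℕ.+ b)
HasDegree-⊗ {f} {g} {a} {b} (nf , df) (ng , dg) =
  (λ z → case (ℤ.i*j≡0⇒i≡0∨j≡0 (co f a) (≡.trans (≡.sym (co-⊗-top f g a b df dg)) z))) ,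
  Deg<-⊗ f g a b df dg
  where
  case : co f a ≡ + 0 ⊎ co g b ≡ + 0 → ⊥
  case (inj₁ z) = nf z
  case (inj₂ z) = ng z

HasDegree⇒≢𝟘 : ∀ {f d} → HasDegree f d → ¬ f ≋ 𝟘
HasDegree⇒≢𝟘 {f} {d} (n , _) e = n (≡.trans (at e d) (co-𝟘 d))

⊗≋𝟘 : ∀ f g → f ⊗ g ≋ 𝟘 → f ≋ 𝟘 ⊎ g ≋ 𝟘
⊗≋𝟘 f g e with degreeView f | degreeView g
... | inj₁ z       | _            = inj₁ z
... | inj₂ _       | inj₁ z       = inj₂ z
... | inj₂ (a , α) | inj₂ (b , β) = ⊥-elim (HasDegree⇒≢𝟘 (HasDegree-⊗ {f} {g} α β) e)

⊗-cancelˡ : ∀ f {g h} → ¬ f ≋ 𝟘 → f ⊗ g ≋ f ⊗ h → g ≋ h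
⊗-cancelˡ f {g} {h} nz e with ⊗≋𝟘 f (g ⊕ ⊖ h) (begin
  f ⊗ (g ⊕ ⊖ h)      ≈⟨ solve 3 (λ f g h → f :* (g :+ :- h) := f :* g :+ :- (f :* h)) ≋-refl f g h ⟩
  f ⊗ g ⊕ ⊖ (f ⊗ h)  ≈⟨ ⊕-congʳ e ⟩
  f ⊗ h ⊕ ⊖ (f ⊗ h)  ≈⟨ ZX.-‿inverseʳ _ ⟩
  𝟘                  ∎)
... | inj₁ z = ⊥-elim (nz z)
... | inj₂ z = x-y≋𝟘⇒x≋y g h z

Monic⇒≢𝟘 : ∀ {d f} → Monic d f → ¬ f ≋ 𝟘
Monic⇒≢𝟘 M = HasDegree⇒≢𝟘 (Monic⇒HasDegree M)

Monic-quotient : ∀ {n m f g} → Monic m g → Monic n (f ⊗ g) →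
                 ∃ λ e → Monic e f × e ℕ.+ m ≡ n
Monic-quotient {n} {m} {f} {g} Mg Mfg with degreeView f
... | inj₁ z = ⊥-elim (Monic⇒≢𝟘 Mfg (≋-trans (⊗-congʳ z) (ZX.zeroˡ g)))
... | inj₂ (e , ef) with HasDegree-unique {f ⊗ g} (HasDegree-⊗ {f} {g} ef (Monic⇒HasDegree Mg))
                                                  (Monic⇒HasDegree Mfg)
... | ≡.refl = e , monic (≡.trans (≡.sym (ℤ.*-identityʳ _))
      (≡.trans (≡.cong (co f e ℤ.*_) (≡.sym (lead Mg)))
      (≡.trans (≡.sym (co-⊗-top f g e m (proj₂ ef) (above Mg))) (lead Mfg)))) (proj₂ ef) , ≡.refl

Monic-unique : ∀ {d e f} → Monic d f → Monic e f → d ≡ e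
Monic-unique {f = f} M N = HasDegree-unique {f} (Monic⇒HasDegree M) (Monic⇒HasDegree N)

opaque
  monic-divide : ∀ {m d} → Monic m d → ∀ f → ∃ λ q → ∃ λ r → f ≋ q ⊗ d ⊕ r × Deg< m r
  monic-divide {m} {d} M f = _ , _ , divMonic-correct M f

monic-∣-low : ∀ {m d r} → Monic m d → d ∣ₚ r → Deg< m r → r ≋ 𝟘
monic-∣-low {d = d} M (divides q e) low = ≋-trans (≋-sym e)
  (≋-trans (⊗-congʳ (monic-low M q (Deg<-resp (≋-sym e) low))) (ZX.zeroˡ d))

C⊗≋𝟘 : ∀ {c f} → c ≢ + 0 → C c ⊗ f ≋ 𝟘 → f ≋ 𝟘
C⊗≋𝟘 {c} {f} nz e with ⊗≋𝟘 (C c) f e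
... | inj₁ z = ⊥-elim (nz (C≋𝟘⇒≡0 z))
... | inj₂ z = z

-- If `f = q d + r`, then `d` divides `c r`, whose degree is too small, so `c r` and hence `r`
-- vanish. This is how a Bézout constant is removed again once a divisor is monic.
monic-∣-scaled : ∀ {m d f c} → Monic m d → c ≢ + 0 → d ∣ₚ C c ⊗ f → d ∣ₚ f
monic-∣-scaled {m} {d} {f} {c} M nz dv with monic-divide M f
... | q , r , e , low = divides q (≋-sym (≋-trans e
  (≋-trans (⊕-congˡ (C⊗≋𝟘 nz (monic-∣-low M d∣cr (Deg<-C⊗ c r low)))) (ZX.+-identityʳ _))))
  where
  d∣cr : d ∣ₚ C c ⊗ r
  d∣cr = ∣ₚ-⊕-cancelˡ (g∣ₚf⊗g (C c ⊗ q) d) (∣ₚ-respʳ (≋-trans (⊗-congˡ e)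
    (solve 4 (λ c q d r → c :* (q :* d :+ r) := c :* q :* d :+ c :* r) ≋-refl (C c) q d r)) dv)

-- Coprimality over ℚ with denominators cleared. Asking for `c = 1` would be too strong: `X - 1` and
-- `X + 1` generate an ideal of ℤ[X] that contains 2 but not 1.
record Coprime (f g : Pol) : Set where
  constructor bezout
  field
    c   : ℤ
    u v : Pol
    c≢0 : c ≢ + 0
    eqn : u ⊗ f ⊕ v ⊗ g ≋ C c

Coprime-sym : ∀ {f g} → Coprime f g → Coprime g f
Coprime-sym (bezout c u v nz e) = bezout c v u nz (≋-trans (ZX.+-comm _ _) e)

Coprime-∣ : ∀ {f g f′ g′} → f′ ∣ₚ f → g′ ∣ₚ g → Coprime f g → Coprime f′ g′
Coprime-∣ {f} {g} {f′} {g′} (divides q e) (divides q′ e′) (bezout c u v nz b) =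
  bezout c (u ⊗ q) (v ⊗ q′) nz
    (≋-trans (⊕-cong (≋-trans (ZX.*-assoc u q f′) (⊗-congˡ e))
                     (≋-trans (ZX.*-assoc v q′ g′) (⊗-congˡ e′))) b)

i*j≢0 : ∀ {i j} → i ≢ + 0 → j ≢ + 0 → i ℤ.* j ≢ + 0
i*j≢0 {i} ni nj e with ℤ.i*j≡0⇒i≡0∨j≡0 i e
... | inj₁ z = ni z
... | inj₂ z = nj z

Coprime-⊗ʳ : ∀ {f g h} → Coprime f g → Coprime f h → Coprime f (g ⊗ h)
Coprime-⊗ʳ {f} {g} {h} (bezout c u v nz e) (bezout c′ u′ v′ nz′ e′) =
  bezout (c ℤ.* c′) (u ⊗ u′ ⊗ f ⊕ u ⊗ v′ ⊗ h ⊕ v ⊗ g ⊗ u′) (v ⊗ v′) (i*j≢0 nz nz′) (begin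
    (u ⊗ u′ ⊗ f ⊕ u ⊗ v′ ⊗ h ⊕ v ⊗ g ⊗ u′) ⊗ f ⊕ v ⊗ v′ ⊗ (g ⊗ h)
      ≈⟨ solve 7 (λ u v u′ v′ f g h →
           (u :* u′ :* f :+ u :* v′ :* h :+ v :* g :* u′) :* f :+ v :* v′ :* (g :* h)
           := (u :* f :+ v :* g) :* (u′ :* f :+ v′ :* h)) ≋-refl u v u′ v′ f g h ⟩
    (u ⊗ f ⊕ v ⊗ g) ⊗ (u′ ⊗ f ⊕ v′ ⊗ h)  ≈⟨ ⊗-cong e e′ ⟩
    C c ⊗ C c′                           ≈⟨ C-* c c′ ⟨
    C (c ℤ.* c′)                         ∎)

Coprime-𝟙ʳ : ∀ f → Coprime f 𝟙
Coprime-𝟙ʳ f = bezout (+ 1) 𝟘 𝟙 (λ ())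
  (≋-trans (⊕-cong (ZX.zeroˡ f) (ZX.*-identityˡ 𝟙)) (ZX.+-identityˡ 𝟙))

-- In `c h = u f h + v g h`, substituting `h = b g` in the first term and `h = a f` in the second
-- shows that `f g` divides `c h`; being monic, it divides `h`.
coprime-∣-⊗ : ∀ {m n f g h} → Monic m f → Monic n g → Coprime f g → f ∣ₚ h → g ∣ₚ h → f ⊗ g ∣ₚ h
coprime-∣-⊗ {f = f} {g} {h} Mf Mg (bezout c u v nz e) (divides a ea) (divides b eb) =
  monic-∣-scaled (Monic-⊗ Mf Mg) nz (divides (u ⊗ b ⊕ v ⊗ a) (begin
    (u ⊗ b ⊕ v ⊗ a) ⊗ (f ⊗ g)
      ≈⟨ solve 6 (λ u v a b f g → (u :* b :+ v :* a) :* (f :* g)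
                   := u :* f :* (b :* g) :+ v :* g :* (a :* f)) ≋-refl u v a b f g ⟩
    u ⊗ f ⊗ (b ⊗ g) ⊕ v ⊗ g ⊗ (a ⊗ f)  ≈⟨ ⊕-cong (⊗-congˡ eb) (⊗-congˡ ea) ⟩
    u ⊗ f ⊗ h ⊕ v ⊗ g ⊗ h              ≈⟨ ZX.distribʳ h _ _ ⟨
    (u ⊗ f ⊕ v ⊗ g) ⊗ h                ≈⟨ ⊗-congʳ e ⟩
    C c ⊗ h                            ∎))

-- Gauss's lemma and greatest common divisors

infix 4 _∣ᶜ_
_∣ᶜ_ : ℤ → Pol → Set
p ∣ᶜ f = ∀ i → p ℤ.∣ co f i

C∣⇒∣ᶜ : ∀ {p f} → C p ∣ₚ f → p ∣ᶜ f
C∣⇒∣ᶜ {p} (divides q e) i = ℤ.divides (co q i)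
  (≡.trans (≡.sym (at e i)) (≡.trans (at (ZX.*-comm q (C p)) i) (≡.trans (co-C⊗ p q i) (ℤ.*-comm p _))))

opaque
  unfolding _⊕_
  ∣ᶜ⇒C∣ : ∀ {p} f → p ∣ᶜ f → C p ∣ₚ f
  ∣ᶜ⇒C∣ {p} f d = divides (quot f d) (≋-trans (ZX.*-comm (quot f d) (C p)) (mk≋ λ i →
      ≡.trans (co-C⊗ p (quot f d) i) (spec f d i)))
    where
    quot : ∀ f → p ∣ᶜ f → Pol
    quot []      d = []
    quot (a ∷ f) d = ℤ._∣_.quotient (d 0) ∷ quot f (λ i → d (suc i))
    spec : ∀ f d i → p ℤ.* co (quot f d) i ≡ co f i
    spec []      d i       = ℤ.*-zeroʳ p
    spec (a ∷ f) d zero    = ≡.trans (ℤ.*-comm p _) (≡.sym (ℤ._∣_.equality (d 0)))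
    spec (a ∷ f) d (suc i) = spec f (λ i → d (suc i)) i

  prime-∣ᶜ : ∀ {p} → Prime p → ∀ f g → + p ∣ᶜ f ⊗ g → + p ∣ᶜ f ⊎ + p ∣ᶜ g
  prime-∣ᶜ pp []      g       d = inj₁ (λ i → ℤ.divides (+ 0) ≡.refl)
  prime-∣ᶜ pp (a ∷ f) []      d = inj₂ (λ i → ℤ.divides (+ 0) ≡.refl)
  prime-∣ᶜ {p} pp (a ∷ f) (b ∷ g) d = cases (λ pa → prime-∣ᶜ pp f (b ∷ g) (dˡ pa))
    (λ pb → prime-∣ᶜ pp (a ∷ f) g (dʳ pb)) (+ p ℤ.∣? a) (+ p ℤ.∣? b)
    where
    dˡ : + p ℤ.∣ a → + p ∣ᶜ f ⊗ (b ∷ g)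
    dˡ pa i = ℤ.∣m+n∣m⇒∣n
      (≡.subst (+ p ℤ.∣_) (Z.coeff-⊛-suc a f (b ∷ g) i) (d (suc i))) (ℤ.∣m⇒∣m*n (co g i) pa)
    dʳ : + p ℤ.∣ b → + p ∣ᶜ (a ∷ f) ⊗ g
    dʳ pb i = ℤ.∣m+n∣m⇒∣n
      (≡.subst (+ p ℤ.∣_) (≡.trans (at (Z.⊛-comm (a ∷ f) (b ∷ g)) (suc i))
          (≡.trans (Z.coeff-⊛-suc b g (a ∷ f) i)
        (≡.cong (λ z → b ℤ.* co f i ℤ.+ z) (at (Z.⊛-comm g (a ∷ f)) i)))) (d (suc i)))
      (ℤ.∣m⇒∣m*n (co f i) pb)
    cases : (+ p ℤ.∣ a → + p ∣ᶜ f ⊎ + p ∣ᶜ (b ∷ g)) → (+ p ℤ.∣ b → + p ∣ᶜ (a ∷ f) ⊎ + p ∣ᶜ g) →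
            Dec (+ p ℤ.∣ a) → Dec (+ p ℤ.∣ b) → + p ∣ᶜ (a ∷ f) ⊎ + p ∣ᶜ (b ∷ g)
    cases recˡ recʳ (yes pa) _ with recˡ pa
    ... | inj₁ h = inj₁ (λ { zero → pa ; (suc i) → h i })
    ... | inj₂ h = inj₂ h
    cases recˡ recʳ (no _) (yes pb) with recʳ pb
    ... | inj₁ h = inj₁ h
    ... | inj₂ h = inj₂ (λ { zero → pb ; (suc i) → h i })
    cases _ _ (no na) (no nb)
      with euclidsLemma ∣ a ∣ ∣ b ∣ pp (≡.subst (p ℕ∣_) (ℤ.abs-* a b)
             (ℤ.∣⇒∣ᵤ (≡.subst (+ p ℤ.∣_) (Z.coeff-⊛-0 (a ∷ f) (b ∷ g)) (d 0))))
    ... | inj₁ h = ⊥-elim (na (ℤ.∣ᵤ⇒∣ h))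
    ... | inj₂ h = ⊥-elim (nb (ℤ.∣ᵤ⇒∣ h))

record ScaledFactorisation (g w t : Pol) : Set where
  constructor scaled
  field
    w′ t′ : Pol
    a b   : ℤ
    a≢0   : a ≢ + 0
    b≢0   : b ≢ + 0
    g≋    : g ≋ w′ ⊗ t′
    w≋    : w ≋ C a ⊗ w′
    t≋    : t ≋ C b ⊗ t′

-- Gauss's lemma, removing the prime factors of the scalar one at a time.
gauss : ∀ g w t {s} → s ≢ + 0 → C s ⊗ g ≋ w ⊗ t → ScaledFactorisation g w t
gauss g w t {s} s≢0 e = signed s s≢0 t e
  where
  go : ∀ ps → All Prime ps → ∀ w t → C (+ product ps) ⊗ g ≋ w ⊗ t → ScaledFactorisation g w t
  go []       []        w t e = scaled w t (+ 1) (+ 1) (λ ()) (λ ())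
    (≋-trans (≋-sym (ZX.*-identityˡ g)) e) (≋-sym (ZX.*-identityˡ w)) (≋-sym (ZX.*-identityˡ t))
  go (p ∷ ps) (pp ∷ pps) w t e = result
    where
    p≢0 : + p ≢ + 0
    p≢0 z = ℕ.≢-nonZero⁻¹ p {{prime⇒nonZero pp}} (ℤ.+-injective z)
    e′ : C (+ p) ⊗ (C (+ product ps) ⊗ g) ≋ w ⊗ t
    e′ = ≋-trans (≋-sym (ZX.*-assoc _ _ _)) (≋-trans (⊗-congʳ (≋-trans (≋-sym (C-* _ _))
           (≡⇒≋ (≡.cong C (≡.sym (ℤ.pos-* p (product ps))))))) e)
    cancel : ∀ {f} → C (+ p) ⊗ (C (+ product ps) ⊗ g) ≋ C (+ p) ⊗ f → C (+ product ps) ⊗ g ≋ f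
    cancel = ⊗-cancelˡ (C (+ p)) (λ z → p≢0 (C≋𝟘⇒≡0 z))
    result : ScaledFactorisation g w t
    result with prime-∣ᶜ pp w t (C∣⇒∣ᶜ (divides (C (+ product ps) ⊗ g) (≋-trans (ZX.*-comm _ _) e′)))
    ... | inj₁ d with ∣ᶜ⇒C∣ w d
    ...   | divides q qe with go ps pps q t (cancel (≋-trans e′ (≋-trans (⊗-congʳ (≋-sym qe))
                (solve 3 (λ q p t → q :* p :* t := p :* (q :* t)) ≋-refl q (C (+ p)) t))))
    ...     | scaled w′ t′ a b na nb ge we te = scaled w′ t′ (+ p ℤ.* a) b (i*j≢0 p≢0 na) nb ge
              (≋-trans (≋-sym qe) (≋-trans (⊗-congʳ we) (≋-trans
                (solve 3 (λ a w p → a :* w :* p := p :* a :* w) ≋-refl (C a) w′ (C (+ p)))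
                (⊗-congʳ (≋-sym (C-* (+ p) a)))))) te
    result | inj₂ d with ∣ᶜ⇒C∣ t d
    ...   | divides q qe with go ps pps w q (cancel (≋-trans e′ (≋-trans (⊗-congˡ (≋-sym qe))
                (solve 3 (λ q p w → w :* (q :* p) := p :* (w :* q)) ≋-refl q (C (+ p)) w))))
    ...     | scaled w′ t′ a b na nb ge we te = scaled w′ t′ a (+ p ℤ.* b) na (i*j≢0 p≢0 nb) ge we
              (≋-trans (≋-sym qe) (≋-trans (⊗-congʳ te) (≋-trans
                (solve 3 (λ a w p → a :* w :* p := p :* a :* w) ≋-refl (C b) t′ (C (+ p)))
                (⊗-congʳ (≋-sym (C-* (+ p) b))))))
  positive : ∀ n t → C (+ suc n) ⊗ g ≋ w ⊗ t → ScaledFactorisation g w t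
  positive n t e = go factors factorsPrime w t
    (≡.subst (λ k → C (+ k) ⊗ g ≋ w ⊗ t) isFactorisation e)
    where
    open PrimeFactorisation (factorise (suc n))
  signed : ∀ s → s ≢ + 0 → ∀ t → C s ⊗ g ≋ w ⊗ t → ScaledFactorisation g w t
  signed (+ zero)   nz t e = ⊥-elim (nz ≡.refl)
  signed (+ suc n)  nz t e = positive n t e
  signed -[1+ n ]   nz t e with positive n (⊖ t) (begin
      C (ℤ.- -[1+ n ]) ⊗ g ≈⟨ ⊗-congʳ (C-neg -[1+ n ]) ⟩
      ⊖ C -[1+ n ] ⊗ g     ≈⟨ solve 2 (λ s g → :- s :* g := :- (s :* g)) ≋-refl (C -[1+ n ]) g ⟩
      ⊖ (C -[1+ n ] ⊗ g)   ≈⟨ ⊖-cong e ⟩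
      ⊖ (w ⊗ t)            ≈⟨ solve 2 (λ s g → :- (s :* g) := s :* :- g) ≋-refl w t ⟩
      w ⊗ ⊖ t              ∎)
  ... | scaled w′ t′ a b na nb ge we te = scaled w′ t′ a (ℤ.- b) na (λ z → nb (ℤ.neg-injective z)) ge we
        (begin
          t              ≈⟨ solve 1 (λ t → t := :- (:- t)) ≋-refl t ⟩
          ⊖ (⊖ t)        ≈⟨ ⊖-cong te ⟩
          ⊖ (C b ⊗ t′)   ≈⟨ solve 2 (λ s g → :- (s :* g) := :- s :* g) ≋-refl (C b) t′ ⟩
          ⊖ C b ⊗ t′     ≈⟨ ⊗-congʳ (C-neg b) ⟨
          C (ℤ.- b) ⊗ t′ ∎)

-- Long division by a `b` that need not be monic: each step first multiplies through by the leading
-- coefficient `c` of `b`, and these multipliers accumulate in `s`.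
pseudo-divide : ∀ {e b} → HasDegree b e → ∀ a →
  ∃ λ s → ∃ λ q → ∃ λ r → s ≢ + 0 × C s ⊗ a ≋ q ⊗ b ⊕ r × Deg< e r
pseudo-divide {e} {b} (nz , db) [] =
  + 1 , 𝟘 , 𝟘 , (λ ()) , ≋-trans (⊗-congˡ (≡⇒≋ 𝟘-def)) (≋-trans (ZX.*-identityˡ 𝟘)
    (≋-sym (≋-trans (ZX.+-identityʳ _) (ZX.zeroˡ b)))) , λ i _ → co-𝟘 i
pseudo-divide {e} {b} (nz , db) (x ∷ a) with pseudo-divide {e} {b} (nz , db) a
... | s , q , r , s≢0 , eq , dr =
  c ℤ.* s , C c ⊗ (X 1 ⊗ q) ⊕ C ρ , C c ⊗ Y ⊕ ⊖ (C ρ ⊗ b) , i*j≢0 nz s≢0 , (begin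
    C (c ℤ.* s) ⊗ (x ∷ a)
      ≈⟨ ⊗-cong (C-* c s) (∷-def x a) ⟩
    C c ⊗ C s ⊗ (C x ⊕ X 1 ⊗ a)
      ≈⟨ solve 5 (λ c s x X a → c :* s :* (x :+ X :* a) := c :* (s :* x :+ X :* (s :* a))) ≋-refl (C c)
          (C s) (C x) (X 1) a ⟩
    C c ⊗ (C s ⊗ C x ⊕ X 1 ⊗ (C s ⊗ a))
      ≈⟨ ⊗-congˡ (⊕-cong (≋-sym (C-* s x)) (⊗-congˡ eq)) ⟩
    C c ⊗ (C (s ℤ.* x) ⊕ X 1 ⊗ (q ⊗ b ⊕ r))
      ≈⟨ solve 7 (λ c y X q b r ρ → c :* (y :+ X :* (q :* b :+ r))
           := (c :* (X :* q) :+ ρ) :* b :+ (c :* (y :+ X :* r) :+ :- (ρ :* b))) ≋-refl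
           (C c) (C (s ℤ.* x)) (X 1) q b r (C ρ) ⟩
    (C c ⊗ (X 1 ⊗ q) ⊕ C ρ) ⊗ b ⊕ (C c ⊗ (C (s ℤ.* x) ⊕ X 1 ⊗ r) ⊕ ⊖ (C ρ ⊗ b))
      ≈⟨ ⊕-congˡ (⊕-congʳ (⊗-congˡ (≋-sym (∷-def (s ℤ.* x) r)))) ⟩
    (C c ⊗ (X 1 ⊗ q) ⊕ C ρ) ⊗ b ⊕ (C c ⊗ Y ⊕ ⊖ (C ρ ⊗ b)) ∎) , low
  where
  c = co b e
  Y = s ℤ.* x ∷ r
  ρ = co Y e
  coR : ∀ i → co (C c ⊗ Y ⊕ ⊖ (C ρ ⊗ b)) i ≡ c ℤ.* co Y i ℤ.- ρ ℤ.* co b i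
  coR i = ≡.trans (co-⊕ (C c ⊗ Y) _ i) (≡.cong₂ ℤ._+_ (co-C⊗ c Y i)
    (≡.trans (co-⊖ (C ρ ⊗ b) i) (≡.cong ℤ.-_ (co-C⊗ ρ b i))))
  low : Deg< e (C c ⊗ Y ⊕ ⊖ (C ρ ⊗ b))
  low i e≤i = ≡.trans (coR i) (go i e≤i)
    where
    go : ∀ i → e ≤ i → c ℤ.* co Y i ℤ.- ρ ℤ.* co b i ≡ + 0
    go i e≤i with e ℕ.≟ i
    ... | yes ≡.refl = ≡.trans (≡.cong (λ z → c ℤ.* ρ ℤ.- z) (ℤ.*-comm ρ c)) (ℤ.+-inverseʳ (c ℤ.* ρ))
    go zero    e≤i | no ne = ⊥-elim (ne (ℕ.n≤0⇒n≡0 e≤i))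
    go (suc i) e≤i | no ne = ≡.cong₂ ℤ._-_
      (≡.trans (≡.cong (c ℤ.*_) (dr i (ℕ.≤-pred e<i))) (ℤ.*-zeroʳ c))
      (≡.trans (≡.cong (ρ ℤ.*_) (db (suc i) e<i)) (ℤ.*-zeroʳ ρ))
      where e<i = ℕ.≤∧≢⇒< e≤i ne

record ScaledGcd (a b : Pol) : Set where
  field
    w u v  : Pol
    s      : ℤ
    s≢0    : s ≢ + 0
    w≋     : w ≋ u ⊗ a ⊕ v ⊗ b
    w∣sa   : w ∣ₚ C s ⊗ a
    w∣sb   : w ∣ₚ C s ⊗ b

-- Euclid's algorithm by pseudo-division; the bound `n` on the degree of `b` makes it terminate.
-- Over ℤ the resulting combination `w` divides `a` and `b` only up to the scalar `s`.
scaledGcd : ∀ n a b → Deg< n b → ScaledGcd a b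
scaledGcd n a b db with degreeView b
... | inj₁ b≋0 = record
  { w = a ; u = 𝟙 ; v = 𝟘 ; s = + 1 ; s≢0 = λ ()
  ; w≋ = ≋-sym (≋-trans (⊕-cong (ZX.*-identityˡ a) (ZX.zeroˡ b)) (ZX.+-identityʳ a))
  ; w∣sa = ∣ₚ-⊗ˡ (C (+ 1)) ∣ₚ-refl
  ; w∣sb = ∣ₚ-⊗ˡ (C (+ 1)) (∣ₚ-respʳ (≋-sym b≋0) ∣ₚ-𝟘) }
scaledGcd zero    a b db | inj₂ (e , ne , _) = ⊥-elim (ne (db e z≤n))
scaledGcd (suc n) a b db | inj₂ (e , de) with pseudo-divide {e} {b} de a
... | s , q , r , s≢0 , eq , dr = record
  { w = w ; u = v ⊗ C s ; v = u ⊕ ⊖ (v ⊗ q) ; s = s′ ℤ.* s ; s≢0 = i*j≢0 s′≢0 s≢0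
  ; w≋ = begin
      w                    ≈⟨ w≋ ⟩
      u ⊗ b ⊕ v ⊗ r
        ≈⟨ solve 5 (λ u v b r q → u :* b :+ v :* r := v :* (q :* b :+ r) :+ (u :+ :- (v :* q)) :* b) ≋-refl
            u v b r q ⟩
      v ⊗ (q ⊗ b ⊕ r) ⊕ (u ⊕ ⊖ (v ⊗ q)) ⊗ b  ≈⟨ ⊕-congʳ (⊗-congˡ (≋-sym eq)) ⟩
      v ⊗ (C s ⊗ a) ⊕ (u ⊕ ⊖ (v ⊗ q)) ⊗ b    ≈⟨ ⊕-congʳ (≋-sym (ZX.*-assoc v (C s) a)) ⟩
      v ⊗ C s ⊗ a ⊕ (u ⊕ ⊖ (v ⊗ q)) ⊗ b      ∎
  ; w∣sa = ∣ₚ-respʳ (begin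
      q ⊗ (C s′ ⊗ b) ⊕ C s′ ⊗ r
        ≈⟨ solve 4 (λ q s b r → q :* (s :* b) :+ s :* r := s :* (q :* b :+ r)) ≋-refl q (C s′) b r ⟩
      C s′ ⊗ (q ⊗ b ⊕ r)   ≈⟨ ⊗-congˡ (≋-sym eq) ⟩
      C s′ ⊗ (C s ⊗ a)     ≈⟨ ZX.*-assoc (C s′) (C s) a ⟨
      C s′ ⊗ C s ⊗ a       ≈⟨ ⊗-congʳ (C-* s′ s) ⟨
      C (s′ ℤ.* s) ⊗ a     ∎) (∣ₚ-⊕ (∣ₚ-⊗ˡ q w∣sa) w∣sb)
  ; w∣sb = ∣ₚ-respʳ (begin
      C s ⊗ (C s′ ⊗ b)   ≈⟨ solve 3 (λ s t b → s :* (t :* b) := t :* s :* b) ≋-refl (C s) (C s′) b ⟩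
      C s′ ⊗ C s ⊗ b     ≈⟨ ⊗-congʳ (C-* s′ s) ⟨
      C (s′ ℤ.* s) ⊗ b   ∎) (∣ₚ-⊗ˡ (C s) w∣sa) }
  where
  e≤n : e ≤ n
  e≤n with e ℕ.<? suc n
  ... | yes (s≤s l) = l
  ... | no ¬l = ⊥-elim (proj₁ de (db e (ℕ.≮⇒≥ ¬l)))
  open ScaledGcd (scaledGcd n b r (Deg<-mono {p = r} e≤n dr)) renaming (s to s′; s≢0 to s′≢0)

i*j≡1⇒i≡±1 : ∀ i j → i ℤ.* j ≡ + 1 → i ≡ + 1 ⊎ i ≡ -[1+ 0 ]
i*j≡1⇒i≡±1 i j e = go i (ℕ.m*n≡1⇒m≡1 ∣ i ∣ ∣ j ∣ (≡.trans (≡.sym (ℤ.abs-* i j)) (≡.cong ∣_∣ e)))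
  where
  go : ∀ i → ∣ i ∣ ≡ 1 → i ≡ + 1 ⊎ i ≡ -[1+ 0 ]
  go (+ _)    ≡.refl = inj₁ ≡.refl
  go -[1+ _ ] ≡.refl = inj₂ ≡.refl

record MonicFactors (f g : Pol) (n : ℕ) : Set where
  field
    σ    : ℤ
    σ²≡1 : σ ℤ.* σ ≡ + 1
    d e  : ℕ
    d+e  : d ℕ.+ e ≡ n
    Mf   : Monic d (C σ ⊗ f)
    Mg   : Monic e (C σ ⊗ g)

  fg≋ : f ⊗ g ≋ (C σ ⊗ f) ⊗ (C σ ⊗ g)
  fg≋ = ≋-sym (begin
    (C σ ⊗ f) ⊗ (C σ ⊗ g)  ≈⟨ solve 3 (λ s f g → (s :* f) :* (s :* g) := (s :* s) :* (f :* g)) ≋-refl (C σ)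
        f g ⟩
    C σ ⊗ C σ ⊗ (f ⊗ g)    ≈⟨ ⊗-congʳ (≋-trans (≋-sym (C-* σ σ)) (≡⇒≋ (≡.cong C σ²≡1))) ⟩
    𝟙 ⊗ (f ⊗ g)            ≈⟨ ZX.*-identityˡ _ ⟩
    f ⊗ g                  ∎)

σσ-cancel : ∀ {σ} → σ ℤ.* σ ≡ + 1 → ∀ f → f ≋ C σ ⊗ (C σ ⊗ f)
σσ-cancel {σ} e f = ≋-sym (≋-trans (≋-sym (ZX.*-assoc _ _ f))
  (≋-trans (⊗-congʳ (≋-trans (≋-sym (C-* σ σ)) (≡⇒≋ (≡.cong C e)))) (ZX.*-identityˡ f)))

-- The leading coefficients multiply to 1, so both are 1 or both are -1, and the same sign `σ` makes
-- both factors monic.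
monicFactors : ∀ {n} f g → Monic n (f ⊗ g) → MonicFactors f g n
monicFactors {n} f g M with degreeView f | degreeView g
... | inj₁ z | _ = ⊥-elim (Monic⇒≢𝟘 M (≋-trans (⊗-congʳ z) (ZX.zeroˡ g)))
... | inj₂ _ | inj₁ z = ⊥-elim (Monic⇒≢𝟘 M (≋-trans (⊗-congˡ z) (ZX.zeroʳ f)))
... | inj₂ (a , α) | inj₂ (b , β)
  with HasDegree-unique {f ⊗ g} (HasDegree-⊗ {f} {g} α β) (Monic⇒HasDegree M)
... | ≡.refl = record
  { σ = co f a ; σ²≡1 = sq ; d = a ; e = b ; d+e = ≡.refl
  ; Mf = monic (≡.trans (co-C⊗ _ f a) sq) (Deg<-C⊗ _ f (proj₂ α))
  ; Mg = monic (≡.trans (co-C⊗ _ g b) leads) (Deg<-C⊗ _ g (proj₂ β)) }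
  where
  leads : co f a ℤ.* co g b ≡ + 1
  leads = ≡.trans (≡.sym (co-⊗-top f g a b (proj₂ α) (proj₂ β))) (lead M)
  sq : co f a ℤ.* co f a ≡ + 1
  sq with i*j≡1⇒i≡±1 (co f a) (co g b) leads
  ... | inj₁ e = ≡.cong₂ ℤ._*_ e e
  ... | inj₂ e = ≡.cong₂ ℤ._*_ e e

record MonicGcd (Φ h : Pol) : Set where
  field
    deg  : ℕ
    f    : Pol
    Mf   : Monic deg f
    f∣Φ  : f ∣ₚ Φ
    f∣h  : f ∣ₚ h
    c    : ℤ
    c≢0  : c ≢ + 0
    u v  : Pol
    eqn  : u ⊗ Φ ⊕ v ⊗ h ≋ C c ⊗ f

-- Euclid's `w` divides only a multiple of `Φ`. Gauss's lemma strips an integer factor from it, and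
-- what remains divides the monic `Φ` itself, hence is monic up to sign; being monic, it also
-- divides `h`.
monicGcd : ∀ {n Φ} → Monic n Φ → ∀ h → MonicGcd Φ h
monicGcd {n} {Φ} M h = record
  { deg = d ; f = C σ ⊗ w′ ; Mf = Mf
  ; f∣Φ = ∣ₚ-respʳ (≋-sym (≋-trans G.g≋ fg≋)) (f∣ₚf⊗g _ _)
  ; f∣h = monic-∣-scaled Mf s≢0 (∣ₚ-trans f∣w w∣sb)
  ; c = a ℤ.* σ ; c≢0 = i*j≢0 G.a≢0 σ≢0 ; u = u ; v = v
  ; eqn = begin
      u ⊗ Φ ⊕ v ⊗ h            ≈⟨ w≋ ⟨
      w                        ≈⟨ G.w≋ ⟩
      C a ⊗ w′                 ≈⟨ ⊗-congˡ (σσ-cancel {σ} σ²≡1 w′) ⟩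
      C a ⊗ (C σ ⊗ (C σ ⊗ w′)) ≈⟨ ZX.*-assoc _ _ _ ⟨
      C a ⊗ C σ ⊗ (C σ ⊗ w′)   ≈⟨ ⊗-congʳ (C-* a σ) ⟨
      C (a ℤ.* σ) ⊗ (C σ ⊗ w′) ∎ }
  where
  open ScaledGcd (scaledGcd (length h) Φ h (Z.Deg<-length h))
  module G = ScaledFactorisation (gauss Φ w (_∣ₚ_.quo w∣sa) s≢0
    (≋-trans (≋-sym (_∣ₚ_.eqn w∣sa)) (ZX.*-comm _ _)))
  open G using (w′; t′; a)
  open MonicFactors (monicFactors w′ t′ (Monic-resp G.g≋ M))
  σ≢0 : σ ≢ + 0
  σ≢0 z with ≡.trans (≡.sym σ²≡1) (≡.cong (ℤ._* σ) z)
  ... | ()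
  f∣w : C σ ⊗ w′ ∣ₚ w
  f∣w = ∣ₚ-respʳ (≋-sym (≋-trans G.w≋ (⊗-congˡ (σσ-cancel {σ} σ²≡1 w′))))
      (∣ₚ-⊗ˡ (C a) (∣ₚ-⊗ˡ (C σ) ∣ₚ-refl))

-- Cyclotomic polynomials

-- θ = X d/dX.
opaque
  unfolding _⊕_
  θ : Pol → Pol
  θ []      = []
  θ (a ∷ f) = + 0 ∷ (f ⊕ θ f)

  co-θ : ∀ f i → co (θ f) i ≡ + i ℤ.* co f i
  co-θ []      i       = ≡.sym (ℤ.*-zeroʳ (+ i))
  co-θ (a ∷ f) zero    = ≡.refl
  co-θ (a ∷ f) (suc i) = ≡.trans (co-⊕ f (θ f) i)
    (≡.trans (≡.cong (λ z → co f i ℤ.+ z) (co-θ f i)) (≡.sym (ℤ.suc-* (+ i) (co f i))))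

  θ-∷ : ∀ a f → θ (a ∷ f) ≋ X 1 ⊗ (f ⊕ θ f)
  θ-∷ a f = ≋-trans (∷-def (+ 0) (f ⊕ θ f)) (≋-trans (⊕-congʳ C-0) (ZX.+-identityˡ _))

  θ-[] : θ [] ≋ 𝟘
  θ-[] = ≋-refl

θ-cong : ∀ {f g} → f ≋ g → θ f ≋ θ g
θ-cong {f} {g} e .at i = ≡.trans (co-θ f i) (≡.trans (≡.cong (+ i ℤ.*_) (at e i)) (≡.sym (co-θ g i)))

θ-⊕ : ∀ f g → θ (f ⊕ g) ≋ θ f ⊕ θ g
θ-⊕ f g .at i = ≡.trans (co-θ (f ⊕ g) i) (≡.trans (≡.cong (+ i ℤ.*_) (co-⊕ f g i))
  (≡.trans (ℤ.*-distribˡ-+ (+ i) (co f i) (co g i))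
    (≡.sym (≡.trans (co-⊕ (θ f) (θ g) i) (≡.cong₂ ℤ._+_ (co-θ f i) (co-θ g i))))))

θ-C⊗ : ∀ a f → θ (C a ⊗ f) ≋ C a ⊗ θ f
θ-C⊗ a f .at i = ≡.trans (co-θ (C a ⊗ f) i) (≡.trans (≡.cong (+ i ℤ.*_) (co-C⊗ a f i))
  (≡.trans (swap (+ i) a (co f i)) (≡.sym (≡.trans (co-C⊗ a (θ f) i) (≡.cong (a ℤ.*_) (co-θ f i))))))
  where
  swap : ∀ x y z → x ℤ.* (y ℤ.* z) ≡ y ℤ.* (x ℤ.* z)
  swap x y z = ≡.trans (≡.sym (ℤ.*-assoc x y z)) (≡.trans (≡.cong (ℤ._* z) (ℤ.*-comm x y))
      (ℤ.*-assoc y x z))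

θ-X1⊗ : ∀ f → θ (X 1 ⊗ f) ≋ X 1 ⊗ (f ⊕ θ f)
θ-X1⊗ f = ≋-trans (θ-cong (≋-sym (≋-trans (∷-def (+ 0) f) (≋-trans (⊕-congʳ C-0) (ZX.+-identityˡ _)))))
    (θ-∷ (+ 0) f)

θ-⊗ : ∀ f g → θ (f ⊗ g) ≋ θ f ⊗ g ⊕ f ⊗ θ g
θ-⊗ []      g = begin
  θ ([] ⊗ g)              ≈⟨ θ-cong (≋-trans (⊗-congʳ (≡⇒≋ 𝟘-def))
      (≋-trans (ZX.zeroˡ g) (≡⇒≋ (≡.sym 𝟘-def)))) ⟩
  θ []                    ≈⟨ θ-[] ⟩
  𝟘                       ≈⟨ ≋-trans (⊕-cong (ZX.zeroˡ g) (ZX.zeroˡ (θ g))) (ZX.+-identityˡ 𝟘) ⟨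
  𝟘 ⊗ g ⊕ 𝟘 ⊗ θ g         ≈⟨ ⊕-cong (⊗-congʳ θ-[]) (⊗-congʳ (≡⇒≋ 𝟘-def)) ⟨
  θ [] ⊗ g ⊕ [] ⊗ θ g     ∎
θ-⊗ (a ∷ f) g = begin
  θ ((a ∷ f) ⊗ g)
    ≈⟨ θ-cong (≋-trans (⊗-congʳ (∷-def a f)) (solve 4
        (λ a x f g → (a :+ x :* f) :* g := a :* g :+ x :* (f :* g)) ≋-refl (C a) (X 1) f g)) ⟩
  θ (C a ⊗ g ⊕ X 1 ⊗ (f ⊗ g))                        ≈⟨ θ-⊕ _ _ ⟩
  θ (C a ⊗ g) ⊕ θ (X 1 ⊗ (f ⊗ g))                    ≈⟨ ⊕-cong (θ-C⊗ a g) (θ-X1⊗ (f ⊗ g)) ⟩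
  C a ⊗ θ g ⊕ X 1 ⊗ (f ⊗ g ⊕ θ (f ⊗ g))              ≈⟨ ⊕-congˡ (⊗-congˡ (⊕-congˡ (θ-⊗ f g))) ⟩
  C a ⊗ θ g ⊕ X 1 ⊗ (f ⊗ g ⊕ (θ f ⊗ g ⊕ f ⊗ θ g))
    ≈⟨ solve 6 (λ a x f g f′ g′ → a :* g′ :+ x :* (f :* g :+ (f′ :* g :+ f :* g′))
                  := (x :* (f :+ f′)) :* g :+ (a :+ x :* f) :* g′) ≋-refl (C a) (X 1) f g (θ f) (θ g) ⟩
  X 1 ⊗ (f ⊕ θ f) ⊗ g ⊕ (C a ⊕ X 1 ⊗ f) ⊗ θ g        ≈⟨ ⊕-cong (⊗-congʳ (θ-∷ a f)) (⊗-congʳ (∷-def a f)) ⟨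
  θ (a ∷ f) ⊗ g ⊕ (a ∷ f) ⊗ θ g                      ∎

θ-X : ∀ n → θ (X n) ≋ C (+ n) ⊗ X n
θ-X n .at i = ≡.trans (co-θ (X n) i) (≡.trans (go i) (≡.sym (co-C⊗ (+ n) (X n) i)))
  where
  go : ∀ i → + i ℤ.* co (X n) i ≡ + n ℤ.* co (X n) i
  go i with n ℕ.≟ i
  ... | yes ≡.refl = ≡.refl
  ... | no ne      = ≡.trans (≡.cong (+ i ℤ.*_) (co-X≢ n i ne))
    (≡.trans (ℤ.*-zeroʳ (+ i)) (≡.sym (≡.trans (≡.cong (+ n ℤ.*_) (co-X≢ n i ne)) (ℤ.*-zeroʳ (+ n)))))

θ-C : ∀ a → θ (C a) ≋ 𝟘
θ-C a .at zero    = ≡.trans (co-θ (C a) 0) (≡.sym (co-𝟘 0))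
θ-C a .at (suc i) = ≡.trans (co-θ (C a) (suc i)) (≡.trans (≡.cong (+ suc i ℤ.*_) (co-C-suc a i))
  (≡.trans (ℤ.*-zeroʳ (+ suc i)) (≡.sym (co-𝟘 (suc i)))))

Y : ℕ → Pol
Y n = X n ⊕ ⊖ 𝟙

Y-+ : ∀ a b → Y (a ℕ.+ b) ≋ X a ⊗ Y b ⊕ Y a
Y-+ a b = ≋-trans (⊕-congʳ (X-+ a b))
  (solve 2 (λ x y → x :* y :+ :- con (+ 1) := x :* (y :+ :- con (+ 1)) :+ (x :+ :- con (+ 1))) ≋-refl (X a)
      (X b))

Y-0 : Y 0 ≋ 𝟘
Y-0 = ≋-trans (⊕-congʳ X-0) (ZX.-‿inverseʳ 𝟙)

Y∣Y* : ∀ d q → Y d ∣ₚ Y (q ℕ.* d)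
Y∣Y* d zero    = ∣ₚ-respʳ (≋-sym Y-0) ∣ₚ-𝟘
Y∣Y* d (suc q) = ∣ₚ-respʳ (≋-sym (Y-+ d (q ℕ.* d))) (∣ₚ-⊕ (∣ₚ-⊗ˡ (X d) (Y∣Y* d q)) ∣ₚ-refl)

Y∣Y : ∀ {d n} → d ℕ∣ n → Y d ∣ₚ Y n
Y∣Y {d} (ℕ∣.divides q ≡.refl) = Y∣Y* d q

-- Bézout's identity takes place in the exponents: from `g + y e = x d` for `g = gcd d e`, `Y-+`
-- gives `Y (x d) = X^g Y (y e) + Y g`, where `Y d` divides the left side and `Y e` the first term
-- on the right.
Y-gcd : ∀ d e → ∃ λ u → ∃ λ v → u ⊗ Y d ⊕ v ⊗ Y e ≋ Y (gcd d e)
Y-gcd d e with Bézout.identity (gcd-GCD d e)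
... | Bézout.Identity.+- x y eq = go (Y∣Y* d x) (Y∣Y* e y)
  where
  g = gcd d e
  go : Y d ∣ₚ Y (x ℕ.* d) → Y e ∣ₚ Y (y ℕ.* e) → ∃ λ u → ∃ λ v → u ⊗ Y d ⊕ v ⊗ Y e ≋ Y g
  go (divides a ea) (divides b eb) = a , ⊖ (X g ⊗ b) , (begin
    a ⊗ Y d ⊕ ⊖ (X g ⊗ b) ⊗ Y e     ≈⟨ solve 4 (λ p x b q → p :+ :- (x :* b) :* q := p :+ :-
        (x :* (b :* q))) ≋-refl (a ⊗ Y d) (X g) b (Y e) ⟩
    a ⊗ Y d ⊕ ⊖ (X g ⊗ (b ⊗ Y e))   ≈⟨ ⊕-cong ea (⊖-cong (⊗-congˡ eb)) ⟩
    Y (x ℕ.* d) ⊕ ⊖ (X g ⊗ Y (y ℕ.* e)) ≈⟨ ⊕-congʳ (≋-trans (≡⇒≋ (≡.cong Y (≡.sym eq))) (Y-+ g (y ℕ.* e))) ⟩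
    X g ⊗ Y (y ℕ.* e) ⊕ Y g ⊕ ⊖ (X g ⊗ Y (y ℕ.* e)) ≈⟨ solve 2 (λ p q → (p :+ q) :+ :- p := q) ≋-refl _ _ ⟩
    Y g ∎)
... | Bézout.Identity.-+ x y eq = go (Y∣Y* d x) (Y∣Y* e y)
  where
  g = gcd d e
  go : Y d ∣ₚ Y (x ℕ.* d) → Y e ∣ₚ Y (y ℕ.* e) → ∃ λ u → ∃ λ v → u ⊗ Y d ⊕ v ⊗ Y e ≋ Y g
  go (divides a ea) (divides b eb) = ⊖ (X g ⊗ a) , b , (begin
    ⊖ (X g ⊗ a) ⊗ Y d ⊕ b ⊗ Y e     ≈⟨ solve 4 (λ p x b q → :- (x :* b) :* q :+ p := p :+ :-
        (x :* (b :* q))) ≋-refl (b ⊗ Y e) (X g) a (Y d) ⟩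
    b ⊗ Y e ⊕ ⊖ (X g ⊗ (a ⊗ Y d))   ≈⟨ ⊕-cong eb (⊖-cong (⊗-congˡ ea)) ⟩
    Y (y ℕ.* e) ⊕ ⊖ (X g ⊗ Y (x ℕ.* d)) ≈⟨ ⊕-congʳ (≋-trans (≡⇒≋ (≡.cong Y (≡.sym eq))) (Y-+ g (x ℕ.* d))) ⟩
    X g ⊗ Y (x ℕ.* d) ⊕ Y g ⊕ ⊖ (X g ⊗ Y (x ℕ.* d)) ≈⟨ solve 2 (λ p q → (p :+ q) :+ :- p := q) ≋-refl _ _ ⟩
    Y g ∎)

Monic-⊕-low : ∀ {n f g} → Monic n f → Deg< n g → Monic n (f ⊕ g)
Monic-⊕-low {n} {f} {g} (monic l a) d = monic
  (≡.trans (co-⊕ f g n) (≡.cong₂ ℤ._+_ l (d n ℕ.≤-refl)))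
  (Deg<-⊕ f g a (Deg<-mono {p = g} (ℕ.n≤1+n n) d))

Deg<-C : ∀ {n} a → Deg< (suc n) (C a)
Deg<-C a (suc i) _ = co-C-suc a i

Monic-Y : ∀ n → Monic (suc n) (Y (suc n))
Monic-Y n = Monic-⊕-low (Monic-X (suc n)) (Deg<-⊖ 𝟙 (Deg<-C (+ 1)))

-- n = X (Yₙ)' - n Yₙ, so Yₙ is separable.
Y-separable : ∀ {n f g} → n ≢ 0 → Y n ≋ f ⊗ g → Coprime f g
Y-separable {n} {f} {g} n≢0 e = bezout (+ n) (θ g ⊕ ⊖ (C (+ n) ⊗ g)) (θ f) (λ z → n≢0 (ℤ.+-injective z))
    (begin
  (θ g ⊕ ⊖ (C (+ n) ⊗ g)) ⊗ f ⊕ θ f ⊗ g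
    ≈⟨ solve 5 (λ f g f′ g′ n → (g′ :+ :- (n :* g)) :* f :+ f′ :* g := (f′ :* g :+ f :* g′) :+ :-
        (n :* (f :* g))) ≋-refl f g (θ f) (θ g) (C (+ n)) ⟩
  θ f ⊗ g ⊕ f ⊗ θ g ⊕ ⊖ (C (+ n) ⊗ (f ⊗ g))  ≈⟨ ⊕-cong (≋-sym (θ-⊗ f g)) (⊖-cong (⊗-congˡ (≋-sym e))) ⟩
  θ (f ⊗ g) ⊕ ⊖ (C (+ n) ⊗ Y n)              ≈⟨ ⊕-congʳ θY ⟩
  C (+ n) ⊗ X n ⊕ ⊖ (C (+ n) ⊗ Y n)
    ≈⟨ solve 2 (λ n x → n :* x :+ :- (n :* (x :+ :- con (+ 1))) := n) ≋-refl (C (+ n)) (X n) ⟩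
  C (+ n)                                    ∎)
  where
  θY : θ (f ⊗ g) ≋ C (+ n) ⊗ X n
  θY = begin
    θ (f ⊗ g)                ≈⟨ θ-cong e ⟨
    θ (X n ⊕ ⊖ 𝟙)            ≈⟨ θ-⊕ (X n) (⊖ 𝟙) ⟩
    θ (X n) ⊕ θ (⊖ 𝟙)        ≈⟨ ⊕-cong (θ-X n) (≋-trans (θ-cong (≋-sym (C-neg (+ 1)))) (θ-C (ℤ.- + 1))) ⟩
    C (+ n) ⊗ X n ⊕ 𝟘        ≈⟨ ZX.+-identityʳ _ ⟩
    C (+ n) ⊗ X n            ∎

dropTrailingZeros-≋0 : ∀ f → Deg< 0 f → dropTrailingZeros f ≡ []
dropTrailingZeros-≋0 []      d = ≡.refl
dropTrailingZeros-≋0 (a ∷ f) d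
  with dropTrailingZeros f | dropTrailingZeros-≋0 f (λ i _ → d (suc i) z≤n) | a ℤ.≟ ℤ.0ℤ
... | [] | ≡.refl | yes _ = ≡.refl
... | [] | ≡.refl | no n  = ⊥-elim (n (d 0 z≤n))

length-dropTrailingZeros : ∀ {d} f → HasDegree f d → length (dropTrailingZeros f) ≡ suc d
length-dropTrailingZeros []      (n , _) = ⊥-elim (n ≡.refl)
length-dropTrailingZeros {zero} (a ∷ f) (n , l)
  with dropTrailingZeros f | dropTrailingZeros-≋0 f (λ i _ → l (suc i) (s≤s z≤n)) | a ℤ.≟ ℤ.0ℤ
... | [] | ≡.refl | yes z = ⊥-elim (n z)
... | [] | ≡.refl | no _  = ≡.refl
length-dropTrailingZeros {suc d} (a ∷ f) (n , l)
  with dropTrailingZeros f | length-dropTrailingZeros {d} f (n , λ i k → l (suc i) (s≤s k)) | a ℤ.≟ ℤ.0ℤ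
... | b ∷ f′ | e | _ = ≡.cong suc e

degree-monic : ∀ {d f} → Monic d f → degree f ≡ d
degree-monic {d} {f} M rewrite length-dropTrailingZeros {d} f (Monic⇒HasDegree M) = ≡.refl

divMonic-exact : ∀ {m D f} → Monic m D → D ∣ₚ f → f ≋ proj₁ (ℤ[X].divMonic (degree D) D f) ⊗ D
divMonic-exact {m} {D} {f} M dv =
  ≡.subst (λ k → f ≋ proj₁ (ℤ[X].divMonic k D f) ⊗ D) (≡.sym (degree-monic M)) exact
  where
  q = proj₁ (ℤ[X].divMonic m D f)
  e = proj₁ (divMonic-correct M f)
  exact : f ≋ q ⊗ D
  exact = ≋-trans e (≋-trans (⊕-congˡ (monic-∣-low M (∣ₚ-⊕-cancelˡ (g∣ₚf⊗g q D) (∣ₚ-respʳ e dv))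
    (proj₂ (divMonic-correct M f)))) (ZX.+-identityʳ _))

opaque
  Φ′ : ℕ → Pol
  Φ′ = Φ

  Π : ℕ → ℕ → Pol
  Π = ∏Φ

  Φ′-def : ∀ n → Φ n ≡ Φ′ n
  Φ′-def n = ≡.refl

  Π-0 : ∀ n → Π n 0 ≋ 𝟙
  Π-0 n = ≡⇒≋ 𝟙-def

  Π-∣ : ∀ {n j} → suc j ℕ∣ n → Π n (suc j) ≋ Φ′ (suc j) ⊗ Π n j
  Π-∣ {n} {j} d = ≋-trans (≡⇒≋ (≡.cong (if_then Φ (suc j) ℤ[X].⊛ ∏Φ n j else ∏Φ n j)
      (dec-true (suc j ∣? n) d)))
    (≡⇒≋ (⊗-def (Φ (suc j)) (∏Φ n j)))

  Π-∤ : ∀ {n j} → ¬ suc j ℕ∣ n → Π n (suc j) ≋ Π n j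
  Π-∤ {n} {j} nd = ≡⇒≋ (≡.cong (if_then Φ (suc j) ℤ[X].⊛ ∏Φ n j else ∏Φ n j) (dec-false (suc j ∣? n) nd))

  Φ′-split : ∀ {n m} → Monic m (Π (suc n) n) → Π (suc n) n ∣ₚ Y (suc n) → Y (suc n) ≋ Φ′ (suc n) ⊗ Π (suc n)
      n
  Φ′-split {n} M dv = ≋-trans (≡⇒≋ (≡.sym (X^n-1-def (suc n))))
    (divMonic-exact M (∣ₚ-respʳ (≡⇒≋ (≡.sym (X^n-1-def (suc n)))) dv))

Π-closed : (P : Pol → Set) → (∀ {f g} → f ≋ g → P f → P g) → P 𝟙 → (∀ {f g} → P f → P g → P (f ⊗ g)) →
           ∀ n j → (∀ d → suc d ≤ j → suc d ℕ∣ n → P (Φ′ (suc d))) → P (Π n j)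
Π-closed P resp p1 p⊗ n zero    h = resp (≋-sym (Π-0 n)) p1
Π-closed P resp p1 p⊗ n (suc j) h with Π-closed P resp p1 p⊗ n j (λ d l → h d (ℕ.m≤n⇒m≤1+n l)) | suc j ∣? n
... | ih | yes d = resp (≋-sym (Π-∣ d)) (p⊗ (h j ℕ.≤-refl d) ih)
... | ih | no nd = resp (≋-sym (Π-∤ nd)) ih

Φ′∣Π : ∀ n j d → suc d ≤ j → suc d ℕ∣ n → Φ′ (suc d) ∣ₚ Π n j
Φ′∣Π n (suc j) d (s≤s d≤j) dv with d ℕ.≟ j
... | yes ≡.refl = ∣ₚ-respʳ (≋-sym (Π-∣ dv)) (f∣ₚf⊗g _ _)
... | no d≢j with Φ′∣Π n j d (ℕ.≤∧≢⇒< d≤j d≢j) dv | suc j ∣? n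
...   | ih | yes dj = ∣ₚ-respʳ (≋-sym (Π-∣ dj)) (∣ₚ-⊗ˡ _ ih)
...   | ih | no nj  = ∣ₚ-respʳ (≋-sym (Π-∤ nj)) ih

Coprime-resp : ∀ {f g h} → g ≋ h → Coprime f g → Coprime f h
Coprime-resp e (bezout c u v nz eq) = bezout c u v nz (≋-trans (⊕-congˡ (⊗-congˡ (≋-sym e))) eq)

-- `h` lies in the ideal generated by `f` and `g`, so it can be eliminated from its Bézout relation
-- with `f`.
Coprime-ideal : ∀ {f g f′ g′ h a b} → f ∣ₚ f′ → g ∣ₚ g′ → a ⊗ f′ ⊕ b ⊗ g′ ≋ h → Coprime f h → Coprime f g
Coprime-ideal {f} {g} {f′} {g′} {h} {a} {b} (divides q e) (divides q′ e′) eh (bezout c u v nz eq) =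
  bezout c (u ⊕ v ⊗ a ⊗ q) (v ⊗ b ⊗ q′) nz (begin
    (u ⊕ v ⊗ a ⊗ q) ⊗ f ⊕ v ⊗ b ⊗ q′ ⊗ g
      ≈⟨ solve 8 (λ u v a b q q′ f g → (u :+ v :* a :* q) :* f :+ v :* b :* q′ :* g
            := u :* f :+ v :* (a :* (q :* f) :+ b :* (q′ :* g))) ≋-refl u v a b q q′ f g ⟩
    u ⊗ f ⊕ v ⊗ (a ⊗ (q ⊗ f) ⊕ b ⊗ (q′ ⊗ g))  ≈⟨ ⊕-congˡ (⊗-congˡ (⊕-cong (⊗-congˡ e) (⊗-congˡ e′))) ⟩
    u ⊗ f ⊕ v ⊗ (a ⊗ f′ ⊕ b ⊗ g′)             ≈⟨ ⊕-congˡ (⊗-congˡ eh) ⟩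
    u ⊗ f ⊕ v ⊗ h                             ≈⟨ eq ⟩
    C c                                       ∎)

-- The index is shifted: this is the factorisation of X^(n+1) - 1.
record CyclotomicFactorisation (n : ℕ) : Set where
  field
    {deg} : ℕ
    M     : Monic deg (Φ′ (suc n))
    split : Y (suc n) ≋ Φ′ (suc n) ⊗ Π (suc n) n

  Y≋Π : Y (suc n) ≋ Π (suc n) (suc n)
  Y≋Π = ≋-trans split (≋-sym (Π-∣ ℕ∣.∣-refl))

  Φ∣Y : Φ′ (suc n) ∣ₚ Y (suc n)
  Φ∣Y = ∣ₚ-respʳ (≋-sym split) (f∣ₚf⊗g _ _)

module _ {e : ℕ} (ge : CyclotomicFactorisation e) where
  -- `Φ′ (suc c)` divides the cofactor `Π (suc e) e` of `Φ′ (suc e)` in `Y (suc e)`, which is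
  -- separable.
  coprime-Φ-divisor : ∀ {c} → suc c ℕ∣ suc e → c < e → Coprime (Φ′ (suc e)) (Φ′ (suc c))
  coprime-Φ-divisor {c} dv c<e = Coprime-∣ ∣ₚ-refl (Φ′∣Π (suc e) e c c<e dv)
      (Y-separable (λ ()) (CyclotomicFactorisation.split ge))

  coprime-Φ-Y : ∀ {g} → CyclotomicFactorisation g → suc g ℕ∣ suc e → g < e → Coprime (Φ′ (suc e))
      (Y (suc g))
  coprime-Φ-Y {g} gg dv g<e = Coprime-resp (≋-sym (CyclotomicFactorisation.Y≋Π gg))
    (Π-closed (Coprime (Φ′ (suc e))) Coprime-resp (Coprime-𝟙ʳ _) Coprime-⊗ʳ (suc g) (suc g)
      λ c l d → coprime-Φ-divisor (ℕ∣.∣-trans d dv) (ℕ.≤-trans l g<e))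

  -- `Φ′ (suc e)` divides `Y (suc e)`, so `Y-gcd` reduces the claim to `Y` of the gcd of `suc d` and
  -- `suc e`. That gcd is a proper divisor of `suc e`, which is the case of `coprime-Φ-Y`.
  coprime-Φ-Y′ : (∀ {g} → g < e → CyclotomicFactorisation g) → ∀ {d} → d < e → Coprime (Φ′ (suc e))
      (Y (suc d))
  coprime-Φ-Y′ below {d} d<e with gcd (suc d) (suc e) | gcd[m,n]∣m (suc d) (suc e) | gcd[m,n]∣n (suc d)
      (suc e) | Y-gcd (suc d) (suc e)
  ... | zero  | 0∣d | _ | _ with ℕ∣.0∣⇒≡0 0∣d
  ...   | ()
  coprime-Φ-Y′ below {d} d<e | suc g | g∣d | g∣e | u , v , eq =
    Coprime-ideal (CyclotomicFactorisation.Φ∣Y ge) ∣ₚ-refl (≋-trans (ZX.+-comm _ _) eq)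
        (coprime-Φ-Y (below g<e) g∣e g<e)
    where
    g<e : g < e
    g<e = ℕ.≤-trans (ℕ∣.∣⇒≤ g∣d) d<e

  coprime-Φ-Φ : (∀ {g} → g < e → CyclotomicFactorisation g) → ∀ {d} → d < e → Coprime (Φ′ (suc e))
      (Φ′ (suc d))
  coprime-Φ-Φ below d<e = Coprime-∣ ∣ₚ-refl (CyclotomicFactorisation.Φ∣Y (below d<e))
      (coprime-Φ-Y′ below d<e)

-- The `Φ` of the proper divisors are monic, pairwise coprime and divide `Y (suc n)`, hence so does
-- their product. This makes the long division that defines `Φ (suc n)` exact, with a monic
-- quotient.
cyclotomicFactorisation : ∀ n → CyclotomicFactorisation n
cyclotomicFactorisation = <-rec CyclotomicFactorisation step
  where
  step : ∀ n → (∀ {m} → m < n → CyclotomicFactorisation m) → CyclotomicFactorisation n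
  step n ih = record { M = proj₁ (proj₂ MΦ) ; split = split }
    where
    MΠ : ∀ j → j ≤ n → ∃ λ m → Monic m (Π (suc n) j)
    MΠ j j≤n = Π-closed (λ f → ∃ λ m → Monic m f) (λ e (m , M) → m , Monic-resp e M) (0 , Monic-𝟙)
      (λ (m , M) (m′ , M′) → _ , Monic-⊗ M M′) (suc n) j λ d l _ → _ , CyclotomicFactorisation.M
          (ih (ℕ.≤-trans l j≤n))
    Π∣Y : ∀ j → j ≤ n → Π (suc n) j ∣ₚ Y (suc n)
    Π∣Y zero    _   = ∣ₚ-respˡ (≋-sym (Π-0 (suc n))) (divides (Y (suc n)) (ZX.*-identityʳ _))
    Π∣Y (suc j) j<n with suc j ∣? suc n | Π∣Y j (ℕ.<⇒≤ j<n)
    ... | no nd | h = ∣ₚ-respˡ (≋-sym (Π-∤ nd)) h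
    ... | yes d | h = ∣ₚ-respˡ (≋-sym (Π-∣ d))
      (coprime-∣-⊗ (CyclotomicFactorisation.M (ih j<n)) (proj₂ (MΠ j (ℕ.<⇒≤ j<n)))
        (Π-closed (Coprime (Φ′ (suc j))) Coprime-resp (Coprime-𝟙ʳ _) Coprime-⊗ʳ (suc n) j
          λ c l _ → coprime-Φ-Φ (ih j<n) (λ g<j → ih (ℕ.<-trans g<j j<n)) l)
        (∣ₚ-trans (CyclotomicFactorisation.Φ∣Y (ih j<n)) (Y∣Y d)) h)
    split : Y (suc n) ≋ Φ′ (suc n) ⊗ Π (suc n) n
    split = Φ′-split (proj₂ (MΠ n ℕ.≤-refl)) (Π∣Y n ℕ.≤-refl)
    MΦ : ∃ λ e → Monic e (Φ′ (suc n)) × e ℕ.+ proj₁ (MΠ n ℕ.≤-refl) ≡ suc n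
    MΦ = Monic-quotient (proj₂ (MΠ n ℕ.≤-refl)) (Monic-resp split (Monic-Y n))

-- The degree of a cyclotomic polynomial

sumTo : ℕ → (ℕ → ℕ) → ℕ
sumTo zero    f = 0
sumTo (suc n) f = sumTo n f ℕ.+ f n

sumTo-cong : ∀ n {f g : ℕ → ℕ} → (∀ i → i < n → f i ≡ g i) → sumTo n f ≡ sumTo n g
sumTo-cong zero    e = ≡.refl
sumTo-cong (suc n) e = ≡.cong₂ ℕ._+_ (sumTo-cong n λ i l → e i (ℕ.m<n⇒m<1+n l)) (e n ℕ.≤-refl)

sumTo-0 : ∀ n → sumTo n (λ _ → 0) ≡ 0
sumTo-0 zero    = ≡.refl
sumTo-0 (suc n) = ≡.trans (ℕ.+-identityʳ _) (sumTo-0 n)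

sumTo-1 : ∀ n → sumTo n (λ _ → 1) ≡ n
sumTo-1 zero    = ≡.refl
sumTo-1 (suc n) = ≡.trans (ℕ.+-comm _ 1) (≡.cong suc (sumTo-1 n))

sumTo-+ : ∀ n f g → sumTo n (λ i → f i ℕ.+ g i) ≡ sumTo n f ℕ.+ sumTo n g
sumTo-+ zero    f g = ≡.refl
sumTo-+ (suc n) f g = ≡.trans (≡.cong (ℕ._+ (f n ℕ.+ g n)) (sumTo-+ n f g))
  (interchange (sumTo n f) (sumTo n g) (f n) (g n))
  where
  open import Algebra.Properties.CommutativeSemigroup ℕ.+-commutativeSemigroup using (interchange)

sumTo-swap : ∀ m n (f : ℕ → ℕ → ℕ) → sumTo m (λ i → sumTo n (f i)) ≡ sumTo n (λ j → sumTo m (λ i → f i j))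
sumTo-swap zero    n f = ≡.sym (sumTo-0 n)
sumTo-swap (suc m) n f = ≡.trans (≡.cong (ℕ._+ sumTo n (f m)) (sumTo-swap m n f))
  (≡.sym (sumTo-+ n (λ j → sumTo m (λ i → f i j)) (f m)))

sumTo-split : ∀ a b f → sumTo (b ℕ.+ a) f ≡ sumTo a f ℕ.+ sumTo b (λ l → f (l ℕ.+ a))
sumTo-split a zero    f = ≡.sym (ℕ.+-identityʳ _)
sumTo-split a (suc b) f = ≡.trans (≡.cong (ℕ._+ f (b ℕ.+ a)) (sumTo-split a b f))
    (ℕ.+-assoc (sumTo a f) _ _)

sumTo-blocks : ∀ d e f → sumTo (d ℕ.* e) f ≡ sumTo d (λ i → sumTo e (λ l → f (l ℕ.+ i ℕ.* e)))
sumTo-blocks zero    e f = ≡.refl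
sumTo-blocks (suc d) e f = ≡.trans (sumTo-split (d ℕ.* e) e f)
  (≡.cong (ℕ._+ sumTo e (λ l → f (l ℕ.+ d ℕ.* e))) (sumTo-blocks d e f))

sumTo-single : ∀ n f k → k < n → (∀ i → i < n → i ≢ k → f i ≡ 0) → sumTo n f ≡ f k
sumTo-single (suc n) f k k<n z with k ℕ.≟ n
... | yes ≡.refl = ≡.cong (ℕ._+ f n) (≡.trans
      (sumTo-cong n λ i l → z i (ℕ.m<n⇒m<1+n l) (ℕ.<⇒≢ l)) (sumTo-0 n))
... | no k≢n = ≡.trans (≡.cong₂ ℕ._+_
      (sumTo-single n f k (ℕ.≤∧≢⇒< (ℕ.≤-pred k<n) k≢n) (λ i l → z i (ℕ.m<n⇒m<1+n l)))
      (z n ℕ.≤-refl (λ e → k≢n (≡.sym e)))) (ℕ.+-identityʳ _)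

term≤sumTo : ∀ n f k → k < n → f k ≤ sumTo n f
term≤sumTo (suc n) f k k<n with k ℕ.≟ n
... | yes ≡.refl = ℕ.m≤n+m (f n) (sumTo n f)
... | no k≢n     = ℕ.≤-trans (term≤sumTo n f k (ℕ.≤∧≢⇒< (ℕ.≤-pred k<n) k≢n)) (ℕ.m≤m+n _ (f n))

opaque
  ind : {A : Set} → Dec A → ℕ
  ind d = if does d then 1 else 0

  ind-yes : {A : Set} (d : Dec A) → A → ind d ≡ 1
  ind-yes d a rewrite dec-true d a = ≡.refl

  ind-no : {A : Set} (d : Dec A) → ¬ A → ind d ≡ 0
  ind-no d a rewrite dec-false d a = ≡.refl

  ind-⇔ : {A B : Set} (d : Dec A) (d′ : Dec B) → (A → B) → (B → A) → ind d ≡ ind d′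
  ind-⇔ d (yes b) f g = ≡.trans (ind-yes d (g b)) ≡.refl
  ind-⇔ d (no nb) f g = ≡.trans (ind-no d (λ a → nb (f a))) ≡.refl

-- Euler's totient. Counting from 0 gives `φ 1 = 1`, because `gcd 0 1 = 1`.
φ : ℕ → ℕ
φ n = sumTo n (λ j → ind (gcd j n ℕ.≟ 1))

φ≥1 : ∀ n → 1 ≤ φ (suc n)
φ≥1 zero    = ℕ.≤-reflexive (≡.sym (ind-yes (gcd 0 1 ℕ.≟ 1) ≡.refl))
φ≥1 (suc n) = ℕ.≤-trans (ℕ.≤-reflexive (≡.sym (ind-yes (gcd 1 (suc (suc n)) ℕ.≟ 1)
    (ℕ∣.∣1⇒≡1 (gcd[m,n]∣m 1 (suc (suc n)))))))
  (term≤sumTo (suc (suc n)) (λ j → ind (gcd j (suc (suc n)) ℕ.≟ 1)) 1 (s≤s (s≤s z≤n)))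

-- Both sides count the j < n of additive order D modulo n = D e.
φ-block : ∀ D e n → D ≢ 0 → e ≢ 0 → D ℕ.* e ≡ n → sumTo n (λ j → ind (gcd j n ℕ.* D ℕ.≟ n)) ≡ φ D
φ-block D zero    _ _ e≢0 ≡.refl = ⊥-elim (e≢0 ≡.refl)
φ-block D (suc e) n D≢0 _ ≡.refl = ≡.trans (sumTo-blocks D e⁺ _) (sumTo-cong D λ i _ → block i)
  where
  e⁺ = suc e
  gcd≡e⁺ : ∀ {g} → g ℕ.* D ≡ n → g ≡ e⁺
  gcd≡e⁺ {g} eq = ℕ.*-cancelʳ-≡ g e⁺ D {{ℕ.≢-nonZero D≢0}} (≡.trans eq (ℕ.*-comm D e⁺))
  gcd-e⁺ : ∀ i → gcd (i ℕ.* e⁺) n ≡ e⁺ ℕ.* gcd i D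
  gcd-e⁺ i = ≡.trans (≡.cong₂ gcd (ℕ.*-comm i e⁺) (ℕ.*-comm D e⁺)) (≡.sym (c*gcd[m,n]≡gcd[cm,cn] e⁺ i D))
  block : ∀ i → sumTo e⁺ (λ l → ind (gcd (l ℕ.+ i ℕ.* e⁺) n ℕ.* D ℕ.≟ n)) ≡ ind (gcd i D ℕ.≟ 1)
  block i = ≡.trans (sumTo-single e⁺ _ 0 (s≤s z≤n) off) (ind-⇔ _ _ to from)
    where
    off : ∀ l → l < e⁺ → l ≢ 0 → ind (gcd (l ℕ.+ i ℕ.* e⁺) n ℕ.* D ℕ.≟ n) ≡ 0
    off l l<e⁺ l≢0 = ind-no _ λ eq → ℕ∣.>⇒∤ {{ℕ.≢-nonZero l≢0}} l<e⁺
      (ℕ∣.∣m+n∣m⇒∣n (≡.subst (_ℕ∣ i ℕ.* e⁺ ℕ.+ l) (gcd≡e⁺ eq)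
        (≡.subst (gcd (l ℕ.+ i ℕ.* e⁺) n ℕ∣_) (ℕ.+-comm l (i ℕ.* e⁺)) (gcd[m,n]∣m (l ℕ.+ i ℕ.* e⁺) n)))
        (ℕ∣.n∣m*n i))
    to : gcd (i ℕ.* e⁺) n ℕ.* D ≡ n → gcd i D ≡ 1
    to eq = ℕ.*-cancelˡ-≡ (gcd i D) 1 e⁺
      (≡.trans (≡.sym (gcd-e⁺ i)) (≡.trans (gcd≡e⁺ eq) (≡.sym (ℕ.*-identityʳ e⁺))))
    from : gcd i D ≡ 1 → gcd (i ℕ.* e⁺) n ℕ.* D ≡ n
    from eq = ≡.trans (≡.cong (ℕ._* D) (≡.trans (gcd-e⁺ i)
        (≡.trans (≡.cong (e⁺ ℕ.*_) eq) (ℕ.*-identityʳ e⁺)))) (ℕ.*-comm e⁺ D)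

-- Each `j < n` is counted for the single divisor `suc d = n / gcd j n`, its additive order modulo
-- `n`; exchanging the sums therefore gives `n`.
φ-sum : ∀ k → let n = suc k in sumTo n (λ d → ind (suc d ∣? n) ℕ.* φ (suc d)) ≡ n
φ-sum k = ≡.trans (sumTo-cong n λ d _ → pointwise d) (≡.trans
    (sumTo-swap n n (λ d j → ind (gcd j n ℕ.* suc d ℕ.≟ n)))
    (≡.trans (sumTo-cong n λ j _ → one j) (sumTo-1 n)))
  where
  n = suc k
  pointwise : ∀ d → ind (suc d ∣? n) ℕ.* φ (suc d) ≡ sumTo n (λ j → ind (gcd j n ℕ.* suc d ℕ.≟ n))
  pointwise d = go (suc d ∣? n)
    where
    go : Dec (suc d ℕ∣ n) → ind (suc d ∣? n) ℕ.* φ (suc d) ≡ sumTo n (λ j → ind (gcd j n ℕ.* suc d ℕ.≟ n))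
    go (yes (ℕ∣.divides e eq)) = ≡.trans (≡.cong (ℕ._* φ (suc d)) (ind-yes (suc d ∣? n) (ℕ∣.divides e eq)))
      (≡.trans (ℕ.*-identityˡ _) (≡.sym (φ-block (suc d) e n (λ ()) e≢0
          (≡.trans (ℕ.*-comm (suc d) e) (≡.sym eq)))))
      where
      e≢0 : e ≢ 0
      e≢0 z = ℕ.1+n≢0 (≡.trans eq (≡.cong (ℕ._* suc d) z))
    go (no nd) = ≡.trans (≡.cong (ℕ._* φ (suc d)) (ind-no (suc d ∣? n) nd))
      (≡.sym (≡.trans (sumTo-cong n λ j _ → ind-no _ λ eq → nd (ℕ∣.divides (gcd j n) (≡.sym eq)))
          (sumTo-0 n)))
  one : ∀ j → sumTo n (λ d → ind (gcd j n ℕ.* suc d ℕ.≟ n)) ≡ 1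
  one j with gcd[m,n]∣n j n
  ... | ℕ∣.divides zero ()
  ... | ℕ∣.divides (suc q) eq = ≡.trans (sumTo-single n _ q q<n off) (ind-yes _ eq′)
    where
    g = gcd j n
    eq′ : g ℕ.* suc q ≡ n
    eq′ = ≡.trans (ℕ.*-comm g (suc q)) (≡.sym eq)
    g≢0 : g ≢ 0
    g≢0 z = ℕ.1+n≢0 (≡.trans eq (≡.trans (≡.cong (suc q ℕ.*_) z) (ℕ.*-zeroʳ (suc q))))
    q<n : q < n
    q<n = ≡.subst (suc q ≤_) (≡.sym eq) (ℕ.m≤m*n (suc q) g {{ℕ.≢-nonZero g≢0}})
    off : ∀ d → d < n → d ≢ q → ind (g ℕ.* suc d ℕ.≟ n) ≡ 0
    off d _ d≢q = ind-no _ λ e → d≢q (ℕ.suc-injective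
        (ℕ.*-cancelˡ-≡ (suc d) (suc q) g {{ℕ.≢-nonZero g≢0}} (≡.trans e (≡.sym eq′))))

Monic-Π : ∀ (ψ : ℕ → ℕ) n j → (∀ d → d < j → Monic (ψ d) (Φ′ (suc d))) →
          Monic (sumTo j (λ d → ind (suc d ∣? n) ℕ.* ψ d)) (Π n j)
Monic-Π ψ n zero    M = Monic-resp (≋-sym (Π-0 n)) Monic-𝟙
Monic-Π ψ n (suc j) M = go (suc j ∣? n)
  where
  s = sumTo j (λ d → ind (suc d ∣? n) ℕ.* ψ d)
  ih : Monic s (Π n j)
  ih = Monic-Π ψ n j (λ d l → M d (ℕ.m<n⇒m<1+n l))
  go : Dec (suc j ℕ∣ n) → Monic (sumTo j (λ d → ind (suc d ∣? n) ℕ.* ψ d) ℕ.+ ind (suc j ∣? n) ℕ.* ψ j)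
      (Π n (suc j))
  go (yes d) rewrite ind-yes (suc j ∣? n) d = Monic-resp (≋-sym (Π-∣ d))
    (≡.subst (λ k → Monic k (Φ′ (suc j) ⊗ Π n j))
      (≡.trans (ℕ.+-comm (ψ j) s) (≡.cong (s ℕ.+_) (≡.sym (ℕ.+-identityʳ (ψ j)))))
          (Monic-⊗ (M j ℕ.≤-refl) ih))
  go (no nd) rewrite ind-no (suc j ∣? n) nd = Monic-resp (≋-sym (Π-∤ nd))
    (≡.subst (λ k → Monic k (Π n j)) (≡.sym (ℕ.+-identityʳ _)) ih)

-- Comparing degrees in `Y (suc n) = Φ′ (suc n) ⊗ Π (suc n) n` gives the degree of `Φ′` the same
-- recursion over divisors that `φ-sum` gives `φ`.
Monic-Φ : ∀ n → Monic (φ (suc n)) (Φ′ (suc n))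
Monic-Φ = <-rec (λ n → Monic (φ (suc n)) (Φ′ (suc n))) step
  where
  step : ∀ n → (∀ {m} → m < n → Monic (φ (suc m)) (Φ′ (suc m))) → Monic (φ (suc n)) (Φ′ (suc n))
  step n ih with Monic-quotient (Monic-Π (λ d → φ (suc d)) (suc n) n (λ d l → ih l))
      (Monic-resp (CyclotomicFactorisation.split (cyclotomicFactorisation n)) (Monic-Y n))
  ... | e , M , eq = ≡.subst (λ k → Monic k (Φ′ (suc n))) (ℕ.+-cancelʳ-≡ s e (φ (suc n)) (≡.trans eq
        (≡.trans (≡.sym (φ-sum n)) (≡.trans (ℕ.+-comm s (ind (suc n ∣? suc n) ℕ.* φ (suc n)))
            (≡.cong (ℕ._+ s)
          (≡.trans (≡.cong (ℕ._* φ (suc n)) (ind-yes (suc n ∣? suc n) ℕ∣.∣-refl))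
              (ℕ.*-identityˡ (φ (suc n))))))))) M
    where s = sumTo n (λ d → ind (suc d ∣? suc n) ℕ.* φ (suc d))

-- Composition and the Frobenius congruence

opaque
  unfolding _⊕_
  comp : Pol → Pol → Pol
  comp []      r = 𝟘
  comp (a ∷ f) r = C a ⊕ r ⊗ comp f r

  comp-∷ : ∀ a f r → comp (a ∷ f) r ≋ C a ⊕ r ⊗ comp f r
  comp-∷ a f r = ≋-refl

  comp-[] : ∀ r → comp [] r ≋ 𝟘
  comp-[] r = ≋-refl

  comp-𝟘 : ∀ {f} r → f ≋ [] → comp f r ≋ 𝟘
  comp-𝟘 {[]}    r e = ≋-refl
  comp-𝟘 {a ∷ f} r e = ≋-trans (⊕-cong {C a} (≋-trans (≡⇒≋ (≡.cong C (at e 0))) C-0)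
    (≋-trans (⊗-congˡ {r} (comp-𝟘 r (Z.tail≋0 e))) (ZX.zeroʳ r))) (ZX.+-identityˡ 𝟘)

  comp-congˡ : ∀ {f g} r → f ≋ g → comp f r ≋ comp g r
  comp-congˡ {[]}    {g}     r e = ≋-sym (comp-𝟘 r (≋-sym e))
  comp-congˡ {a ∷ f} {[]}    r e = comp-𝟘 r e
  comp-congˡ {a ∷ f} {b ∷ g} r e = ⊕-cong {C a} (≡⇒≋ (≡.cong C (at e 0)))
      (⊗-congˡ {r} (comp-congˡ r (Z.tail≋ e)))

  comp-congʳ : ∀ f {r s} → r ≋ s → comp f r ≋ comp f s
  comp-congʳ []      e = ≋-refl
  comp-congʳ (a ∷ f) e = ⊕-congˡ {C a} (⊗-cong e (comp-congʳ f e))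

  comp-⊕ : ∀ f g r → comp (f ⊕ g) r ≋ comp f r ⊕ comp g r
  comp-⊕ []      g       r = ≋-sym (ZX.+-identityˡ (comp g r))
  comp-⊕ (a ∷ f) []      r = ≋-sym (ZX.+-identityʳ (comp (a ∷ f) r))
  comp-⊕ (a ∷ f) (b ∷ g) r = begin
    C (a ℤ.+ b) ⊕ r ⊗ comp (f ⊕ g) r                        ≈⟨ ⊕-cong (C-+ a b)
        (⊗-congˡ {r} (comp-⊕ f g r)) ⟩
    (C a ⊕ C b) ⊕ r ⊗ (comp f r ⊕ comp g r)
      ≈⟨ solve 5 (λ a b r f g → (a :+ b) :+ r :* (f :+ g) := (a :+ r :* f) :+ (b :+ r :* g)) ≋-refl
           (C a) (C b) r (comp f r) (comp g r) ⟩
    (C a ⊕ r ⊗ comp f r) ⊕ (C b ⊕ r ⊗ comp g r)          ∎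

  comp-· : ∀ a f r → comp (a ℤ[X].· f) r ≋ C a ⊗ comp f r
  comp-· a []      r = ≋-sym (ZX.zeroʳ (C a))
  comp-· a (b ∷ f) r = begin
    C (a ℤ.* b) ⊕ r ⊗ comp (a ℤ[X].· f) r   ≈⟨ ⊕-cong (C-* a b) (⊗-congˡ {r} (comp-· a f r)) ⟩
    C a ⊗ C b ⊕ r ⊗ (C a ⊗ comp f r)
      ≈⟨ solve 4 (λ a b r f → a :* b :+ r :* (a :* f) := a :* (b :+ r :* f)) ≋-refl (C a) (C b) r
          (comp f r) ⟩
    C a ⊗ (C b ⊕ r ⊗ comp f r)           ∎

  comp-⊗ : ∀ f g r → comp (f ⊗ g) r ≋ comp f r ⊗ comp g r
  comp-⊗ []      g r = ≋-sym (ZX.zeroˡ (comp g r))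
  comp-⊗ (a ∷ f) g r = begin
    comp (a ℤ[X].· g ⊕ (+ 0 ∷ f ⊗ g)) r                   ≈⟨ comp-⊕ (a ℤ[X].· g) (+ 0 ∷ f ⊗ g) r ⟩
    comp (a ℤ[X].· g) r ⊕ (C (+ 0) ⊕ r ⊗ comp (f ⊗ g) r)
      ≈⟨ ⊕-cong (comp-· a g r) (⊕-cong C-0 (⊗-congˡ {r} (comp-⊗ f g r))) ⟩
    C a ⊗ comp g r ⊕ (𝟘 ⊕ r ⊗ (comp f r ⊗ comp g r))  ≈⟨ ⊕-congˡ {C a ⊗ comp g r} (ZX.+-identityˡ _) ⟩
    C a ⊗ comp g r ⊕ r ⊗ (comp f r ⊗ comp g r)
      ≈⟨ solve 4 (λ a r f g → a :* g :+ r :* (f :* g) := (a :+ r :* f) :* g) ≋-refl (C a) r (comp f r)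
          (comp g r) ⟩
    (C a ⊕ r ⊗ comp f r) ⊗ comp g r                   ∎

  comp-C : ∀ a r → comp (C a) r ≋ C a
  comp-C a r = ≋-trans (⊕-congˡ {C a} (ZX.zeroʳ r)) (ZX.+-identityʳ (C a))

  comp-X : ∀ n r → comp (X n) r ≋ r ^ n
  comp-X zero    r = comp-C (+ 1) r
  comp-X (suc n) r = ≋-trans (⊕-cong C-0 (⊗-congˡ {r} (comp-X n r))) (ZX.+-identityˡ _)

comp-assoc : ∀ f r s → comp (comp f r) s ≋ comp f (comp r s)
comp-assoc []      r s = ≋-trans (comp-congˡ s (≋-trans (comp-[] r) (≡⇒≋ (≡.sym 𝟘-def))))
  (≋-trans (comp-[] s) (≋-sym (comp-[] (comp r s))))
comp-assoc (a ∷ f) r s = begin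
  comp (comp (a ∷ f) r) s                  ≈⟨ comp-congˡ s (comp-∷ a f r) ⟩
  comp (C a ⊕ r ⊗ comp f r) s           ≈⟨ comp-⊕ (C a) (r ⊗ comp f r) s ⟩
  comp (C a) s ⊕ comp (r ⊗ comp f r) s  ≈⟨ ⊕-cong (comp-C a s) (comp-⊗ r (comp f r) s) ⟩
  C a ⊕ comp r s ⊗ comp (comp f r) s    ≈⟨ ⊕-congˡ (⊗-congˡ (comp-assoc f r s)) ⟩
  C a ⊕ comp r s ⊗ comp f (comp r s)    ≈⟨ comp-∷ a f (comp r s) ⟨
  comp (a ∷ f) (comp r s)                  ∎

X-^ : ∀ a b → X b ^ a ≋ X (a ℕ.* b)
X-^ zero    b = ≋-sym X-0
X-^ (suc a) b = ≋-trans (⊗-congˡ (X-^ a b)) (≋-sym (X-+ b (a ℕ.* b)))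

comp-XX : ∀ f a b → comp (comp f (X a)) (X b) ≋ comp f (X (a ℕ.* b))
comp-XX f a b = ≋-trans (comp-assoc f (X a) (X b)) (comp-congʳ f (≋-trans (comp-X a (X b)) (X-^ a b)))

comp-mod : ∀ {h r s} f → h ∣ₚ r ⊕ ⊖ s → h ∣ₚ comp f r ⊕ ⊖ comp f s
comp-mod {h} {r} {s} []      d = ∣ₚ-respʳ (≋-sym (≋-trans (⊕-cong (comp-[] r) (⊖-cong (comp-[] s)))
    (ZX.-‿inverseʳ 𝟘))) ∣ₚ-𝟘
comp-mod {h} {r} {s} (a ∷ f) d = ∣ₚ-respʳ (begin
  (r ⊕ ⊖ s) ⊗ comp f r ⊕ s ⊗ (comp f r ⊕ ⊖ comp f s)
    ≈⟨ solve 5 (λ a r s f g → (r :+ :- s) :* f :+ s :* (f :+ :- g) := (a :+ r :* f) :+ :- (a :+ s :* g))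
        ≋-refl (C a) r s (comp f r) (comp f s) ⟩
  C a ⊕ r ⊗ comp f r ⊕ ⊖ (C a ⊕ s ⊗ comp f s)   ≈⟨ ⊕-cong (comp-∷ a f r) (⊖-cong (comp-∷ a f s)) ⟨
  comp (a ∷ f) r ⊕ ⊖ comp (a ∷ f) s ∎) (∣ₚ-⊕ (∣ₚ-⊗ʳ (comp f r) d) (∣ₚ-⊗ˡ s (comp-mod f d)))

comp-∣ : ∀ {f g} r → f ∣ₚ g → comp f r ∣ₚ comp g r
comp-∣ {f} {g} r (divides q e) = divides (comp q r) (≋-trans (≋-sym (comp-⊗ q f r)) (comp-congˡ r e))

p∤! : ∀ {p} → Prime p → ∀ j → j < p → ¬ p ℕ∣ j !
p∤! pp zero    l d = ℕ.<⇒≢ (ℕ.nonTrivial⇒n>1 _ {{prime⇒nonTrivial pp}}) (≡.sym (ℕ∣.∣1⇒≡1 d))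
p∤! pp (suc j) l d with euclidsLemma (suc j) (j !) pp d
... | inj₁ e = ℕ∣.>⇒∤ l e
... | inj₂ e = p∤! pp j (ℕ.<-trans (ℕ.n<1+n j) l) e

p∣pCk : ∀ {p} → Prime p → ∀ k → 0 < k → k < p → p ℕ∣ p choose k
p∣pCk {p} pp k 0<k k<p with euclidsLemma (p choose k) (k ! ℕ.* (p ℕ.∸ k) !) pp p∣
  where
  instance _ = ℕ.m*n≢0 (k !) ((p ℕ.∸ k) !) {{ℕ._!≢0 k}} {{ℕ._!≢0 (p ℕ.∸ k)}}
  p∣p! : ∀ {p} → 0 < p → p ℕ∣ p !
  p∣p! {suc p} _ = ℕ∣.m∣m*n (p !)
  p∣ : p ℕ∣ (p choose k) ℕ.* (k ! ℕ.* (p ℕ.∸ k) !)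
  p∣ = ≡.subst (p ℕ∣_) (≡.sym (≡.trans (≡.cong (ℕ._* (k ! ℕ.* (p ℕ.∸ k) !)) (nCk≡n!/k![n-k]! (ℕ.<⇒≤ k<p)))
    (m/n*n≡m (≡.subst (_ℕ∣ p !) (ℕ.*-comm ((p ℕ.∸ k) !) (k !)) (Spec.[n∸k]!k!∣n! (ℕ.<⇒≤ k<p))))))
    (p∣p! (ℕ.<-trans 0<k k<p))
... | inj₁ d = d
... | inj₂ d with euclidsLemma (k !) ((p ℕ.∸ k) !) pp d
...   | inj₁ e = ⊥-elim (p∤! pp k k<p e)
...   | inj₂ e = ⊥-elim (p∤! pp (p ℕ.∸ k) (ℕ.∸-monoʳ-< 0<k (ℕ.<⇒≤ k<p)) e)

open import Algebra.Properties.CommutativeSemiring.Binomial ZX.commutativeSemiring using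
    (theorem; binomialTerm)
open import Algebra.Properties.Semiring.Mult ZX.semiring using () renaming (_×_ to _×ₚ_)
open import Algebra.Properties.Monoid.Sum ZX.+-monoid using (sum-init-last) renaming (sum to sumₚ)

×≋C⊗ : ∀ n f → n ×ₚ f ≋ C (+ n) ⊗ f
×≋C⊗ zero    f = ≋-sym (≋-trans (⊗-congʳ C-0) (ZX.zeroˡ f))
×≋C⊗ (suc n) f = ≋-trans (⊕-congˡ (×≋C⊗ n f)) (≋-sym (≋-trans (⊗-congʳ (C-+ (+ 1) (+ n)))
  (≋-trans (ZX.distribʳ f 𝟙 (C (+ n))) (⊕-congʳ (ZX.*-identityˡ f)))))

C∣C : ∀ {p n} → p ℕ∣ n → C (+ p) ∣ₚ C (+ n)
C∣C {p} (ℕ∣.divides q ≡.refl) = divides (C (+ q)) (≋-trans (≋-sym (C-* (+ q) (+ p)))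
    (≡⇒≋ (≡.cong C (≡.sym (ℤ.pos-* q p)))))

sum-∣ : ∀ {h n} (t : Fin n → Pol) → (∀ i → h ∣ₚ t i) → h ∣ₚ sumₚ t
sum-∣ {n = zero}  t d = ∣ₚ-𝟘
sum-∣ {n = suc n} t d = ∣ₚ-⊕ (d Fin.zero) (sum-∣ (λ i → t (Fin.suc i)) (λ i → d (Fin.suc i)))

frobenius-⊕ : ∀ {p} → Prime p → ∀ f g → C (+ p) ∣ₚ (f ⊕ g) ^ p ⊕ ⊖ (f ^ p ⊕ g ^ p)
frobenius-⊕ {zero}        pp f g = ⊥-elim (ℕ.≢-nonZero⁻¹ 0 {{prime⇒nonZero pp}} ≡.refl)
frobenius-⊕ {suc q} pp f g = ∣ₚ-respʳ (≋-sym (begin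
  (f ⊕ g) ^ p ⊕ ⊖ (f ^ p ⊕ g ^ p)        ≈⟨ ⊕-congʳ (theorem p f g) ⟩
  t Fin.zero ⊕ sumₚ (λ i → t (Fin.suc i)) ⊕ ⊖ (f ^ p ⊕ g ^ p)
    ≈⟨ ⊕-congʳ (⊕-congˡ (sum-init-last (λ i → t (Fin.suc i)))) ⟩
  t Fin.zero ⊕ (mid ⊕ t (Fin.suc (fromℕ q))) ⊕ ⊖ (f ^ p ⊕ g ^ p)
    ≈⟨ ⊕-congʳ (⊕-cong t0 (⊕-congˡ tp)) ⟩
  g ^ p ⊕ (mid ⊕ f ^ p) ⊕ ⊖ (f ^ p ⊕ g ^ p)
    ≈⟨ solve 3 (λ a b c → a :+ (b :+ c) :+ :- (c :+ a) := b) ≋-refl (g ^ p) mid (f ^ p) ⟩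
  mid ∎)) (sum-∣ _ λ i → mid∣ i)
  where
  p = suc q
  t : Fin (suc p) → Pol
  t = binomialTerm f g p
  mid = sumₚ (λ i → t (Fin.suc (inject₁ i)))
  t0 : t Fin.zero ≋ g ^ p
  t0 = ≋-trans (ZX.+-identityʳ _) (ZX.*-identityˡ _)
  tp : t (Fin.suc (fromℕ q)) ≋ f ^ p
  tp rewrite Fin.toℕ-fromℕ q | nCn≡1 p | ℕ.n∸n≡0 q = ≋-trans (ZX.+-identityʳ _) (ZX.*-identityʳ _)
  mid∣ : ∀ i → C (+ p) ∣ₚ t (Fin.suc (inject₁ i))
  mid∣ i = ∣ₚ-respʳ (≋-sym (×≋C⊗ (p choose k) _)) (∣ₚ-⊗ʳ _ (C∣C (p∣pCk pp k (s≤s z≤n)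
    (s≤s (≡.subst (_< q) (≡.sym (Fin.toℕ-inject₁ i)) (Fin.toℕ<n i))))))
    where k = suc (toℕ (inject₁ i))

𝟙^ : ∀ n → 𝟙 ^ n ≋ 𝟙
𝟙^ zero    = ≋-refl
𝟙^ (suc n) = ≋-trans (ZX.*-identityˡ _) (𝟙^ n)

fermat-ℕ : ∀ {p} → Prime p → ∀ n → C (+ p) ∣ₚ C (+ n) ^ p ⊕ ⊖ C (+ n)
fermat-ℕ {p} pp zero  = ∣ₚ-respʳ (≋-sym (0^ p (prime⇒nonZero pp))) ∣ₚ-𝟘
  where
  0^ : ∀ p → ℕ.NonZero p → C (+ 0) ^ p ⊕ ⊖ C (+ 0) ≋ 𝟘
  0^ (suc q) _ = ≋-trans (⊕-cong (≋-trans (⊗-congʳ C-0) (ZX.zeroˡ _)) (⊖-cong C-0)) (ZX.-‿inverseʳ 𝟘)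
fermat-ℕ {p} pp (suc n) = ∣ₚ-respʳ (begin
  (f ⊕ 𝟙) ^ p ⊕ ⊖ (f ^ p ⊕ 𝟙 ^ p) ⊕ (f ^ p ⊕ ⊖ f)
    ≈⟨ ⊕-congʳ (⊕-cong (^-congˡ p f+1) (⊖-cong (⊕-congˡ (𝟙^ p)))) ⟩
  C (+ suc n) ^ p ⊕ ⊖ (f ^ p ⊕ 𝟙) ⊕ (f ^ p ⊕ ⊖ f)
    ≈⟨ solve 3 (λ a b c → a :+ :- (b :+ con (+ 1)) :+ (b :+ :- c) := a :+ :- (c :+ con (+ 1))) ≋-refl
        (C (+ suc n) ^ p) (f ^ p) f ⟩
  C (+ suc n) ^ p ⊕ ⊖ (f ⊕ 𝟙)    ≈⟨ ⊕-congˡ (⊖-cong f+1) ⟩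
  C (+ suc n) ^ p ⊕ ⊖ C (+ suc n) ∎) (∣ₚ-⊕ (frobenius-⊕ pp f 𝟙) (fermat-ℕ pp n))
  where
  f = C (+ n)
  f+1 : f ⊕ 𝟙 ≋ C (+ suc n)
  f+1 = ≋-trans (≋-sym (C-+ (+ n) (+ 1))) (≡⇒≋ (≡.cong (λ k → C (+ k)) (ℕ.+-comm n 1)))

fermat : ∀ {p} → Prime p → ∀ a → C (+ p) ∣ₚ C a ^ p ⊕ ⊖ C a
fermat pp (+ n) = fermat-ℕ pp n
-- In `0 = (n + 1) + (-(n + 1))`, additivity of the p-th power modulo `p` and the congruences for 0
-- and for `n + 1` leave the one for the negative summand.
fermat {p} pp -[1+ n ] = ∣ₚ-respʳ (begin
  ⊖ ((f ⊕ g) ^ p ⊕ ⊖ (f ^ p ⊕ g ^ p)) ⊕ ⊖ (f ^ p ⊕ ⊖ f) ⊕ ((f ⊕ g) ^ p ⊕ ⊖ (f ⊕ g))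
    ≈⟨ solve 5 (λ s a b f g → :- (s :+ :- (a :+ b)) :+ :- (a :+ :- f) :+ (s :+ :- (f :+ g)) := b :+ :- g)
        ≋-refl ((f ⊕ g) ^ p) (f ^ p) (g ^ p) f g ⟩
  g ^ p ⊕ ⊖ g ∎) (∣ₚ-⊕ (∣ₚ-⊕ (∣ₚ-⊖ (frobenius-⊕ pp f g)) (∣ₚ-⊖ (fermat-ℕ pp (suc n))))
    (∣ₚ-respʳ (⊕-cong (^-congˡ p f+g) (⊖-cong f+g)) (fermat-ℕ pp 0)))
  where
  f = C (+ suc n)
  g = C -[1+ n ]
  f+g : C (+ 0) ≋ f ⊕ g
  f+g = ≋-trans (≡⇒≋ (≡.cong C (≡.sym (ℤ.+-inverseʳ (+ suc n))))) (C-+ (+ suc n) -[1+ n ])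

^-distrib-⊗ : ∀ f g n → (f ⊗ g) ^ n ≋ f ^ n ⊗ g ^ n
^-distrib-⊗ f g zero    = ≋-sym (ZX.*-identityˡ 𝟙)
^-distrib-⊗ f g (suc n) = ≋-trans (⊗-congˡ (^-distrib-⊗ f g n))
  (solve 4 (λ f g a b → f :* g :* (a :* b) := f :* a :* (g :* b)) ≋-refl f g (f ^ n) (g ^ n))

frobenius : ∀ {p} → Prime p → ∀ f → C (+ p) ∣ₚ comp f (X p) ⊕ ⊖ (f ^ p)
frobenius {p} pp [] = ∣ₚ-respʳ (≋-sym (≋-trans (⊕-cong (comp-[] (X p)) (⊖-cong (0^ p (prime⇒nonZero pp))))
    (ZX.-‿inverseʳ 𝟘))) ∣ₚ-𝟘
  where
  0^ : ∀ p → ℕ.NonZero p → [] ^ p ≋ 𝟘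
  0^ (suc q) _ = ≋-trans (⊗-congʳ (≡⇒≋ 𝟘-def)) (ZX.zeroˡ _)
frobenius {p} pp (a ∷ f) = ∣ₚ-respʳ (begin
  ⊖ (S ⊕ ⊖ (C a ^ p ⊕ (X 1 ⊗ f) ^ p)) ⊕ ⊖ (C a ^ p ⊕ ⊖ C a) ⊕ X p ⊗ (comp f (X p) ⊕ ⊖ (f ^ p))
    ≈⟨ ⊕-congʳ (⊕-congʳ (⊖-cong (⊕-congˡ (⊖-cong (⊕-congˡ xf))))) ⟩
  ⊖ (S ⊕ ⊖ (C a ^ p ⊕ X p ⊗ f ^ p)) ⊕ ⊖ (C a ^ p ⊕ ⊖ C a) ⊕ X p ⊗ (comp f (X p) ⊕ ⊖ (f ^ p))
    ≈⟨ solve 6 (λ s a′ x f′ a c → :- (s :+ :- (a′ :+ x :* f′)) :+ :- (a′ :+ :- a) :+ x :* (c :+ :- f′) :=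
        (a :+ x :* c) :+ :- s) ≋-refl
         S (C a ^ p) (X p) (f ^ p) (C a) (comp f (X p)) ⟩
  (C a ⊕ X p ⊗ comp f (X p)) ⊕ ⊖ S   ≈⟨ ⊕-cong (≋-sym (comp-∷ a f (X p)))
      (⊖-cong (^-congˡ p (≋-sym (∷-def a f)))) ⟩
  comp (a ∷ f) (X p) ⊕ ⊖ ((a ∷ f) ^ p)  ∎)
  (∣ₚ-⊕ (∣ₚ-⊕ (∣ₚ-⊖ (frobenius-⊕ pp (C a) (X 1 ⊗ f))) (∣ₚ-⊖ (fermat pp a))) (∣ₚ-⊗ˡ (X p) (frobenius pp f)))
  where
  S = (C a ⊕ X 1 ⊗ f) ^ p
  xf : (X 1 ⊗ f) ^ p ≋ X p ⊗ f ^ p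
  xf = ≋-trans (^-distrib-⊗ (X 1) f p) (⊗-congʳ (≋-trans (X-^ p 1) (≡⇒≋ (≡.cong X (ℕ.*-identityʳ p)))))

-- Irreducibility of the cyclotomic polynomials

norm₁ : Pol → ℕ
norm₁ []      = 0
norm₁ (a ∷ f) = ∣ a ∣ ℕ.+ norm₁ f

∣co∣≤norm₁ : ∀ f i → ∣ co f i ∣ ≤ norm₁ f
∣co∣≤norm₁ []      i       = z≤n
∣co∣≤norm₁ (a ∷ f) zero    = ℕ.m≤m+n ∣ a ∣ (norm₁ f)
∣co∣≤norm₁ (a ∷ f) (suc i) = ℕ.≤-trans (∣co∣≤norm₁ f i) (ℕ.m≤n+m (norm₁ f) ∣ a ∣)

comp-X1 : ∀ f → comp f (X 1) ≋ f
comp-X1 []      = ≋-trans (comp-[] (X 1)) (≡⇒≋ (≡.sym 𝟘-def))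
comp-X1 (a ∷ f) = ≋-trans (comp-∷ a f (X 1)) (≋-trans (⊕-congˡ (⊗-congˡ (comp-X1 f))) (≋-sym (∷-def a f)))

∣ₚ-^ : ∀ {f} n → n ≢ 0 → f ∣ₚ f ^ n
∣ₚ-^ zero    nz = ⊥-elim (nz ≡.refl)
∣ₚ-^ (suc n) nz = f∣ₚf⊗g _ _

∣ₚ-diff : ∀ {h} f g k → h ∣ₚ f ⊕ ⊖ g → h ∣ₚ f ⊕ ⊖ k → h ∣ₚ g ⊕ ⊖ k
∣ₚ-diff f g k d e = ∣ₚ-respʳ (solve 3 (λ f g k → (f :+ :- k) :+ :- (f :+ :- g) := g :+ :- k) ≋-refl f g k)
    (∣ₚ-⊕ e (∣ₚ-⊖ d))

prime>1 : ∀ {q} → Prime q → 1 < q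
prime>1 pp = ℕ.nonTrivial⇒n>1 _ {{prime⇒nonTrivial pp}}

prime∤1 : ∀ {q} → Prime q → ¬ q ℕ∣ 1
prime∤1 pp d = ℕ.<⇒≢ (prime>1 pp) (≡.sym (ℕ∣.∣1⇒≡1 d))

-- The multiplier `t` of `landau`. A prime up to `b` divides it exactly when it does not divide `a`;
-- so if `a` and `n` are coprime, no such prime divides `a + t n`.
coprimeProduct : ℕ → ℕ → ℕ
coprimeProduct a zero    = 1
coprimeProduct a (suc i) with gcd (suc i) a ℕ.≟ 1
... | yes _ = suc i ℕ.* coprimeProduct a i
... | no  _ = coprimeProduct a i

coprimeProduct≢0 : ∀ a b → coprimeProduct a b ≢ 0
coprimeProduct≢0 a (suc i) with gcd (suc i) a ℕ.≟ 1
... | yes _ = λ z → coprimeProduct≢0 a i (ℕ.m+n≡0⇒m≡0 _ z)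
... | no  _ = coprimeProduct≢0 a i

∣coprimeProduct⇒∤ : ∀ {q} → Prime q → ∀ a b → q ℕ∣ coprimeProduct a b → ¬ q ℕ∣ a
∣coprimeProduct⇒∤ pp a zero    d _ = prime∤1 pp d
∣coprimeProduct⇒∤ pp a (suc i) d q∣a with gcd (suc i) a ℕ.≟ 1
... | no  _ = ∣coprimeProduct⇒∤ pp a i d q∣a
... | yes e with euclidsLemma (suc i) (coprimeProduct a i) pp d
...   | inj₁ q∣i = prime∤1 pp (≡.subst (_ ℕ∣_) e (gcd-greatest q∣i q∣a))
...   | inj₂ d′  = ∣coprimeProduct⇒∤ pp a i d′ q∣a

coprime⇒∣coprimeProduct : ∀ a b q → suc q ≤ b → gcd (suc q) a ≡ 1 → suc q ℕ∣ coprimeProduct a b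
coprime⇒∣coprimeProduct a (suc i) q (s≤s q≤i) e with gcd (suc i) a ℕ.≟ 1 | q ℕ.≟ i
... | yes _ | yes ≡.refl = ℕ∣.m∣m*n (coprimeProduct a i)
... | no ne | yes ≡.refl = ⊥-elim (ne e)
... | yes _ | no q≢i     = ℕ∣.∣n⇒∣m*n (suc i) (coprime⇒∣coprimeProduct a i q (ℕ.≤∧≢⇒< q≤i q≢i) e)
... | no _  | no q≢i     = coprime⇒∣coprimeProduct a i q (ℕ.≤∧≢⇒< q≤i q≢i) e

prime-gcd : ∀ {q} → Prime q → ∀ a → ¬ q ℕ∣ a → gcd q a ≡ 1
prime-gcd {q} pp a q∤a with prime⇒irreducible pp (gcd[m,n]∣m q a)
... | inj₁ e = e
... | inj₂ e = ⊥-elim (q∤a (≡.subst (_ℕ∣ a) e (gcd[m,n]∣n q a)))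

-- Landau's argument: f(X^q) ≡ f(X)^q ≡ 0 modulo f and q, while the remainder of f(X^q) modulo f
-- takes only n values, so it vanishes for all large primes q.
module Landau {e n′ : ℕ} {f : Pol} (Mf : Monic e f) (f∣Y : f ∣ₚ Y (suc n′)) where
  private
    n = suc n′
    Q r : ℕ → Pol
    Q j = proj₁ (monic-divide Mf (comp f (X j)))
    r j = proj₁ (proj₂ (monic-divide Mf (comp f (X j))))
    -- Exceeds the absolute value of every coefficient of every `r j`, so that a prime `q ≥ B`
    -- dividing all of them forces them to be 0.
    B = suc (sumTo n (λ j → norm₁ (r j)))

  X-mod : ∀ j t → f ∣ₚ X (j ℕ.+ t ℕ.* n) ⊕ ⊖ X j
  X-mod j t = ∣ₚ-respʳ (≋-trans
    (solve 2 (λ x y → x :* (y :+ :- con (+ 1)) := x :* y :+ :- x) ≋-refl (X j) (X (t ℕ.* n)))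
    (⊕-congʳ (≋-sym (X-+ j (t ℕ.* n))))) (∣ₚ-⊗ˡ (X j) (∣ₚ-trans f∣Y (Y∣Y* n t)))

  largePrime : ∀ {q} → Prime q → B ≤ q → f ∣ₚ comp f (X q)
  largePrime {q} pp B≤q = ∣ₚ-respʳ (solve 2 (λ a b → (a :+ :- b) :+ b := a) ≋-refl (comp f (X q)) (r j))
      (∣ₚ-⊕ d₁ (∣ₚ-respʳ (≋-sym r≋𝟘) ∣ₚ-𝟘))
    where
    j = q % n
    d₁ : f ∣ₚ comp f (X q) ⊕ ⊖ r j
    d₁ = ∣ₚ-respʳ (solve 3 (λ a b c → (a :+ :- b) :+ (b :+ :- c) := a :+ :- c) ≋-refl (comp f (X q))
        (comp f (X j)) (r j))
      (∣ₚ-⊕ (comp-mod f (≡.subst (λ k → f ∣ₚ X k ⊕ ⊖ X j) (≡.sym (m≡m%n+[m/n]*n q n)) (X-mod j (q / n))))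
        (∣ₚ-respʳ (≋-trans (solve 2 (λ a b → a := (a :+ b) :+ :- b) ≋-refl (Q j ⊗ f) (r j))
          (⊕-congʳ (≋-sym (proj₁ (proj₂ (proj₂ (monic-divide Mf (comp f (X j))))))))) (g∣ₚf⊗g (Q j) f)))
    r≋𝟘 : r j ≋ 𝟘
    r≋𝟘 = vanish (frobenius pp f)
      where
      lowr : Deg< e (r j)
      lowr = proj₂ (proj₂ (proj₂ (monic-divide Mf (comp f (X j)))))
      small : ∀ i → ∣ co (r j) i ∣ < q
      small i = ℕ.≤-trans (s≤s (ℕ.≤-trans (∣co∣≤norm₁ (r j) i)
          (term≤sumTo n (λ j → norm₁ (r j)) j (m%n<n q n)))) B≤q
      small-multiple : ∀ k → q ℕ.* k < q → q ℕ.* k ≡ 0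
      small-multiple zero    _ = ℕ.*-zeroʳ q
      small-multiple (suc k) l = ⊥-elim (ℕ.<⇒≱ l (ℕ.m≤m*n q (suc k)))
      -- Writing `f(X^q) = f^q + q s` and `s = Q′ f + ρ` shows that `f(X^q)` is congruent to `q ρ`
      -- modulo `f`. Remainders are unique, so `r j = q ρ`, too large to be nonzero.
      vanish′ : ∀ s → s ⊗ C (+ q) ≋ comp f (X q) ⊕ ⊖ (f ^ q) → ∀ Q′ ρ → s ≋ Q′ ⊗ f ⊕ ρ → Deg< e ρ → r j ≋ 𝟘
      vanish′ s es Q′ ρ eq low = mk≋ λ i → ≡.trans (zero-co i) (≡.sym (co-𝟘 i))
        where
        d₂ : f ∣ₚ comp f (X q) ⊕ ⊖ (C (+ q) ⊗ ρ)
        d₂ = ∣ₚ-respʳ (begin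
          f ^ q ⊕ C (+ q) ⊗ Q′ ⊗ f
            ≈⟨ solve 5 (λ a c Q f ρ → a :+ c :* Q :* f := (a :+ (Q :* f :+ ρ) :* c) :+ :- (c :* ρ)) ≋-refl
                (f ^ q) (C (+ q)) Q′ f ρ ⟩
          f ^ q ⊕ (Q′ ⊗ f ⊕ ρ) ⊗ C (+ q) ⊕ ⊖ (C (+ q) ⊗ ρ)  ≈⟨ ⊕-congʳ
              (⊕-congˡ (≋-trans (⊗-congʳ (≋-sym eq)) es)) ⟩
          f ^ q ⊕ (comp f (X q) ⊕ ⊖ (f ^ q)) ⊕ ⊖ (C (+ q) ⊗ ρ)
            ≈⟨ ⊕-congʳ (solve 2 (λ a b → a :+ (b :+ :- a) := b) ≋-refl (f ^ q) (comp f (X q))) ⟩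
          comp f (X q) ⊕ ⊖ (C (+ q) ⊗ ρ) ∎)
          (∣ₚ-⊕ (∣ₚ-^ q (ℕ.≢-nonZero⁻¹ q {{prime⇒nonZero pp}})) (g∣ₚf⊗g (C (+ q) ⊗ Q′) f))
        r≋qρ : r j ≋ C (+ q) ⊗ ρ
        r≋qρ = x-y≋𝟘⇒x≋y (r j) (C (+ q) ⊗ ρ) (monic-∣-low Mf
            (∣ₚ-diff (comp f (X q)) (r j) (C (+ q) ⊗ ρ) d₁ d₂)
          (Deg<-⊕ (r j) _ lowr (Deg<-⊖ (C (+ q) ⊗ ρ) (Deg<-C⊗ (+ q) ρ low))))
        multiple : ∀ i → ∣ co (r j) i ∣ ≡ q ℕ.* ∣ co ρ i ∣
        multiple i = ≡.trans (≡.cong ∣_∣ (≡.trans (at r≋qρ i) (co-C⊗ (+ q) ρ i))) (ℤ.abs-* (+ q) (co ρ i))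
        zero-co : ∀ i → co (r j) i ≡ + 0
        zero-co i = ℤ.∣i∣≡0⇒i≡0 (≡.trans (multiple i)
            (small-multiple ∣ co ρ i ∣ (≡.subst (_< q) (multiple i) (small i))))
      vanish : C (+ q) ∣ₚ comp f (X q) ⊕ ⊖ (f ^ q) → r j ≋ 𝟘
      vanish (divides s es) = let (Q′ , ρ , eq , low) = monic-divide Mf s in vanish′ s es Q′ ρ eq low

  products : ∀ ps → All Prime ps → All (B ≤_) ps → f ∣ₚ comp f (X (product ps))
  products []       []         []       = ∣ₚ-respʳ (≋-sym (comp-X1 f)) ∣ₚ-refl
  products (p ∷ ps) (pp ∷ pps) (l ∷ ls) = ∣ₚ-respʳ (comp-XX f p (product ps))
    (∣ₚ-trans (products ps pps ls) (comp-∣ (X (product ps)) (largePrime pp l)))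

  -- Modulo `f`, `f(X^a)` depends only on `a` modulo `n`, so `a` may be replaced by `a′ = a + t n`.
  -- All prime factors of `a′` are at least `B`, and `products` composes the substitutions for them.
  landau : ∀ a → gcd a n ≡ 1 → f ∣ₚ comp f (X a)
  landau a cop = ∣ₚ-respʳ (solve 2 (λ a b → b :+ :- (b :+ :- a) := a) ≋-refl (comp f (X a)) (comp f (X a′)))
      (∣ₚ-⊕ f∣a′ (∣ₚ-⊖ (comp-mod f (X-mod a t))))
    where
    t = coprimeProduct a B
    a′ = a ℕ.+ t ℕ.* n
    a′≢0 : a′ ≢ 0
    a′≢0 z = coprimeProduct≢0 a B (ℕ.m*n≡0⇒m≡0 t n (ℕ.m+n≡0⇒n≡0 a z))
    open PrimeFactorisation (factorise a′ {{ℕ.≢-nonZero a′≢0}})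
    large : ∀ {q} → Prime q → q ℕ∣ a′ → B ≤ q
    large {zero}  pp d = ⊥-elim (ℕ.≢-nonZero⁻¹ 0 {{prime⇒nonZero pp}} ≡.refl)
    large {suc q} pp d with B ℕ.≤? suc q
    ... | yes l = l
    ... | no ¬l with suc q ∣? a
    ...   | no q∤a = ⊥-elim (q∤a (ℕ∣.∣m+n∣m⇒∣n (≡.subst (suc q ℕ∣_) (ℕ.+-comm a (t ℕ.* n)) d)
              (ℕ∣.∣m⇒∣m*n n (coprime⇒∣coprimeProduct a B q (ℕ.<⇒≤ (ℕ.≰⇒> ¬l)) (prime-gcd pp a q∤a)))))
    ...   | yes q∣a with euclidsLemma t n pp (ℕ∣.∣m+n∣m⇒∣n d q∣a)
    ...     | inj₁ q∣t = ⊥-elim (∣coprimeProduct⇒∤ pp a B q∣t q∣a)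
    ...     | inj₂ q∣n = ⊥-elim (prime∤1 pp (≡.subst (suc q ℕ∣_) cop (gcd-greatest q∣a q∣n)))
    f∣a′ : f ∣ₚ comp f (X a′)
    f∣a′ = ≡.subst (λ k → f ∣ₚ comp f (X k)) (≡.sym isFactorisation)
      (products factors factorsPrime (All.tabulate λ {q} q∈ → large (All.lookup factorsPrime q∈)
        (≡.subst (q ℕ∣_) (≡.sym isFactorisation) (∈⇒∣product q∈))))

-- mev cs is the monic polynomial function with lower coefficients cs, constant term first.
mev : List Pol → Pol → Pol
mev []       y = 𝟙
mev (c ∷ cs) y = c ⊕ y ⊗ mev cs y

mev-sum : ∀ r c cs ds → length ds ≡ length cs → ∃ λ es → length es ≡ suc (length cs) ×
          ∀ y → mev es y ≋ mev (c ∷ cs) y ⊕ r ⊗ mev ds y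
mev-sum r c []        []       _ = c ⊕ r ∷ [] , ≡.refl , λ y →
  solve 3 (λ c r y → (c :+ r) :+ y :* con (+ 1) := (c :+ y :* con (+ 1)) :+ r :* con (+ 1)) ≋-refl c r y
mev-sum r c (c′ ∷ cs) (d ∷ ds) l with mev-sum r c′ cs ds (ℕ.suc-injective l)
... | es , le , eq = c ⊕ r ⊗ d ∷ es , ≡.cong suc le , λ y → ≋-trans (⊕-congˡ (⊗-congˡ (eq y)))
  (solve 6 (λ c r d y m m′ → (c :+ r :* d) :+ y :* (m :+ r :* m′) := (c :+ y :* m) :+ r :* (d :+ y :* m′))
      ≋-refl
    c r d y (mev (c′ ∷ cs) y) (mev ds y))

mev-divide : ∀ r c cs → ∃ λ ds → length ds ≡ length cs ×
             ∀ y → mev (c ∷ cs) y ⊕ ⊖ mev (c ∷ cs) r ≋ (y ⊕ ⊖ r) ⊗ mev ds y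
mev-divide r c []        = [] , ≡.refl , λ y →
  solve 3 (λ c r y → (c :+ y :* con (+ 1)) :+ :- (c :+ r :* con (+ 1)) := (y :+ :- r) :* con (+ 1)) ≋-refl c
      r y
mev-divide r c (c′ ∷ cs) with mev-divide r c′ cs
... | ds , ld , eq with mev-sum r c′ cs ds ld
...   | es , le , eq′ = es , le , λ y → begin
  c ⊕ y ⊗ m y ⊕ ⊖ (c ⊕ r ⊗ m r)
    ≈⟨ solve 5 (λ c r y m m′ → (c :+ y :* m) :+ :- (c :+ r :* m′) := (y :+ :- r) :* m :+ r :* (m :+ :- m′))
        ≋-refl c r y (m y) (m r) ⟩
  (y ⊕ ⊖ r) ⊗ m y ⊕ r ⊗ (m y ⊕ ⊖ m r)           ≈⟨ ⊕-congˡ (⊗-congˡ (eq y)) ⟩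
  (y ⊕ ⊖ r) ⊗ m y ⊕ r ⊗ ((y ⊕ ⊖ r) ⊗ mev ds y)
    ≈⟨ solve 4 (λ z m r d → z :* m :+ r :* (z :* d) := z :* (m :+ r :* d)) ≋-refl (y ⊕ ⊖ r) (m y) r
        (mev ds y) ⟩
  (y ⊕ ⊖ r) ⊗ (m y ⊕ r ⊗ mev ds y)              ≈⟨ ⊗-congˡ (≋-sym (eq′ y)) ⟩
  (y ⊕ ⊖ r) ⊗ mev es y                          ∎
  where
  m : Pol → Pol
  m = mev (c′ ∷ cs)

-- `σ - ρ` is not a zero divisor modulo `f`. This is what remains of working over a field when roots
-- are counted in ℤ[X] modulo `f`.
Regular : Pol → Pol → Pol → Set
Regular f ρ σ = ∀ w → f ∣ₚ (σ ⊕ ⊖ ρ) ⊗ w → f ∣ₚ w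

-- Each root splits off a linear factor, and regularity passes the remaining roots on to the
-- cofactor. More roots than the degree reduce the polynomial to the constant `𝟙`, which still has a
-- root modulo `f`.
roots-bound : ∀ f cs ρs → length cs < length ρs → AllPairs (Regular f) ρs → All (λ ρ → f ∣ₚ mev cs ρ) ρs → f
    ∣ₚ 𝟙
roots-bound f []       (ρ ∷ ρs) l       _          (z ∷ _)  = z
roots-bound f (c ∷ cs) (ρ ∷ ρs) (s≤s l) (reg ∷ regs) (z ∷ zs) with mev-divide ρ c cs
... | ds , ld , eq = roots-bound f ds ρs (≡.subst (_< length ρs) (≡.sym ld) l) regs
  (All.zipWith (λ {σ} (r , z′) → r (mev ds σ) (∣ₚ-respʳ (eq σ) (∣ₚ-⊕ z′ (∣ₚ-⊖ z)))) (reg , zs))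

comp-mev : ∀ e f → Monic e f → ∃ λ cs → length cs ≡ e × ∀ y → comp f y ≋ mev cs y
comp-mev zero    f       M = [] , ≡.refl , λ y → ≋-trans (comp-congˡ y (≋-trans (Monic0⇒≋1 M) (≡⇒≋ 𝟙-def)))
    (comp-C (+ 1) y)
comp-mev (suc e) []      (monic () _)
comp-mev (suc e) (a ∷ f) (monic l ab) with comp-mev e f (monic l (λ i k → ab (suc i) (s≤s k)))
... | cs , lc , eq = C a ∷ cs , ≡.cong suc lc , λ y → ≋-trans (comp-∷ a f y) (⊕-congˡ (⊗-congˡ (eq y)))

coprimesBelow : ℕ → ℕ → List ℕ
coprimesBelow n zero    = []
coprimesBelow n (suc j) with gcd j n ℕ.≟ 1
... | yes _ = j ∷ coprimesBelow n j
... | no  _ = coprimesBelow n j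

coprimesBelow-length : ∀ n j → length (coprimesBelow n j) ≡ sumTo j (λ j → ind (gcd j n ℕ.≟ 1))
coprimesBelow-length n zero    = ≡.refl
coprimesBelow-length n (suc j) with gcd j n ℕ.≟ 1
... | yes e = ≡.trans (≡.cong suc (coprimesBelow-length n j)) (≡.trans (ℕ.+-comm 1 (sumTo j _))
      (≡.cong (sumTo j _ ℕ.+_) (≡.sym (ind-yes _ e))))
... | no ne = ≡.trans (coprimesBelow-length n j) (≡.trans (≡.sym (ℕ.+-identityʳ (sumTo j _)))
      (≡.cong (sumTo j _ ℕ.+_) (≡.sym (ind-no _ ne))))

coprimesBelow-All : ∀ n j → All (λ a → a < j × gcd a n ≡ 1) (coprimesBelow n j)
coprimesBelow-All n zero    = []
coprimesBelow-All n (suc j) with gcd j n ℕ.≟ 1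
... | yes e = (ℕ.≤-refl , e) ∷ All.map (λ (l , e) → ℕ.m<n⇒m<1+n l , e) (coprimesBelow-All n j)
... | no  _ = All.map (λ (l , e) → ℕ.m<n⇒m<1+n l , e) (coprimesBelow-All n j)

coprimesBelow-sorted : ∀ n j k → j ≤ k → AllPairs (λ a b → a < k × b < a) (coprimesBelow n j)
coprimesBelow-sorted n zero    k j≤k = []
coprimesBelow-sorted n (suc j) k j≤k with gcd j n ℕ.≟ 1
... | yes _ = All.map (λ (l , _) → j≤k , l) (coprimesBelow-All n j) ∷ coprimesBelow-sorted n j k (ℕ.<⇒≤ j≤k)
... | no  _ = coprimesBelow-sorted n j k (ℕ.<⇒≤ j≤k)

-- `X^b - X^a = - X^b (X^(a-b) - 1)`. Modulo `f` the first factor has the inverse `X^(N-b)`, because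
-- `f` divides `Y N`; the second cancels by its Bézout relation with `Φ′ N`, as `0 < a - b < N`.
regular-X : ∀ {e f} n → Monic e f → f ∣ₚ Φ′ (suc n) → ∀ {a b} → a < suc n → b < a → Regular f (X a) (X b)
regular-X {e} {f} n Mf f∣Φ {a} {b} (s≤s a≤n) b<a w d = go (ℕ.m≤n⇒∃[o]m+o≡n b<a)
  where
  N = suc n
  f∣YN : f ∣ₚ Y N
  f∣YN = ∣ₚ-trans f∣Φ (CyclotomicFactorisation.Φ∣Y (cyclotomicFactorisation n))
  go : ∃ (λ o → suc b ℕ.+ o ≡ a) → f ∣ₚ w
  go (o , ≡.refl) = finish (coprime-Φ-Y′ (cyclotomicFactorisation n) (λ _ → cyclotomicFactorisation _)
      (ℕ.<-≤-trans (s≤s (ℕ.m≤n+m o b)) a≤n))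
    where
    D = suc o
    xa : X (suc b ℕ.+ o) ≋ X b ⊗ X D
    xa = ≋-trans (≡⇒≋ (≡.cong X (≡.sym (ℕ.+-suc b o)))) (X-+ b D)
    xN : X (N ℕ.∸ b) ⊗ X b ≋ X N
    xN = ≋-trans (≋-sym (X-+ (N ℕ.∸ b) b)) (≡⇒≋ (≡.cong X (ℕ.m∸n+n≡m
      (ℕ.<⇒≤ (ℕ.<-≤-trans b<a (ℕ.m≤n⇒m≤1+n a≤n))))))
    f∣YD : f ∣ₚ Y D ⊗ w
    f∣YD = ∣ₚ-respʳ (begin
      ⊖ (X (N ℕ.∸ b) ⊗ ((X b ⊕ ⊖ X (suc b ℕ.+ o)) ⊗ w)) ⊕ ⊖ (Y D ⊗ w ⊗ Y N)
        ≈⟨ ⊕-congʳ (⊖-cong (⊗-congˡ (⊗-congʳ (⊕-congˡ (⊖-cong xa))))) ⟩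
      ⊖ (X (N ℕ.∸ b) ⊗ ((X b ⊕ ⊖ (X b ⊗ X D)) ⊗ w)) ⊕ ⊖ (Y D ⊗ w ⊗ Y N)
        ≈⟨ solve 5 (λ z x y w n → :- (z :* ((x :+ :- (x :* y)) :* w)) :+ :-
            ((y :+ :- con (+ 1)) :* w :* (n :+ :- con (+ 1)))
             := (z :* x) :* ((y :+ :- con (+ 1)) :* w) :+ :-
                 ((y :+ :- con (+ 1)) :* w :* (n :+ :- con (+ 1)))) ≋-refl (X (N ℕ.∸ b)) (X b) (X D) w
                     (X N) ⟩
      (X (N ℕ.∸ b) ⊗ X b) ⊗ (Y D ⊗ w) ⊕ ⊖ (Y D ⊗ w ⊗ Y N)   ≈⟨ ⊕-congʳ (⊗-congʳ xN) ⟩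
      X N ⊗ (Y D ⊗ w) ⊕ ⊖ (Y D ⊗ w ⊗ Y N)
        ≈⟨ solve 2 (λ n z → n :* z :+ :- (z :* (n :+ :- con (+ 1))) := z) ≋-refl (X N) (Y D ⊗ w) ⟩
      Y D ⊗ w ∎) (∣ₚ-⊕ (∣ₚ-⊖ (∣ₚ-⊗ˡ (X (N ℕ.∸ b)) d)) (∣ₚ-⊖ (∣ₚ-⊗ˡ (Y D ⊗ w) f∣YN)))
    finish : Coprime (Φ′ N) (Y D) → f ∣ₚ w
    finish (bezout c u v nz eq) = monic-∣-scaled Mf nz (∣ₚ-respʳ (begin
      u ⊗ w ⊗ Φ′ N ⊕ v ⊗ (Y D ⊗ w)  ≈⟨ solve 5 (λ u v w p y → u :* w :* p :+ v :* (y :* w) :=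
          (u :* p :+ v :* y) :* w) ≋-refl u v w (Φ′ N) (Y D) ⟩
      (u ⊗ Φ′ N ⊕ v ⊗ Y D) ⊗ w      ≈⟨ ⊗-congʳ eq ⟩
      C c ⊗ w ∎) (∣ₚ-⊕ (∣ₚ-⊗ˡ (u ⊗ w) f∣Φ) (∣ₚ-⊗ˡ v f∣YD)))

-- Read as a polynomial function on ℤ[X] modulo `f`, `f` has every `X^a` with `a` coprime to `suc n`
-- as a root, by Landau's argument. These are `φ (suc n)` roots with regular differences, so the
-- degree cannot be smaller.
φ≤deg : ∀ {e f} n → Monic (suc e) f → f ∣ₚ Φ′ (suc n) → φ (suc n) ≤ suc e
φ≤deg {e} {f} n Mf f∣Φ = bound (comp-mev (suc e) f Mf)
  where
  units = coprimesBelow (suc n) (suc n)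
  open Landau Mf (∣ₚ-trans f∣Φ (CyclotomicFactorisation.Φ∣Y (cyclotomicFactorisation n)))
  f∤𝟙 : ¬ f ∣ₚ 𝟙
  f∤𝟙 d = Monic⇒≢𝟘 Monic-𝟙 (monic-∣-low Mf d (Deg<-C (+ 1)))
  bound : (∃ λ cs → length cs ≡ suc e × ∀ y → comp f y ≋ mev cs y) → φ (suc n) ≤ suc e
  bound (cs , lc , eq) = ≡.subst₂ _≤_ (≡.trans (List.length-map X units)
      (coprimesBelow-length (suc n) (suc n))) lc (ℕ.≮⇒≥ λ l →
    f∤𝟙 (roots-bound f cs (map X units) l
      (AllPairs.map⁺ (AllPairs.map (λ (a<n , b<a) → regular-X n Mf f∣Φ a<n b<a)
          (coprimesBelow-sorted (suc n) (suc n) (suc n) ℕ.≤-refl)))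
      (All.map⁺ (All.map (λ {a} (_ , cop) → ∣ₚ-respʳ (eq (X a)) (landau a cop))
          (coprimesBelow-All (suc n) (suc n))))))

-- The gcd with `h` is a monic divisor of `Φ′ (suc n)`. If it is not constant, `φ≤deg` gives it the
-- full degree `φ (suc n)`, so it is `Φ′ (suc n)` itself.
Φ-irreducible : ∀ n h → Φ′ (suc n) ∣ₚ h ⊎ Coprime (Φ′ (suc n)) h
Φ-irreducible n h = cases G.deg G.Mf
  where
  module G = MonicGcd (monicGcd (Monic-Φ n) h)
  cases : ∀ d → Monic d G.f → Φ′ (suc n) ∣ₚ h ⊎ Coprime (Φ′ (suc n)) h
  cases zero    M = inj₂ (bezout G.c G.u G.v G.c≢0 (≋-trans G.eqn
    (≋-trans (⊗-congˡ (≋-trans (Monic0⇒≋1 M) (≡⇒≋ 𝟙-def))) (ZX.*-identityʳ (C G.c)))))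
  cases (suc e) M = inj₁ (∣ₚ-trans (whole (Monic-quotient M
      (Monic-resp (≋-sym (_∣ₚ_.eqn G.f∣Φ)) (Monic-Φ n)))) G.f∣h)
    where
    q = _∣ₚ_.quo G.f∣Φ
    whole : (∃ λ e′ → Monic e′ q × e′ ℕ.+ suc e ≡ φ (suc n)) → Φ′ (suc n) ∣ₚ G.f
    whole (zero   , Mq , _)  = ∣ₚ-respˡ (≋-trans (≋-sym
        (≋-trans (⊗-congʳ (≋-trans (Monic0⇒≋1 Mq) (≡⇒≋ 𝟙-def))) (ZX.*-identityˡ G.f))) (_∣ₚ_.eqn G.f∣Φ))
            ∣ₚ-refl
    whole (suc e′ , _  , eq) = ⊥-elim (ℕ.<⇒≱ (ℕ.≤-trans (ℕ.m≤n+m (suc (suc e)) e′)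
      (ℕ.≤-reflexive (≡.trans (ℕ.+-suc e′ (suc e)) eq))) (φ≤deg n M G.f∣Φ))

-- Reciprocal polynomials

opaque
  -- The reciprocal `X^n f(1/X)`. Here `n` may exceed the degree of `f`, as it does when a sum such
  -- as `X y ⊕ A` is reversed summand by summand.
  rev : ℕ → Pol → Pol
  rev zero    f = co f 0 ∷ []
  rev (suc n) f = co f (suc n) ∷ rev n f

  rev-suc : ∀ n f → rev (suc n) f ≡ co f (suc n) ∷ rev n f
  rev-suc n f = ≡.refl

  rev-zero : ∀ f → rev 0 f ≡ co f 0 ∷ []
  rev-zero f = ≡.refl

  co-rev : ∀ n f i → i ≤ n → co (rev n f) i ≡ co f (n ℕ.∸ i)
  co-rev zero    f zero    _       = ≡.refl
  co-rev (suc n) f zero    _       = ≡.refl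
  co-rev (suc n) f (suc i) (s≤s l) = co-rev n f i l

  Deg<-rev : ∀ n f → Deg< (suc n) (rev n f)
  Deg<-rev zero    f (suc i) _       = ≡.refl
  Deg<-rev (suc n) f (suc i) (s≤s l) = Deg<-rev n f i l

≋-by-Deg : ∀ {n f g} → Deg< n f → Deg< n g → (∀ i → i < n → co f i ≡ co g i) → f ≋ g
≋-by-Deg {n} df dg e .at i with i ℕ.<? n
... | yes l = e i l
... | no ¬l = ≡.trans (df i (ℕ.≮⇒≥ ¬l)) (≡.sym (dg i (ℕ.≮⇒≥ ¬l)))

rev-cong : ∀ n {f g} → f ≋ g → rev n f ≋ rev n g
rev-cong n {f} {g} e = ≋-by-Deg (Deg<-rev n f) (Deg<-rev n g) λ { i (s≤s l) →
  ≡.trans (co-rev n f i l) (≡.trans (at e (n ℕ.∸ i)) (≡.sym (co-rev n g i l))) }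

rev-⊕ : ∀ n f g → rev n (f ⊕ g) ≋ rev n f ⊕ rev n g
rev-⊕ n f g = ≋-by-Deg (Deg<-rev n (f ⊕ g)) (Deg<-⊕ (rev n f) (rev n g) (Deg<-rev n f) (Deg<-rev n g)) λ
    { i (s≤s l) →
  ≡.trans (co-rev n (f ⊕ g) i l) (≡.trans (co-⊕ f g (n ℕ.∸ i))
    (≡.sym (≡.trans (co-⊕ (rev n f) (rev n g) i) (≡.cong₂ ℤ._+_ (co-rev n f i l) (co-rev n g i l))))) }

rev-C⊗ : ∀ n c f → rev n (C c ⊗ f) ≋ C c ⊗ rev n f
rev-C⊗ n c f = ≋-by-Deg (Deg<-rev n (C c ⊗ f)) (Deg<-C⊗ c (rev n f) (Deg<-rev n f)) λ { i (s≤s l) →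
  ≡.trans (co-rev n (C c ⊗ f) i l) (≡.trans (co-C⊗ c f (n ℕ.∸ i))
    (≡.sym (≡.trans (co-C⊗ c (rev n f) i) (≡.cong (c ℤ.*_) (co-rev n f i l))))) }

rev-rev : ∀ n f → Deg< (suc n) f → rev n (rev n f) ≋ f
rev-rev n f d = ≋-by-Deg (Deg<-rev n (rev n f)) d λ { i (s≤s l) →
  ≡.trans (co-rev n (rev n f) i l) (≡.trans (co-rev n f (n ℕ.∸ i) (ℕ.m∸n≤m n i))
      (≡.cong (co f) (ℕ.m∸[m∸n]≡n l))) }

X1⊗≋0∷ : ∀ f → X 1 ⊗ f ≋ + 0 ∷ f
X1⊗≋0∷ f = ≋-sym (≋-trans (∷-def (+ 0) f) (≋-trans (⊕-congʳ C-0) (ZX.+-identityˡ _)))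

rev-X1⊗ : ∀ n f → rev (suc n) (X 1 ⊗ f) ≋ rev n f
rev-X1⊗ n f = ≋-by-Deg (Deg<-rev (suc n) _) (Deg<-mono {p = rev n f} (ℕ.n≤1+n _) (Deg<-rev n f)) λ
    { i (s≤s l) →
  ≡.trans (co-rev (suc n) (X 1 ⊗ f) i l) (≡.trans (at (X1⊗≋0∷ f) (suc n ℕ.∸ i)) (go i l)) }
  where
  go : ∀ i → i ≤ suc n → co (+ 0 ∷ f) (suc n ℕ.∸ i) ≡ co (rev n f) i
  go i l with i ℕ.≤? n
  ... | yes i≤n rewrite ℕ.+-∸-assoc 1 i≤n = ≡.sym (co-rev n f i i≤n)
  ... | no ¬i≤n with ℕ.≤-antisym l (ℕ.≰⇒> ¬i≤n)
  ...   | ≡.refl rewrite ℕ.n∸n≡0 n = ≡.sym (Deg<-rev n f (suc n) ℕ.≤-refl)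

rev-shift : ∀ k b g → Deg< (suc b) g → rev (k ℕ.+ b) g ≋ X k ⊗ rev b g
rev-shift zero    b g d = ≋-sym (≋-trans (⊗-congʳ X-0) (ZX.*-identityˡ _))
rev-shift (suc k) b g d = begin
  rev (suc (k ℕ.+ b)) g        ≈⟨ ≡⇒≋ (rev-suc (k ℕ.+ b) g) ⟩
  co g (suc (k ℕ.+ b)) ∷ rev (k ℕ.+ b) g ≈⟨ d _ (s≤s (ℕ.m≤n+m b k)) Z.∷≋ ≋-refl ⟩
  + 0 ∷ rev (k ℕ.+ b) g        ≈⟨ X1⊗≋0∷ _ ⟨
  X 1 ⊗ rev (k ℕ.+ b) g        ≈⟨ ⊗-congˡ (rev-shift k b g d) ⟩
  X 1 ⊗ (X k ⊗ rev b g)        ≈⟨ ZX.*-assoc _ _ _ ⟨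
  X 1 ⊗ X k ⊗ rev b g          ≈⟨ ⊗-congʳ (X-+ 1 k) ⟨
  X (suc k) ⊗ rev b g          ∎

rev0-C : ∀ c → rev 0 (C c) ≋ C c
rev0-C c = ≋-trans (≡⇒≋ (≡.trans (rev-zero (C c)) (≡.cong (_∷ []) (co-C-0 c)))) (≡⇒≋ (C-def c))

rev-C : ∀ n c → rev n (C c) ≋ X n ⊗ C c
rev-C n c = ≋-trans (≡⇒≋ (≡.cong (λ k → rev k (C c)) (≡.sym (ℕ.+-identityʳ n))))
  (≋-trans (rev-shift n 0 (C c) (λ { (suc i) _ → co-C-suc c i })) (⊗-congˡ (rev0-C c)))

rev-⊗ : ∀ f g a b → Deg< (suc a) f → Deg< (suc b) g → rev (a ℕ.+ b) (f ⊗ g) ≋ rev a f ⊗ rev b g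
rev-⊗ [] g a b df dg = begin
  rev (a ℕ.+ b) ([] ⊗ g)   ≈⟨ rev-cong (a ℕ.+ b) (≋-trans (⊗-congʳ []≋) (⊗-congˡ ≋-refl)) ⟩
  rev (a ℕ.+ b) (C (+ 0) ⊗ g)  ≈⟨ rev-C⊗ (a ℕ.+ b) (+ 0) g ⟩
  C (+ 0) ⊗ rev (a ℕ.+ b) g  ≈⟨ ≋-trans (⊗-congʳ C-0) (ZX.zeroˡ _) ⟩
  𝟘                        ≈⟨ ZX.zeroˡ _ ⟨
  𝟘 ⊗ rev b g              ≈⟨ ⊗-congʳ (≋-trans (rev-cong a []≋)
      (≋-trans (rev-C a (+ 0)) (≋-trans (⊗-congˡ C-0) (ZX.zeroʳ _)))) ⟨
  rev a [] ⊗ rev b g       ∎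
  where
  []≋ : [] ≋ C (+ 0)
  []≋ = ≋-trans (≡⇒≋ 𝟘-def) (≋-sym C-0)
rev-⊗ (c ∷ f) g zero b df dg = begin
  rev b ((c ∷ f) ⊗ g)      ≈⟨ rev-cong b (⊗-congʳ f≋) ⟩
  rev b (C c ⊗ g)          ≈⟨ rev-C⊗ b c g ⟩
  C c ⊗ rev b g            ≈⟨ ⊗-congʳ (≋-trans (rev-cong 0 f≋) (rev0-C c)) ⟨
  rev 0 (c ∷ f) ⊗ rev b g  ∎
  where
  f≋ : c ∷ f ≋ C c
  f≋ = ≋-trans (≡.refl Z.∷≋ mk≋ λ i → df (suc i) (s≤s z≤n)) (≡⇒≋ (C-def c))
rev-⊗ (c ∷ f) g (suc a) b df dg = begin
  rev (suc (a ℕ.+ b)) ((c ∷ f) ⊗ g)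
    ≈⟨ rev-cong (suc (a ℕ.+ b)) (≋-trans (⊗-congʳ (∷-def c f))
        (solve 4 (λ c x f g → (c :+ x :* f) :* g := c :* g :+ x :* (f :* g)) ≋-refl (C c) (X 1) f g)) ⟩
  rev (suc (a ℕ.+ b)) (C c ⊗ g ⊕ X 1 ⊗ (f ⊗ g))   ≈⟨ rev-⊕ (suc (a ℕ.+ b)) _ _ ⟩
  rev (suc (a ℕ.+ b)) (C c ⊗ g) ⊕ rev (suc (a ℕ.+ b)) (X 1 ⊗ (f ⊗ g))
    ≈⟨ ⊕-cong (≋-trans (rev-C⊗ (suc (a ℕ.+ b)) c g) (⊗-congˡ (rev-shift (suc a) b g dg)))
        (≋-trans (rev-X1⊗ (a ℕ.+ b) (f ⊗ g)) (rev-⊗ f g a b (λ i l → df (suc i) (s≤s l)) dg)) ⟩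
  C c ⊗ (X (suc a) ⊗ rev b g) ⊕ rev a f ⊗ rev b g
    ≈⟨ solve 4 (λ c x f g → c :* (x :* g) :+ f :* g := (x :* c :+ f) :* g) ≋-refl (C c) (X (suc a))
        (rev a f) (rev b g) ⟩
  (X (suc a) ⊗ C c ⊕ rev a f) ⊗ rev b g
    ≈⟨ ⊗-congʳ (≋-trans (rev-cong (suc a) (∷-def c f))
        (≋-trans (rev-⊕ (suc a) (C c) (X 1 ⊗ f)) (⊕-cong (rev-C (suc a) c) (rev-X1⊗ a f)))) ⟨
  rev (suc a) (c ∷ f) ⊗ rev b g ∎

rev-X : ∀ D e → e ≤ D → rev D (X e) ≋ X (D ℕ.∸ e)
rev-X D e e≤D = ≋-by-Deg (Deg<-rev D (X e)) (Deg<-mono {p = X (D ℕ.∸ e)} (s≤s (ℕ.m∸n≤m D e))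
    (above (Monic-X (D ℕ.∸ e)))) λ { i (s≤s l) →
  ≡.trans (co-rev D (X e) i l) (go i l) }
  where
  go : ∀ i → i ≤ D → co (X e) (D ℕ.∸ i) ≡ co (X (D ℕ.∸ e)) i
  go i l with e ℕ.≟ D ℕ.∸ i
  ... | yes ≡.refl rewrite ℕ.m∸[m∸n]≡n l = ≡.trans (co-X≡ (D ℕ.∸ i)) (≡.sym (co-X≡ i))
  ... | no ne = ≡.trans (co-X≢ e (D ℕ.∸ i) ne) (≡.sym
      (co-X≢ (D ℕ.∸ e) i λ { ≡.refl → ne (≡.sym (ℕ.m∸[m∸n]≡n e≤D)) }))

-- Sums of monomials and sums of coefficients

S : List ℕ → Pol
S []       = 𝟘
S (e ∷ es) = X e ⊕ S es

rev-S : ∀ D es → All (_≤ D) es → rev D (S es) ≋ S (map (D ℕ.∸_) es)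
rev-S D []       _        = ≋-trans (rev-cong D (≋-sym C-0))
    (≋-trans (rev-C D (+ 0)) (≋-trans (⊗-congˡ C-0) (ZX.zeroʳ _)))
rev-S D (e ∷ es) (l ∷ ls) = ≋-trans (rev-⊕ D (X e) (S es)) (⊕-cong (rev-X D e l) (rev-S D es ls))

S-++ : ∀ es fs → S (es ++ fs) ≋ S es ⊕ S fs
S-++ []       fs = ≋-sym (ZX.+-identityˡ _)
S-++ (e ∷ es) fs = ≋-trans (⊕-congˡ (S-++ es fs)) (≋-sym (ZX.+-assoc _ _ _))

X⊗S : ∀ e fs → X e ⊗ S fs ≋ S (map (e ℕ.+_) fs)
X⊗S e []       = ZX.zeroʳ _
X⊗S e (f ∷ fs) = ≋-trans (ZX.distribˡ _ _ _) (⊕-cong (≋-sym (X-+ e f)) (X⊗S e fs))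

S⊗S : ∀ es fs → S es ⊗ S fs ≋ S (cartesianProductWith ℕ._+_ es fs)
S⊗S []       fs = ZX.zeroˡ _
S⊗S (e ∷ es) fs = ≋-trans (ZX.distribʳ _ _ _) (≋-trans (⊕-cong (X⊗S e fs) (S⊗S es fs))
  (≋-sym (S-++ (map (e ℕ.+_) fs) (cartesianProductWith ℕ._+_ es fs))))

co-S≥0 : ∀ es i → + 0 ℤ.≤ co (S es) i
co-S≥0 []       i = ℤ.≤-reflexive (≡.sym (co-𝟘 i))
co-S≥0 (e ∷ es) i rewrite co-⊕ (X e) (S es) i with e ℕ.≟ i
... | yes ≡.refl rewrite co-X≡ e = ℤ.+-mono-≤ (ℤ.+≤+ z≤n) (co-S≥0 es e)
... | no ne rewrite co-X≢ e i ne | ℤ.+-identityˡ (co (S es) i) = co-S≥0 es i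

co-S∈ : ∀ {es i} → i ∈ es → + 1 ℤ.≤ co (S es) i
co-S∈ {e ∷ es} {i} (here ≡.refl) rewrite co-⊕ (X e) (S es) e | co-X≡ e = ℤ.+-monoʳ-≤ (+ 1) (co-S≥0 es e)
co-S∈ {e ∷ es} {i} (there i∈) rewrite co-⊕ (X e) (S es) i with e ℕ.≟ i
... | yes ≡.refl rewrite co-X≡ e = ℤ.+-mono-≤ (ℤ.+≤+ z≤n) (co-S∈ i∈)
... | no ne rewrite co-X≢ e i ne | ℤ.+-identityˡ (co (S es) i) = co-S∈ i∈

co-S≢0 : ∀ es {i} → co (S es) i ≢ + 0 → i ∈ es
co-S≢0 []       {i} nz = ⊥-elim (nz (co-𝟘 i))
co-S≢0 (e ∷ es) {i} nz with e ℕ.≟ i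
... | yes ≡.refl = here ≡.refl
... | no ne = there (co-S≢0 es λ z → nz (≡.trans (co-⊕ (X e) (S es) i) (≡.cong₂ ℤ._+_ (co-X≢ e i ne) z)))

Σℤ : ℕ → (ℕ → ℤ) → ℤ
Σℤ zero    h = + 0
Σℤ (suc n) h = h 0 ℤ.+ Σℤ n (h ∘ suc)

Σℤ-cong : ∀ n {g h} → (∀ i → i < n → g i ≡ h i) → Σℤ n g ≡ Σℤ n h
Σℤ-cong zero    e = ≡.refl
Σℤ-cong (suc n) e = ≡.cong₂ ℤ._+_ (e 0 (s≤s z≤n)) (Σℤ-cong n λ i l → e (suc i) (s≤s l))

Σℤ-snoc : ∀ n h → Σℤ (suc n) h ≡ Σℤ n h ℤ.+ h n
Σℤ-snoc zero    h = ℤ.+-comm (h 0) (+ 0)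
Σℤ-snoc (suc n) h = ≡.trans (≡.cong (λ z → h 0 ℤ.+ z) (Σℤ-snoc n (h ∘ suc))) (≡.sym (ℤ.+-assoc (h 0) _ _))

Σℤ-minus : ∀ n g h → Σℤ n (λ i → g i ℤ.- h i) ≡ Σℤ n g ℤ.- Σℤ n h
Σℤ-minus zero    g h = ≡.refl
Σℤ-minus (suc n) g h = ≡.trans (≡.cong (λ z → g 0 ℤ.- h 0 ℤ.+ z) (Σℤ-minus n (g ∘ suc) (h ∘ suc)))
  (solveℤ 4 (λ a b c d → a ℤ:- b ℤ:+ (c ℤ:- d) ℤ:= a ℤ:+ c ℤ:- (b ℤ:+ d)) ≡.refl (g 0) (h 0)
      (Σℤ n (g ∘ suc)) (Σℤ n (h ∘ suc)))

Σℤ-0 : ∀ n → Σℤ n (λ _ → + 0) ≡ + 0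
Σℤ-0 zero    = ≡.refl
Σℤ-0 (suc n) = ≡.trans (ℤ.+-identityˡ _) (Σℤ-0 n)

Σℤ-≥0 : ∀ n {h} → (∀ i → i < n → + 0 ℤ.≤ h i) → + 0 ℤ.≤ Σℤ n h
Σℤ-≥0 zero    p = ℤ.≤-refl
Σℤ-≥0 (suc n) p = ℤ.+-mono-≤ (p 0 (s≤s z≤n)) (Σℤ-≥0 n λ i l → p (suc i) (s≤s l))

Σℤ-term : ∀ n {h} → (∀ i → i < n → + 0 ℤ.≤ h i) → ∀ i → i < n → h i ℤ.≤ Σℤ n h
Σℤ-term (suc n) {h} p zero    l       = ≡.subst (ℤ._≤ h 0 ℤ.+ Σℤ n (h ∘ suc)) (ℤ.+-identityʳ (h 0))
  (ℤ.+-monoʳ-≤ (h 0) (Σℤ-≥0 n λ i l → p (suc i) (s≤s l)))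
Σℤ-term (suc n) {h} p (suc i) (s≤s l) = ≡.subst (ℤ._≤ h 0 ℤ.+ Σℤ n (h ∘ suc)) (ℤ.+-identityˡ (h (suc i)))
  (ℤ.+-mono-≤ (p 0 (s≤s z≤n)) (Σℤ-term n (λ i l → p (suc i) (s≤s l)) i l))

Σℤ-zero : ∀ n {h} → (∀ i → i < n → + 0 ℤ.≤ h i) → Σℤ n h ≡ + 0 → ∀ i → i < n → h i ≡ + 0
Σℤ-zero n {h} p z i l = ℤ.≤-antisym (≡.subst (h i ℤ.≤_) z (Σℤ-term n p i l)) (p i l)

Σℤ-squeeze : ∀ n {g h} → (∀ i → i < n → g i ℤ.≤ h i) → Σℤ n g ≡ Σℤ n h → ∀ i → i < n → g i ≡ h i
Σℤ-squeeze n {g} {h} p e i l = ≡.sym (ℤ.i-j≡0⇒i≡j (h i) (g i)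
  (Σℤ-zero n (λ i l → ℤ.i≤j⇒0≤j-i (p i l)) (≡.trans (Σℤ-minus n h g) (ℤ.i≡j⇒i-j≡0 (≡.sym e))) i l))

opaque
  unfolding _⊕_
  convolution : ∀ f g n → co (f ⊗ g) n ≡ Σℤ (suc n) (λ i → co f i ℤ.* co g (n ℕ.∸ i))
  convolution []      g n       = ≡.sym (≡.trans (Σℤ-cong (suc n) λ i _ → ℤ.*-zeroˡ (co g (n ℕ.∸ i)))
      (Σℤ-0 (suc n)))
  convolution (a ∷ f) g zero    = ≡.trans (co-⊗-0 (a ∷ f) g) (≡.sym (ℤ.+-identityʳ _))
  convolution (a ∷ f) g (suc n) = ≡.trans (Z.coeff-⊛-suc a f g n)
      (≡.cong (λ z → a ℤ.* co g (suc n) ℤ.+ z) (convolution f g n))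

comp-𝟙 : ∀ n f → Deg< n f → comp f 𝟙 ≋ C (Σℤ n (co f))
comp-𝟙 zero    f       d = ≋-trans (comp-𝟘 𝟙 (≋-trans (Deg<0⇒≋𝟘 d) (≡⇒≋ (≡.sym 𝟘-def)))) (≋-sym C-0)
comp-𝟙 (suc n) []      d = ≋-trans (comp-[] 𝟙) (≋-sym (≋-trans (≡⇒≋ (≡.cong C (Σℤ-0 (suc n)))) C-0))
comp-𝟙 (suc n) (a ∷ f) d = ≋-trans (comp-∷ a f 𝟙) (≋-trans (⊕-congˡ (≋-trans (ZX.*-identityˡ _)
  (comp-𝟙 n f λ i l → d (suc i) (s≤s l)))) (≋-sym (C-+ a _)))

comp-𝟙-rev : ∀ n f → comp (rev n f) 𝟙 ≋ C (Σℤ (suc n) (co f))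
comp-𝟙-rev zero    f = ≋-trans (comp-congˡ 𝟙 (≋-trans (≡⇒≋ (rev-zero f)) (≡⇒≋ (C-def (co f 0)))))
  (≋-trans (comp-C (co f 0) 𝟙) (≡⇒≋ (≡.cong C (≡.sym (ℤ.+-identityʳ (co f 0))))))
comp-𝟙-rev (suc n) f = begin
  comp (rev (suc n) f) 𝟙                        ≈⟨ comp-congˡ 𝟙 (≡⇒≋ (rev-suc n f)) ⟩
  comp (co f (suc n) ∷ rev n f) 𝟙               ≈⟨ comp-∷ _ _ 𝟙 ⟩
  C (co f (suc n)) ⊕ 𝟙 ⊗ comp (rev n f) 𝟙       ≈⟨ ⊕-congˡ (≋-trans (ZX.*-identityˡ _) (comp-𝟙-rev n f)) ⟩
  C (co f (suc n)) ⊕ C (Σℤ (suc n) (co f))      ≈⟨ C-+ _ _ ⟨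
  C (co f (suc n) ℤ.+ Σℤ (suc n) (co f))        ≈⟨ ≡⇒≋
      (≡.cong C (≡.trans (ℤ.+-comm (co f (suc n)) _) (≡.sym (Σℤ-snoc (suc n) (co f))))) ⟩
  C (Σℤ (suc (suc n)) (co f))                   ∎

i²≡j²⇒i≡±j : ∀ i j → i ℤ.* i ≡ j ℤ.* j → i ≡ j ⊎ i ≡ ℤ.- j
i²≡j²⇒i≡±j i j e with ℤ.i*j≡0⇒i≡0∨j≡0 (i ℤ.- j) {i ℤ.+ j} (≡.trans
  (solveℤ 2 (λ i j → (i ℤ:- j) ℤ:* (i ℤ:+ j) ℤ:= i ℤ:* i ℤ:- j ℤ:* j) ≡.refl i j) (ℤ.i≡j⇒i-j≡0 e))
... | inj₁ z = inj₁ (ℤ.i-j≡0⇒i≡j i j z)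
... | inj₂ z = inj₂ (ℤ.i-j≡0⇒i≡j i (ℤ.- j) (≡.trans (≡.cong (λ k → i ℤ.+ k) (ℤ.neg-involutive j)) z))

0≤i²-i : ∀ i → + 0 ℤ.≤ i ℤ.* i ℤ.- i
0≤i²-i (+ zero)  = ℤ.≤-refl
0≤i²-i (+ suc n) = ℤ.i≤j⇒0≤j-i (ℤ.≤-trans (ℤ.+≤+ (ℕ.m≤m*n (suc n) (suc n)))
    (ℤ.≤-reflexive (ℤ.pos-* (suc n) (suc n))))
0≤i²-i -[1+ n ]  = ℤ.+≤+ z≤n

Bit : ℤ → Set
Bit i = i ≡ + 0 ⊎ i ≡ + 1

i²≡i⇒Bit : ∀ i → i ℤ.* i ℤ.- i ≡ + 0 → Bit i
i²≡i⇒Bit i e with ℤ.i*j≡0⇒i≡0∨j≡0 i {i ℤ.- + 1} (≡.trans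
  (solveℤ 1 (λ i → i ℤ:* (i ℤ:- ℤcon (+ 1)) ℤ:= i ℤ:* i ℤ:- i) ≡.refl i) e)
... | inj₁ z = inj₁ z
... | inj₂ z = inj₂ (ℤ.i-j≡0⇒i≡j i (+ 1) z)

Bit⇒≥0 : ∀ {i} → Bit i → + 0 ℤ.≤ i
Bit⇒≥0 (inj₁ ≡.refl) = ℤ.≤-refl
Bit⇒≥0 (inj₂ ≡.refl) = ℤ.+≤+ z≤n

Bit⇒i²≡i : ∀ {i} → Bit i → i ℤ.* i ≡ i
Bit⇒i²≡i (inj₁ ≡.refl) = ≡.refl
Bit⇒i²≡i (inj₂ ≡.refl) = ≡.refl

-- Ljunggren's trick: G rev G = F rev F forces the coefficients of ±G to be 0 or 1, because their sum
-- equals the sum of their squares.  The supports of F and G then have the same differences, and the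
-- hypotheses alt and mix on es identify the support of G.
module Ljunggren
  (es : List ℕ) (D : ℕ) (0∈es : 0 ∈ es) (D∈es : D ∈ es) (es≤D : All (_≤ D) es)
  (bitF : ∀ i → Bit (co (S es) i))
  (alt : ∀ {s a b c d} → a ∈ es → b ∈ es → c ∈ es → d ∈ es → a ≡ s ℕ.+ b → c ℕ.+ s ≡ D ℕ.+ d →
         s ∈ es ⊎ D ℕ.∸ s ∈ es)
  (mix : ∀ {s u a b} → s ∈ es → u ∈ es → a ∈ es → b ∈ es → s ℕ.+ u ℕ.+ b ≡ a ℕ.+ D →
         D ℕ.∸ s ∈ es ⊎ D ℕ.∸ u ∈ es)
  where

  open DecMembership ℕ._≟_ using (_∈?_)

  F₀ : Pol
  F₀ = S es

  degF : Deg< (suc D) F₀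
  degF i D<i with co F₀ i ℤ.≟ + 0
  ... | yes z = z
  ... | no nz = ⊥-elim (ℕ.<⇒≱ D<i (All.lookup es≤D (co-S≢0 es nz)))

  ∈⇒1 : ∀ {i} → i ∈ es → co F₀ i ≡ + 1
  ∈⇒1 {i} i∈ with bitF i
  ... | inj₂ e = e
  ... | inj₁ z with ≡.subst (+ 1 ℤ.≤_) z (co-S∈ i∈)
  ...   | ℤ.+≤+ ()

  module _ (G : Pol) (degG : Deg< (suc D) G) (eq : G ⊗ rev D G ≋ F₀ ⊗ rev D F₀)
           (sums : Σℤ (suc D) (co G) ≡ Σℤ (suc D) (co F₀)) where

    squares : ∀ f → co (f ⊗ rev D f) D ≡ Σℤ (suc D) (λ i → co f i ℤ.* co f i)
    squares f = ≡.trans (convolution f (rev D f) D) (Σℤ-cong (suc D) λ where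
      i (s≤s l) → ≡.cong (co f i ℤ.*_) (≡.trans (co-rev D f (D ℕ.∸ i) (ℕ.m∸n≤m D i))
          (≡.cong (co f) (ℕ.m∸[m∸n]≡n l))))

    bitG : ∀ i → Bit (co G i)
    bitG i with i ℕ.<? suc D
    ... | no ¬l = inj₁ (degG i (ℕ.≮⇒≥ ¬l))
    ... | yes l = i²≡i⇒Bit (co G i) (Σℤ-zero (suc D) (λ i _ → 0≤i²-i (co G i))
      (≡.trans (Σℤ-minus (suc D) (λ i → co G i ℤ.* co G i) (co G)) (ℤ.i≡j⇒i-j≡0 Σ²≡Σ)) i l)
      where
      Σ²≡Σ : Σℤ (suc D) (λ i → co G i ℤ.* co G i) ≡ Σℤ (suc D) (co G)
      Σ²≡Σ = ≡.trans (≡.sym (squares G)) (≡.trans (at eq D) (≡.trans (squares F₀)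
        (≡.trans (Σℤ-cong (suc D) λ i _ → Bit⇒i²≡i (bitF i)) (≡.sym sums))))

    ends : co G 0 ≡ + 1 × co G D ≡ + 1
    ends = go (bitG 0) (bitG D)
      where
      ends-product : ∀ f → co (f ⊗ rev D f) 0 ≡ co f 0 ℤ.* co f D
      ends-product f = ≡.trans (co-⊗-0 f (rev D f)) (≡.cong (co f 0 ℤ.*_) (co-rev D f 0 z≤n))
      product≡1 : co G 0 ℤ.* co G D ≡ + 1
      product≡1 = ≡.trans (≡.sym (ends-product G)) (≡.trans (at eq 0) (≡.trans (ends-product F₀)
        (≡.cong₂ ℤ._*_ (∈⇒1 0∈es) (∈⇒1 D∈es))))
      0≢1 : + 0 ≢ + 1
      0≢1 ()
      go : Bit (co G 0) → Bit (co G D) → co G 0 ≡ + 1 × co G D ≡ + 1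
      go (inj₂ e) (inj₂ e′) = e , e′
      go (inj₁ z) _         = ⊥-elim (0≢1 (≡.trans (≡.sym (ℤ.*-zeroˡ (co G D)))
          (≡.trans (≡.cong (ℤ._* co G D) (≡.sym z)) product≡1)))
      go (inj₂ _) (inj₁ z)  = ⊥-elim (0≢1 (≡.trans (≡.sym (ℤ.*-zeroʳ (co G 0)))
          (≡.trans (≡.cong (co G 0 ℤ.*_) (≡.sym z)) product≡1)))

    revG≥0 : ∀ i → + 0 ℤ.≤ co (rev D G) i
    revG≥0 i with i ℕ.<? suc D
    ... | no ¬l = ℤ.≤-reflexive (≡.sym (Deg<-rev D G i (ℕ.≮⇒≥ ¬l)))
    ... | yes (s≤s l) = ℤ.≤-trans (Bit⇒≥0 (bitG (D ℕ.∸ i))) (ℤ.≤-reflexive (≡.sym (co-rev D G i l)))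

    -- The coefficients of `G` are nonnegative, so the pair `s`, `t` makes the coefficient of
    -- `X^(s+D-t)` in `G ⊗ rev D G` positive. The same coefficient of `F₀ ⊗ rev D F₀` then provides
    -- `a - b = s - t`.
    difference : ∀ s t → s ≤ D → t ≤ D → co G s ≡ + 1 → co G t ≡ + 1 →
                 ∃ λ a → ∃ λ b → a ∈ es × b ∈ es × a ℕ.+ t ≡ s ℕ.+ b
    difference s t s≤D t≤D gs gt = found
      where
      idx = s ℕ.+ (D ℕ.∸ t)
      term : ∀ i → + 0 ℤ.≤ co G i ℤ.* co (rev D G) (idx ℕ.∸ i)
      term i with bitG i
      ... | inj₁ z rewrite z = ℤ.≤-reflexive (≡.sym (ℤ.*-zeroˡ (co (rev D G) (idx ℕ.∸ i))))
      ... | inj₂ e rewrite e | ℤ.*-identityˡ (co (rev D G) (idx ℕ.∸ i)) = revG≥0 (idx ℕ.∸ i)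
      one : co G s ℤ.* co (rev D G) (idx ℕ.∸ s) ≡ + 1
      one = ≡.cong₂ ℤ._*_ gs (≡.trans (≡.cong (co (rev D G)) (ℕ.m+n∸m≡n s (D ℕ.∸ t)))
        (≡.trans (co-rev D G (D ℕ.∸ t) (ℕ.m∸n≤m D t)) (≡.trans (≡.cong (co G) (ℕ.m∸[m∸n]≡n t≤D)) gt)))
      positive : + 1 ℤ.≤ co (G ⊗ rev D G) idx
      positive = ≡.subst₂ ℤ._≤_ one (≡.sym (convolution G (rev D G) idx))
        (Σℤ-term (suc idx) (λ i _ → term i) s (s≤s (ℕ.m≤m+n s (D ℕ.∸ t))))
      FrevF : F₀ ⊗ rev D F₀ ≋ S (cartesianProductWith ℕ._+_ es (map (D ℕ.∸_) es))
      FrevF = ≋-trans (⊗-congˡ (rev-S D es es≤D)) (S⊗S es (map (D ℕ.∸_) es))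
      nonzero : co (S (cartesianProductWith ℕ._+_ es (map (D ℕ.∸_) es))) idx ≢ + 0
      nonzero z with ≡.subst (+ 1 ℤ.≤_) (≡.trans (at eq idx) (≡.trans (at FrevF idx) z)) positive
      ... | ℤ.+≤+ ()
      found : ∃ λ a → ∃ λ b → a ∈ es × b ∈ es × a ℕ.+ t ≡ s ℕ.+ b
      found with ∈-cartesianProductWith⁻ ℕ._+_ es (map (D ℕ.∸_) es) (co-S≢0 _ nonzero)
      ... | a , b′ , a∈ , b′∈ , e with ∈-map⁻ (D ℕ.∸_) b′∈
      ...   | b , b∈ , ≡.refl = a , b , a∈ , b∈ , ℕ.+-cancelʳ-≡ D (a ℕ.+ t) (s ℕ.+ b) (begin′
        a ℕ.+ t ℕ.+ D                      ≡⟨ ≡.cong (a ℕ.+ t ℕ.+_) (ℕ.m∸n+n≡m (All.lookup es≤D b∈)) ⟨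
        a ℕ.+ t ℕ.+ (D ℕ.∸ b ℕ.+ b)        ≡⟨ shuffle a t (D ℕ.∸ b) b ⟩
        (a ℕ.+ (D ℕ.∸ b)) ℕ.+ (t ℕ.+ b)    ≡⟨ ≡.cong (ℕ._+ (t ℕ.+ b)) (≡.sym e) ⟩
        (s ℕ.+ (D ℕ.∸ t)) ℕ.+ (t ℕ.+ b)    ≡⟨ shuffle′ s (D ℕ.∸ t) t b ⟩
        s ℕ.+ b ℕ.+ (D ℕ.∸ t ℕ.+ t)        ≡⟨ ≡.cong (s ℕ.+ b ℕ.+_) (ℕ.m∸n+n≡m t≤D) ⟩
        s ℕ.+ b ℕ.+ D                      ∎′)
        where
        open ≡.≡-Reasoning renaming (begin_ to begin′_; _∎ to _∎′) using (step-≡-⟩; step-≡-⟨)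
        shuffle : ∀ a t c b → a ℕ.+ t ℕ.+ (c ℕ.+ b) ≡ (a ℕ.+ c) ℕ.+ (t ℕ.+ b)
        shuffle = solveℕ 4 (λ a t c b → a ℕ:+ t ℕ:+ (c ℕ:+ b) ℕ:= (a ℕ:+ c) ℕ:+ (t ℕ:+ b)) ≡.refl
        shuffle′ : ∀ s c t b → (s ℕ.+ c) ℕ.+ (t ℕ.+ b) ≡ s ℕ.+ b ℕ.+ (c ℕ.+ t)
        shuffle′ = solveℕ 4 (λ s c t b → (s ℕ:+ c) ℕ:+ (t ℕ:+ b) ℕ:= s ℕ:+ b ℕ:+ (c ℕ:+ t)) ≡.refl

    support≤D : ∀ {s} → co G s ≡ + 1 → s ≤ D
    support≤D {s} gs with s ℕ.≤? D
    ... | yes l = l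
    ... | no ¬l with ≡.trans (≡.sym gs) (degG s (ℕ.≰⇒> ¬l))
    ...   | ()

    -- Both 0 and `D` lie in the support of `G`, so `s` and `D - s` are differences of exponents of
    -- `F₀`, which is what `alt` asks for.
    dichotomy : ∀ s → co G s ≡ + 1 → s ∈ es ⊎ D ℕ.∸ s ∈ es
    dichotomy s gs =
      let (a , b , a∈ , b∈ , e)  = difference s 0 (support≤D gs) z≤n gs (proj₁ ends)
          (c , d , c∈ , d∈ , e′) = difference D s ℕ.≤-refl (support≤D gs) (proj₂ ends) gs
      in alt a∈ b∈ c∈ d∈ (≡.trans (≡.sym (ℕ.+-identityʳ a)) e) e′

    -- Serves to show that one alternative of `dichotomy` holds on the whole support: `s - t` is a
    -- difference of exponents, and `mix` applies to it with `u = D - t`.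
    noMix : ∀ s t → co G s ≡ + 1 → co G t ≡ + 1 → s ∈ es → D ℕ.∸ t ∈ es → D ℕ.∸ s ∈ es ⊎ t ∈ es
    noMix s t gs gt s∈ t∈ =
      let (a , b , a∈ , b∈ , e) = difference s t (support≤D gs) (support≤D gt) gs gt
      in Sum.map₂ (≡.subst (_∈ es) (ℕ.m∸[m∸n]≡n (support≤D gt))) (mix s∈ t∈ a∈ b∈ (≡.trans
        (≡.trans (ℕ.+-assoc s (D ℕ.∸ t) b) (≡.trans (≡.cong (s ℕ.+_) (ℕ.+-comm (D ℕ.∸ t) b))
          (≡.trans (≡.sym (ℕ.+-assoc s b (D ℕ.∸ t))) (≡.cong (ℕ._+ (D ℕ.∸ t)) (≡.sym e)))))
        (≡.trans (ℕ.+-assoc a t (D ℕ.∸ t)) (≡.cong (a ℕ.+_) (ℕ.m+[n∸m]≡n (support≤D gt))))))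

    support : (∀ s → co G s ≡ + 1 → s ∈ es) ⊎ (∀ s → co G s ≡ + 1 → D ℕ.∸ s ∈ es)
    support = cases (ℕ.anyUpTo? (λ s → (co G s ℤ.≟ + 1) ×-dec ¬? (s ∈? es)) (suc D))
      where
      in-es : ¬ (∃ λ s → s < suc D × co G s ≡ + 1 × s ∉ es) → ∀ s → co G s ≡ + 1 → Dec (s ∈ es) → s ∈ es
      in-es none s gs (yes s∈) = s∈
      in-es none s gs (no s∉)  = ⊥-elim (none (s , s≤s (support≤D gs) , gs , s∉))
      reflected : ∀ t → co G t ≡ + 1 → t ∉ es → t ∈ es ⊎ D ℕ.∸ t ∈ es →
                  ∀ s → co G s ≡ + 1 → s ∈ es ⊎ D ℕ.∸ s ∈ es → D ℕ.∸ s ∈ es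
      reflected t gt t∉ (inj₁ t∈) s gs _         = ⊥-elim (t∉ t∈)
      reflected t gt t∉ (inj₂ _)  s gs (inj₂ h)  = h
      reflected t gt t∉ (inj₂ h)  s gs (inj₁ s∈) = Sum.[ (λ h → h) , (λ t∈ → ⊥-elim (t∉ t∈)) ]
          (noMix s t gs gt s∈ h)
      cases : Dec (∃ λ s → s < suc D × co G s ≡ + 1 × s ∉ es) →
              (∀ s → co G s ≡ + 1 → s ∈ es) ⊎ (∀ s → co G s ≡ + 1 → D ℕ.∸ s ∈ es)
      cases (no none)               = inj₁ λ s gs → in-es none s gs (s ∈? es)
      cases (yes (t , _ , gt , t∉)) = inj₂ λ s gs → reflected t gt t∉ (dichotomy t gt) s gs (dichotomy s gs)

    Σ-rev : Σℤ (suc D) (co (rev D F₀)) ≡ Σℤ (suc D) (co F₀)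
    Σ-rev = C-injective (≋-trans (≋-sym (comp-𝟙 (suc D) (rev D F₀) (Deg<-rev D F₀))) (comp-𝟙-rev D F₀))

    -- Containment of the supports bounds each coefficient of `G` by that of `F₀` or of its
    -- reciprocal. The coefficient sums agree, so no inequality is strict.
    positiveCase : G ≋ F₀ ⊎ G ≋ rev D F₀
    positiveCase = Sum.map
      (λ sub → ≋-by-Deg degG degF (Σℤ-squeeze (suc D) (λ i _ → le₁ sub i (bitG i)) sums))
      (λ sub → ≋-by-Deg degG (Deg<-rev D F₀)
        (Σℤ-squeeze (suc D) (λ { i (s≤s l) → le₂ sub i l (bitG i) }) (≡.trans sums (≡.sym Σ-rev))))
      support
      where
      le₁ : (∀ s → co G s ≡ + 1 → s ∈ es) → ∀ i → Bit (co G i) → co G i ℤ.≤ co F₀ i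
      le₁ sub i (inj₁ z) = ≡.subst (ℤ._≤ co F₀ i) (≡.sym z) (co-S≥0 es i)
      le₁ sub i (inj₂ o) = ℤ.≤-reflexive (≡.trans o (≡.sym (∈⇒1 (sub i o))))
      le₂ : (∀ s → co G s ≡ + 1 → D ℕ.∸ s ∈ es) → ∀ i → i ≤ D → Bit (co G i) → co G i ℤ.≤ co (rev D F₀) i
      le₂ sub i l (inj₁ z) = ≡.subst₂ ℤ._≤_ (≡.sym z) (≡.sym (co-rev D F₀ i l)) (co-S≥0 es (D ℕ.∸ i))
      le₂ sub i l (inj₂ o) = ℤ.≤-reflexive (≡.trans o (≡.sym (≡.trans (co-rev D F₀ i l) (∈⇒1 (sub i o)))))

  -- Reversal preserves the value at 1, so evaluating the hypothesis there gives `G(1)² = F₀(1)²`;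
  -- `τ` is the sign that makes the coefficient sums equal.
  ljunggren : ∀ G → Deg< (suc D) G → G ⊗ rev D G ≋ F₀ ⊗ rev D F₀ →
              ∃ λ τ → τ ℤ.* τ ≡ + 1 × (C τ ⊗ G ≋ F₀ ⊎ C τ ⊗ G ≋ rev D F₀)
  ljunggren G degG eq = signs (i²≡j²⇒i≡±j (Σℤ (suc D) (co G)) (Σℤ (suc D) (co F₀)) (C-injective (begin
      C (σG ℤ.* σG)                    ≈⟨ C-* σG σG ⟩
      C σG ⊗ C σG                      ≈⟨ ⊗-cong (comp-𝟙 (suc D) G degG) (comp-𝟙-rev D G) ⟨
      comp G 𝟙 ⊗ comp (rev D G) 𝟙      ≈⟨ comp-⊗ G (rev D G) 𝟙 ⟨
      comp (G ⊗ rev D G) 𝟙             ≈⟨ comp-congˡ 𝟙 eq ⟩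
      comp (F₀ ⊗ rev D F₀) 𝟙           ≈⟨ comp-⊗ F₀ (rev D F₀) 𝟙 ⟩
      comp F₀ 𝟙 ⊗ comp (rev D F₀) 𝟙    ≈⟨ ⊗-cong (comp-𝟙 (suc D) F₀ degF) (comp-𝟙-rev D F₀) ⟩
      C σF ⊗ C σF                      ≈⟨ C-* σF σF ⟨
      C (σF ℤ.* σF)                    ∎)))
    where
    σG = Σℤ (suc D) (co G)
    σF = Σℤ (suc D) (co F₀)
    G⁻ = C -[1+ 0 ] ⊗ G
    σG⁻ : σG ≡ ℤ.- σF → Σℤ (suc D) (co G⁻) ≡ σF
    σG⁻ e = C-injective (begin
      C (Σℤ (suc D) (co G⁻))           ≈⟨ comp-𝟙 (suc D) G⁻ (Deg<-C⊗ _ G degG) ⟨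
      comp G⁻ 𝟙                        ≈⟨ ≋-trans (comp-⊗ (C -[1+ 0 ]) G 𝟙) (⊗-congʳ (comp-C -[1+ 0 ] 𝟙)) ⟩
      C -[1+ 0 ] ⊗ comp G 𝟙            ≈⟨ ⊗-congˡ (comp-𝟙 (suc D) G degG) ⟩
      C -[1+ 0 ] ⊗ C σG                ≈⟨ C-* _ _ ⟨
      C (-[1+ 0 ] ℤ.* σG)              ≈⟨ ≡⇒≋ (≡.cong C
          (≡.trans (ℤ.-1*i≡-i σG) (≡.trans (≡.cong ℤ.-_ e) (ℤ.neg-involutive σF)))) ⟩
      C σF                             ∎)
    eq⁻ : G⁻ ⊗ rev D G⁻ ≋ F₀ ⊗ rev D F₀
    eq⁻ = begin
      G⁻ ⊗ rev D G⁻                    ≈⟨ ⊗-congˡ (rev-C⊗ D -[1+ 0 ] G) ⟩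
      G⁻ ⊗ (C -[1+ 0 ] ⊗ rev D G)      ≈⟨ solve 2 (λ a b → con -[1+ 0 ] :* a :* (con -[1+ 0 ] :* b) := a :*
          b) ≋-refl G (rev D G) ⟩
      G ⊗ rev D G                      ≈⟨ eq ⟩
      F₀ ⊗ rev D F₀                    ∎
    signs : σG ≡ σF ⊎ σG ≡ ℤ.- σF → ∃ λ τ → τ ℤ.* τ ≡ + 1 × (C τ ⊗ G ≋ F₀ ⊎ C τ ⊗ G ≋ rev D F₀)
    signs (inj₁ e) = + 1 , ≡.refl , Sum.map (≋-trans (ZX.*-identityˡ G)) (≋-trans (ZX.*-identityˡ G))
        (positiveCase G degG eq e)
    signs (inj₂ e) = -[1+ 0 ] , ≡.refl , positiveCase G⁻ (Deg<-C⊗ _ G degG) eq⁻ (σG⁻ e)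

-- Generic tuples

-- `F` hides its sum in a local function. Quantifying over that sum `s` exposes how one more
-- exponent changes `F`.
F-∷ : ∀ (Q : Pol → Pol → Set) n → (∀ s → Q (ℤ[X].1ₚ ℤ[X].+ s) (ℤ[X].1ₚ ℤ[X].+ (ℤ[X].X^ n ℤ[X].+ s))) →
      ∀ {k} (ns : Vec ℕ k) → Q (F ns) (F (n ∷ ns))
F-∷ Q n q ns = q _

F≋S : ∀ {k} (ns : Vec ℕ k) → F ns ≋ S (0 ∷ toList ns)
F≋S []       = ≋-trans (≡⇒≋ 𝟙-def) (≋-sym (≋-trans (⊕-congʳ X-0) (ZX.+-identityʳ 𝟙)))
F≋S (n ∷ ns) = ≋-trans (F-∷ (λ f g → g ≋ X n ⊕ f) n step ns) (≋-trans (⊕-congˡ (F≋S ns))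
  (solve 3 (λ x o s → x :+ (o :+ s) := o :+ (x :+ s)) ≋-refl (X n) (X 0) (S (toList ns))))
  where
  step : ∀ s → ℤ[X].1ₚ ℤ[X].+ (ℤ[X].X^ n ℤ[X].+ s) ≋ X n ⊕ (ℤ[X].1ₚ ℤ[X].+ s)
  step s = ≋-trans (≡⇒≋ (≡.trans (⊕-def ℤ[X].1ₚ _) (≡.cong (ℤ[X].1ₚ ⊕_)
      (≡.trans (⊕-def (ℤ[X].X^ n) s) (≡.cong (_⊕ s) (X-def n))))))
    (≋-trans (solve 3 (λ o x s → o :+ (x :+ s) := x :+ (o :+ s)) ≋-refl ℤ[X].1ₚ (X n) s)
      (⊕-congˡ (≡⇒≋ (≡.sym (⊕-def ℤ[X].1ₚ s)))))

top : ∀ {k} → Vec ℕ (suc k) → ℕ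
top {k} ns = lookup ns (fromℕ k)

exponents : ∀ {k} → Vec ℕ k → List ℕ
exponents ns = 0 ∷ toList ns

sorted : ∀ {k} {ns : Vec ℕ k} → Linked _<_ ns → AllPairs _<_ (toList ns)
sorted []            = []
sorted [-]           = [] ∷ []
sorted {ns = _ ∷ _ ∷ _} (x<y ∷ l) with sorted l
... | y< ∷ rest = (x<y ∷ All.map (ℕ.<-trans x<y) y<) ∷ y< ∷ rest

≤top : ∀ {k} {ns : Vec ℕ (suc k)} → Linked _<_ ns → All (_≤ top ns) (toList ns)
≤top [-]             = ℕ.≤-refl ∷ []
≤top {suc k} {_ ∷ _ ∷ _} (x<y ∷ l) with ≤top l
... | y≤ ∷ rest = ℕ.≤-trans (ℕ.<⇒≤ x<y) y≤ ∷ y≤ ∷ rest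

exponents-sorted : ∀ {k N} {ns : Vec ℕ k} → IncreasingIn[1, N ] ns → AllPairs _<_ (exponents ns)
exponents-sorted {ns = ns} (b , l) = go b ∷ sorted l
  where
  go : ∀ {k} {ns : Vec ℕ k} → VAll.All (λ n → 1 ≤ n × n ≤ _) ns → All (0 <_) (toList ns)
  go VAll.[]            = []
  go ((p , _) VAll.∷ b) = p ∷ go b

S-bits : ∀ {es} → AllPairs _<_ es → ∀ i → Bit (co (S es) i)
S-bits []                    i = inj₁ (co-𝟘 i)
S-bits {e ∷ es} (e< ∷ pairs) i with e ℕ.≟ i
... | yes ≡.refl = inj₂ (≡.trans (co-⊕ (X e) (S es) e) (≡.cong₂ ℤ._+_ (co-X≡ e) zero′))
  where
  zero′ : co (S es) e ≡ + 0
  zero′ with co (S es) e ℤ.≟ + 0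
  ... | yes z = z
  ... | no nz = ⊥-elim (ℕ.<-irrefl ≡.refl (All.lookup e< (co-S≢0 es nz)))
... | no ne = ≡.subst Bit (≡.sym (≡.trans (co-⊕ (X e) (S es) i)
      (≡.trans (≡.cong (ℤ._+ co (S es) i) (co-X≢ e i ne)) (ℤ.+-identityˡ _)))) (S-bits pairs i)

-- The exponents of F, with nothing standing for the exponent 0.
Index : ℕ → Set
Index k = Maybe (Fin k)

val : ∀ {k} → Vec ℕ k → Index k → ℕ
val ns nothing  = 0
val ns (just i) = lookup ns i

-- The coordinate vector of an exponent. The exponent 0 gets the zero vector, since it contributes
-- nothing to a linear relation.
δ : ∀ {k} → Index k → Fin k → ℕ
δ nothing  j = 0
δ (just i) j with i Fin.≟ j
... | yes _ = 1
... | no  _ = 0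

δ-refl : ∀ {k} (i : Fin k) → δ (just i) i ≡ 1
δ-refl i with i Fin.≟ i
... | yes _ = ≡.refl
... | no ne = ⊥-elim (ne ≡.refl)

δ≢0 : ∀ {k} (x : Index k) j → δ x j ≢ 0 → x ≡ just j
δ≢0 nothing  j nz = ⊥-elim (nz ≡.refl)
δ≢0 (just i) j nz with i Fin.≟ j
... | yes ≡.refl = ≡.refl
... | no _       = ⊥-elim (nz ≡.refl)

δ≤1 : ∀ {k} (x : Index k) j → δ x j ≤ 1
δ≤1 nothing  j = z≤n
δ≤1 (just i) j with i Fin.≟ j
... | yes _ = ℕ.≤-refl
... | no  _ = z≤n

∈exponents : ∀ {k} {ns : Vec ℕ k} {e} → e ∈ exponents ns → ∃ λ x → e ≡ val ns x
∈exponents (here ≡.refl) = nothing , ≡.refl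
∈exponents {ns = ns} (there e∈) with go ns e∈
  where
  go : ∀ {k} (ns : Vec ℕ k) {e} → e ∈ toList ns → ∃ λ i → e ≡ lookup ns i
  go (n ∷ ns) (here ≡.refl) = Fin.zero , ≡.refl
  go (n ∷ ns) (there e∈)    = let (i , eq) = go ns e∈ in Fin.suc i , eq
... | i , eq = just i , eq

val∈ : ∀ {k} (ns : Vec ℕ k) x → val ns x ∈ exponents ns
val∈ ns nothing  = here ≡.refl
val∈ ns (just i) = there (go ns i)
  where
  go : ∀ {k} (ns : Vec ℕ k) i → lookup ns i ∈ toList ns
  go (n ∷ ns) Fin.zero    = here ≡.refl
  go (n ∷ ns) (Fin.suc i) = there (go ns i)

dot : ∀ {k} → (Fin k → ℤ) → Vec ℕ k → ℤ
dot c []       = + 0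
dot c (n ∷ ns) = c Fin.zero ℤ.* + n ℤ.+ dot (c ∘ Fin.suc) ns

dot-cong : ∀ {k} {c c′ : Fin k → ℤ} → (∀ i → c i ≡ c′ i) → ∀ ns → dot c ns ≡ dot c′ ns
dot-cong e []       = ≡.refl
dot-cong e (n ∷ ns) = ≡.cong₂ (λ a b → a ℤ.* + n ℤ.+ b) (e Fin.zero) (dot-cong (e ∘ Fin.suc) ns)

dot-0 : ∀ {k} (ns : Vec ℕ k) → dot (λ _ → + 0) ns ≡ + 0
dot-0 []       = ≡.refl
dot-0 (n ∷ ns) = ≡.trans (ℤ.+-identityˡ _) (dot-0 ns)

dot-+ : ∀ {k} (c c′ : Fin k → ℤ) ns → dot (λ i → c i ℤ.+ c′ i) ns ≡ dot c ns ℤ.+ dot c′ ns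
dot-+ c c′ []       = ≡.refl
dot-+ c c′ (n ∷ ns) = ≡.trans (≡.cong (λ z → (c Fin.zero ℤ.+ c′ Fin.zero) ℤ.* + n ℤ.+ z)
    (dot-+ (c ∘ Fin.suc) (c′ ∘ Fin.suc) ns))
  (solveℤ 5 (λ a b n x y → (a ℤ:+ b) ℤ:* n ℤ:+ (x ℤ:+ y) ℤ:= (a ℤ:* n ℤ:+ x) ℤ:+ (b ℤ:* n ℤ:+ y)) ≡.refl
    (c Fin.zero) (c′ Fin.zero) (+ n) (dot (c ∘ Fin.suc) ns) (dot (c′ ∘ Fin.suc) ns))

dot-neg : ∀ {k} (c : Fin k → ℤ) ns → dot (λ i → ℤ.- c i) ns ≡ ℤ.- dot c ns
dot-neg c []       = ≡.refl
dot-neg c (n ∷ ns) = ≡.trans (≡.cong (λ z → ℤ.- c Fin.zero ℤ.* + n ℤ.+ z) (dot-neg (c ∘ Fin.suc) ns))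
  (solveℤ 3 (λ a n x → ℤ:neg a ℤ:* n ℤ:+ ℤ:neg x ℤ:= ℤ:neg (a ℤ:* n ℤ:+ x)) ≡.refl (c Fin.zero) (+ n)
      (dot (c ∘ Fin.suc) ns))

δ-suc : ∀ {k} (i j : Fin k) → δ (just (Fin.suc i)) (Fin.suc j) ≡ δ (just i) j
δ-suc i j with i Fin.≟ j
... | yes _ = ≡.refl
... | no  _ = ≡.refl

dot-δ : ∀ {k} (ns : Vec ℕ k) x → dot (λ j → + δ x j) ns ≡ + val ns x
dot-δ ns       nothing            = dot-0 ns
dot-δ (n ∷ ns) (just Fin.zero)    = ≡.trans (≡.cong₂ ℤ._+_ (ℤ.*-identityˡ (+ n)) (dot-0 ns))
    (ℤ.+-identityʳ (+ n))
dot-δ (n ∷ ns) (just (Fin.suc i)) = ≡.trans (ℤ.+-identityˡ _) (≡.trans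
  (dot-cong (λ j → ≡.cong +_ (δ-suc i j)) ns) (dot-δ ns (just i)))

-- The relations to be excluded have at most three exponents on either side, hence the bound 3.
-- Divisibility by `p` covers exact relations as well, since `p` divides 0.
Generic : ℕ → ∀ {k} → Vec ℕ k → Set
Generic p {k} ns = ∀ (c : Fin k → ℤ) → (∀ i → ∣ c i ∣ ≤ 3) → + p ℤ.∣ dot c ns → ∀ i → c i ≡ + 0

sumδ : ∀ {k} → List (Index k) → Fin k → ℕ
sumδ xs j = sum (map (λ x → δ x j) xs)

sumval : ∀ {k} → Vec ℕ k → List (Index k) → ℕ
sumval ns xs = sum (map (val ns) xs)

dot-sumδ : ∀ {k} (ns : Vec ℕ k) xs → dot (λ j → + sumδ xs j) ns ≡ + sumval ns xs
dot-sumδ ns []       = dot-0 ns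
dot-sumδ ns (x ∷ xs) = ≡.trans (dot-+ (λ j → + δ x j) (λ j → + sumδ xs j) ns)
    (≡.cong₂ ℤ._+_ (dot-δ ns x) (dot-sumδ ns xs))

sumδ≤length : ∀ {k} (xs : List (Index k)) j → sumδ xs j ≤ length xs
sumδ≤length []       j = z≤n
sumδ≤length (x ∷ xs) j = ℕ.+-mono-≤ (δ≤1 x j) (sumδ≤length xs j)

-- Two multiplicity vectors with entries up to 3 differ by entries in [-3,3]. So a congruence
-- between two short sums of exponents of a generic tuple can only hold formally, each nonzero
-- exponent occurring equally often on both sides.
generic-sums : ∀ {p k} {ns : Vec ℕ k} → Generic p ns → ∀ xs ys → length xs ≤ 3 → length ys ≤ 3 →
               + p ℤ.∣ + sumval ns xs ℤ.- + sumval ns ys → ∀ j → sumδ xs j ≡ sumδ ys j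
generic-sums {p} {k} {ns} gen xs ys lx ly d j = ℤ.+-injective
    (ℤ.i-j≡0⇒i≡j (+ sumδ xs j) (+ sumδ ys j) (gen c small (≡.subst (+ p ℤ.∣_) (≡.sym dot-c) d) j))
  where
  c : Fin k → ℤ
  c j = + sumδ xs j ℤ.- + sumδ ys j
  dot-c : dot c ns ≡ + sumval ns xs ℤ.- + sumval ns ys
  dot-c = ≡.trans (dot-+ (λ j → + sumδ xs j) (λ j → ℤ.- + sumδ ys j) ns) (≡.cong₂ ℤ._+_ (dot-sumδ ns xs)
    (≡.trans (dot-neg (λ j → + sumδ ys j) ns) (≡.cong ℤ.-_ (dot-sumδ ns ys))))
  small : ∀ j → ∣ c j ∣ ≤ 3
  small j = ℕ.≤-trans (ℕ.≤-reflexive (≡.cong ∣_∣ (ℤ.[+m]-[+n]≡m⊖n (sumδ xs j) (sumδ ys j))))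
    (ℕ.≤-trans (ℤ.∣m⊝n∣≤m⊔n (sumδ xs j) (sumδ ys j))
      (ℕ.⊔-lub (ℕ.≤-trans (sumδ≤length xs j) lx) (ℕ.≤-trans (sumδ≤length ys j) ly)))

generic-sums≡ : ∀ {p k} {ns : Vec ℕ k} → Generic p ns → ∀ xs ys → length xs ≤ 3 → length ys ≤ 3 →
                sumval ns xs ≡ sumval ns ys → ∀ j → sumδ xs j ≡ sumδ ys j
generic-sums≡ {p} {ns = ns} gen xs ys lx ly e = generic-sums gen xs ys lx ly
  (ℤ.divides (+ 0) (ℤ.i≡j⇒i-j≡0 (≡.cong +_ e)))

δ-cases : ∀ {k} (xs : List (Index k)) j → 1 ≤ sumδ xs j → just j ∈ xs
δ-cases (x ∷ xs) j l with δ x j ℕ.≟ 0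
... | yes z = there (δ-cases xs j (≡.subst (λ n → 1 ≤ n ℕ.+ sumδ xs j) z l))
... | no nz = here (≡.sym (δ≢0 x j nz))

-- If neither `y` nor `z` were the exponent 0, both would have to be `x`, and counting `x` would
-- give 1 = 2.
formal-subtract : ∀ {k} (x : Index k) y z → (∀ j → δ x j ≡ δ y j ℕ.+ δ z j) → y ≡ nothing ⊎ z ≡ nothing
formal-subtract x nothing   z        e = inj₁ ≡.refl
formal-subtract x (just i)  nothing  e = inj₂ ≡.refl
formal-subtract x (just i)  (just j) e with δ≢0 x i (λ z → contra i (≡.trans (≡.sym (e i)) z)) | δ≢0 x j
    (λ z → contra′ j (≡.trans (≡.sym (e j)) z))
  where
  contra : ∀ i → δ (just i) i ℕ.+ δ (just j) i ≢ 0
  contra i rewrite δ-refl i = λ ()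
  contra′ : ∀ j → δ (just i) j ℕ.+ δ (just j) j ≢ 0
  contra′ j z with ≡.trans (≡.sym (δ-refl j)) (ℕ.m+n≡0⇒n≡0 (δ (just i) j) z)
  ... | ()
... | ≡.refl | ≡.refl with ≡.trans (≡.sym (≡.cong₂ ℕ._+_ (δ-refl i) (δ-refl i)))
    (≡.trans (≡.sym (e i)) (δ-refl i))
...   | ()

module GenericTuple {p k N : ℕ} (ns : Vec ℕ (suc k)) (gen : Generic p ns) (inc : IncreasingIn[1, N ] ns) where
  es : List ℕ
  es = exponents ns

  D : ℕ
  D = top ns

  ℓ : Fin (suc k)
  ℓ = fromℕ k

  D∈ : D ∈ es
  D∈ = val∈ ns (just ℓ)

  es≤D : All (_≤ D) es
  es≤D = z≤n ∷ ≤top (proj₂ inc)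

  open ≡.≡-Reasoning renaming (begin_ to begin′_; _∎ to _∎′) using (step-≡-⟩; step-≡-⟨)

  -- Eliminating `s` gives `a + c = D + b + d`, which must hold formally, so `D` is `a` or `c`. If
  -- `c = D`, then `s = d`. If `a = D`, then `c = b + d` formally, so `b = 0` and `s = D`, or
  -- `d = 0` and `D - s = c`.
  alt : ∀ {s a b c d} → a ∈ es → b ∈ es → c ∈ es → d ∈ es → a ≡ s ℕ.+ b → c ℕ.+ s ≡ D ℕ.+ d → s ∈ es ⊎ D ℕ.∸
      s ∈ es
  alt {s} a∈ b∈ c∈ d∈ e e′ = go (∈exponents a∈) (∈exponents b∈) (∈exponents c∈) (∈exponents d∈)
    where
    go : ∃ (λ x → _ ≡ val ns x) → ∃ (λ x → _ ≡ val ns x) → ∃ (λ x → _ ≡ val ns x) → ∃ (λ x → _ ≡ val ns x) →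
        s ∈ es ⊎ D ℕ.∸ s ∈ es
    go (xa , ≡.refl) (xb , ≡.refl) (xc , ≡.refl) (xd , ≡.refl) = cases (δ-cases (xa ∷ xc ∷ []) ℓ pos)
      where
      rel : val ns xa ℕ.+ (val ns xc ℕ.+ 0) ≡ D ℕ.+ (val ns xb ℕ.+ (val ns xd ℕ.+ 0))
      rel = begin′
        val ns xa ℕ.+ (val ns xc ℕ.+ 0)           ≡⟨ ≡.cong₂ ℕ._+_ e (ℕ.+-identityʳ (val ns xc)) ⟩
        s ℕ.+ val ns xb ℕ.+ val ns xc             ≡⟨ ≡.cong (ℕ._+ val ns xc) (ℕ.+-comm s (val ns xb)) ⟩
        val ns xb ℕ.+ s ℕ.+ val ns xc             ≡⟨ ≡.trans (ℕ.+-assoc (val ns xb) s (val ns xc))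
            (≡.cong (val ns xb ℕ.+_) (ℕ.+-comm s (val ns xc))) ⟩
        val ns xb ℕ.+ (val ns xc ℕ.+ s)           ≡⟨ ≡.cong (val ns xb ℕ.+_) e′ ⟩
        val ns xb ℕ.+ (D ℕ.+ val ns xd)           ≡⟨ ℕ.+-assoc (val ns xb) D (val ns xd) ⟨
        val ns xb ℕ.+ D ℕ.+ val ns xd             ≡⟨ ≡.cong (ℕ._+ val ns xd) (ℕ.+-comm (val ns xb) D) ⟩
        D ℕ.+ val ns xb ℕ.+ val ns xd             ≡⟨ ≡.trans (ℕ.+-assoc D (val ns xb) (val ns xd))
            (≡.cong (λ z → D ℕ.+ (val ns xb ℕ.+ z)) (≡.sym (ℕ.+-identityʳ (val ns xd)))) ⟩
        D ℕ.+ (val ns xb ℕ.+ (val ns xd ℕ.+ 0))   ∎′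
      formal : ∀ j → sumδ (xa ∷ xc ∷ []) j ≡ sumδ (just ℓ ∷ xb ∷ xd ∷ []) j
      formal = generic-sums≡ gen (xa ∷ xc ∷ []) (just ℓ ∷ xb ∷ xd ∷ []) (s≤s (s≤s z≤n)) ℕ.≤-refl rel
      pos : 1 ≤ sumδ (xa ∷ xc ∷ []) ℓ
      pos = ≡.subst (1 ≤_) (≡.sym (≡.trans (formal ℓ) (≡.cong (ℕ._+ sumδ (xb ∷ xd ∷ []) ℓ) (δ-refl ℓ))))
          (s≤s z≤n)
      cases : just ℓ ∈ xa ∷ xc ∷ [] → s ∈ es ⊎ D ℕ.∸ s ∈ es
      cases (here ≡.refl) with formal-subtract xc xb xd (λ j → ≡.trans (≡.sym (ℕ.+-identityʳ (δ xc j)))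
               (≡.trans (ℕ.+-cancelˡ-≡ (δ (just ℓ) j) _ _ (formal j))
                   (≡.cong (δ xb j ℕ.+_) (ℕ.+-identityʳ (δ xd j)))))
      ... | inj₁ ≡.refl = inj₁ (≡.subst (_∈ es) (≡.trans e (ℕ.+-identityʳ s)) D∈)
      ... | inj₂ ≡.refl = inj₂ (≡.subst (_∈ es) (≡.trans (≡.sym (ℕ.m+n∸n≡m (val ns xc) s))
          (≡.cong (ℕ._∸ s) (≡.trans e′ (ℕ.+-identityʳ D)))) (val∈ ns xc))
      cases (there (here ≡.refl)) = inj₁ (≡.subst (_∈ es) (≡.sym (ℕ.+-cancelˡ-≡ D s (val ns xd) e′))
          (val∈ ns xd))

  -- The relation holds formally, so `D` is one of `s`, `u`, `b`. In the first two cases a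
  -- difference is 0. If `b = D`, then `s + u = a` formally, so `s` or `u` is 0 and its difference
  -- from `D` is `D`.
  mix : ∀ {s u a b} → s ∈ es → u ∈ es → a ∈ es → b ∈ es → s ℕ.+ u ℕ.+ b ≡ a ℕ.+ D → D ℕ.∸ s ∈ es ⊎ D ℕ.∸ u ∈
      es
  mix s∈ u∈ a∈ b∈ e = go (∈exponents s∈) (∈exponents u∈) (∈exponents a∈) (∈exponents b∈)
    where
    D-D : D ℕ.∸ D ∈ es
    D-D = ≡.subst (_∈ es) (≡.sym (ℕ.n∸n≡0 D)) (here ≡.refl)
    go : ∃ (λ x → _ ≡ val ns x) → ∃ (λ x → _ ≡ val ns x) → ∃ (λ x → _ ≡ val ns x) → ∃ (λ x → _ ≡ val ns x) →
        _ ∈ es ⊎ _ ∈ es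
    go (xs , ≡.refl) (xu , ≡.refl) (xa , ≡.refl) (xb , ≡.refl) = cases (δ-cases (xs ∷ xu ∷ xb ∷ []) ℓ pos)
      where
      rel : val ns xs ℕ.+ (val ns xu ℕ.+ (val ns xb ℕ.+ 0)) ≡ D ℕ.+ (val ns xa ℕ.+ 0)
      rel = ≡.trans (≡.cong (λ z → val ns xs ℕ.+ (val ns xu ℕ.+ z)) (ℕ.+-identityʳ (val ns xb)))
        (≡.trans (≡.sym (ℕ.+-assoc (val ns xs) (val ns xu) (val ns xb)))
            (≡.trans e (≡.trans (ℕ.+-comm (val ns xa) D)
          (≡.cong (D ℕ.+_) (≡.sym (ℕ.+-identityʳ (val ns xa)))))))
      formal : ∀ j → sumδ (xs ∷ xu ∷ xb ∷ []) j ≡ sumδ (just ℓ ∷ xa ∷ []) j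
      formal = generic-sums≡ gen (xs ∷ xu ∷ xb ∷ []) (just ℓ ∷ xa ∷ []) ℕ.≤-refl (s≤s (s≤s z≤n)) rel
      pos : 1 ≤ sumδ (xs ∷ xu ∷ xb ∷ []) ℓ
      pos = ≡.subst (1 ≤_) (≡.sym (≡.trans (formal ℓ) (≡.cong (ℕ._+ sumδ (xa ∷ []) ℓ) (δ-refl ℓ))))
          (s≤s z≤n)
      cases : just ℓ ∈ xs ∷ xu ∷ xb ∷ [] → D ℕ.∸ val ns xs ∈ es ⊎ D ℕ.∸ val ns xu ∈ es
      cases (here ≡.refl)         = inj₁ D-D
      cases (there (here ≡.refl)) = inj₂ D-D
      cases (there (there (here ≡.refl))) with formal-subtract xa xs xu
          (λ j → ≡.sym (ℕ.+-cancelʳ-≡ (δ (just ℓ) j) _ _ (reorder j)))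
        where
        reorder : ∀ j → δ xs j ℕ.+ δ xu j ℕ.+ δ (just ℓ) j ≡ δ xa j ℕ.+ δ (just ℓ) j
        reorder j = ≡.trans (ℕ.+-assoc (δ xs j) (δ xu j) _)
            (≡.trans (≡.cong (λ z → δ xs j ℕ.+ (δ xu j ℕ.+ z)) (≡.sym (ℕ.+-identityʳ _)))
          (≡.trans (formal j) (≡.trans (≡.cong (δ (just ℓ) j ℕ.+_) (ℕ.+-identityʳ (δ xa j)))
              (ℕ.+-comm (δ (just ℓ) j) (δ xa j)))))
      ... | inj₁ ≡.refl = inj₁ D∈
      ... | inj₂ ≡.refl = inj₂ D∈

  open Ljunggren es D (here ≡.refl) D∈ es≤D (S-bits (exponents-sorted inc)) alt mix public
    using (F₀; degF; ∈⇒1; ljunggren)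

  MonicF : Monic D F₀
  MonicF = monic (∈⇒1 D∈) degF

-- Common factors of F and its reciprocal

-- The sign is -1 for `X - 1`, so products of cyclotomic polynomials require both values of `ε`.
record SelfReciprocal (f : Pol) : Set where
  constructor selfReciprocal
  field
    {d}  : ℕ
    M    : Monic d f
    ε    : ℤ
    ε²≡1 : ε ℤ.* ε ≡ + 1
    rev≋ : rev d f ≋ C ε ⊗ f

SelfReciprocal-resp : ∀ {f g} → f ≋ g → SelfReciprocal f → SelfReciprocal g
SelfReciprocal-resp e (selfReciprocal {d} M ε sq r) = selfReciprocal (Monic-resp e M) ε sq
  (≋-trans (rev-cong d (≋-sym e)) (≋-trans r (⊗-congˡ e)))

SelfReciprocal-𝟙 : SelfReciprocal 𝟙
SelfReciprocal-𝟙 = selfReciprocal Monic-𝟙 (+ 1) ≡.refl (≋-trans (rev0-C (+ 1)) (≋-sym (ZX.*-identityˡ 𝟙)))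

sq-* : ∀ {a b} → a ℤ.* a ≡ + 1 → b ℤ.* b ≡ + 1 → (a ℤ.* b) ℤ.* (a ℤ.* b) ≡ + 1
sq-* {a} {b} ea eb = ≡.trans (interchange a b a b) (≡.cong₂ ℤ._*_ ea eb)
  where
  open import Algebra.Properties.CommutativeSemigroup ℤ.*-commutativeSemigroup using (interchange)

SelfReciprocal-⊗ : ∀ {f g} → SelfReciprocal f → SelfReciprocal g → SelfReciprocal (f ⊗ g)
SelfReciprocal-⊗ {f} {g} (selfReciprocal {d} M ε sq r) (selfReciprocal {d′} M′ ε′ sq′ r′) =
  selfReciprocal (Monic-⊗ M M′) (ε ℤ.* ε′) (sq-* {ε} {ε′} sq sq′) (begin
    rev (d ℕ.+ d′) (f ⊗ g)      ≈⟨ rev-⊗ f g d d′ (above M) (above M′) ⟩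
    rev d f ⊗ rev d′ g          ≈⟨ ⊗-cong r r′ ⟩
    (C ε ⊗ f) ⊗ (C ε′ ⊗ g)      ≈⟨ solve 4 (λ a f b g → (a :* f) :* (b :* g) := (a :* b) :* (f :* g)) ≋-refl
        (C ε) f (C ε′) g ⟩
    C ε ⊗ C ε′ ⊗ (f ⊗ g)        ≈⟨ ⊗-congʳ (C-* ε ε′) ⟨
    C (ε ℤ.* ε′) ⊗ (f ⊗ g)      ∎)

SelfReciprocal-Y : ∀ n → SelfReciprocal (Y (suc n))
SelfReciprocal-Y n = selfReciprocal (Monic-Y n) -[1+ 0 ] ≡.refl (begin
  rev (suc n) (X (suc n) ⊕ ⊖ 𝟙)                   ≈⟨ rev-⊕ (suc n) (X (suc n)) (⊖ 𝟙) ⟩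
  rev (suc n) (X (suc n)) ⊕ rev (suc n) (⊖ 𝟙)     ≈⟨ ⊕-cong (rev-X (suc n) (suc n) ℕ.≤-refl)
      (≋-trans (rev-cong (suc n) (≋-sym (C-neg (+ 1)))) (rev-C (suc n) -[1+ 0 ])) ⟩
  X (suc n ℕ.∸ suc n) ⊕ X (suc n) ⊗ C -[1+ 0 ]    ≈⟨ ⊕-congʳ (≋-trans (≡⇒≋ (≡.cong X (ℕ.n∸n≡0 n))) X-0) ⟩
  𝟙 ⊕ X (suc n) ⊗ C -[1+ 0 ]                      ≈⟨ solve 1
      (λ x → con (+ 1) :+ x :* con -[1+ 0 ] := con -[1+ 0 ] :* (x :+ :- con (+ 1))) ≋-refl (X (suc n)) ⟩
  C -[1+ 0 ] ⊗ Y (suc n)                          ∎)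

SelfReciprocal-quotient : ∀ {f g h} → h ≋ f ⊗ g → SelfReciprocal h → SelfReciprocal g → SelfReciprocal f
SelfReciprocal-quotient {f} {g} {h} e (selfReciprocal {n} Mh ε sq r) (selfReciprocal {m} Mg ε′ sq′ r′)
  with Monic-quotient Mg (Monic-resp e Mh)
... | d , Mf , ≡.refl = selfReciprocal Mf (ε ℤ.* ε′) (sq-* {ε} {ε′} sq sq′)
    (⊗-cancelˡ g (Monic⇒≢𝟘 Mg) (begin
    g ⊗ rev d f                          ≈⟨ ⊗-congʳ (σσ-cancel sq′ g) ⟩
    C ε′ ⊗ (C ε′ ⊗ g) ⊗ rev d f          ≈⟨ ⊗-congʳ (⊗-congˡ (≋-sym r′)) ⟩
    C ε′ ⊗ rev m g ⊗ rev d f             ≈⟨ solve 3 (λ a b c → a :* b :* c := a :* (c :* b)) ≋-refl (C ε′)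
        (rev m g) (rev d f) ⟩
    C ε′ ⊗ (rev d f ⊗ rev m g)           ≈⟨ ⊗-congˡ (rev-⊗ f g d m (above Mf) (above Mg)) ⟨
    C ε′ ⊗ rev (d ℕ.+ m) (f ⊗ g)         ≈⟨ ⊗-congˡ
        (≋-trans (rev-cong (d ℕ.+ m) (≋-sym e)) (≋-trans r (⊗-congˡ e))) ⟩
    C ε′ ⊗ (C ε ⊗ (f ⊗ g))               ≈⟨ solve 4
        (λ a b f g → b :* (a :* (f :* g)) := g :* ((a :* b) :* f)) ≋-refl (C ε) (C ε′) f g ⟩
    g ⊗ (C ε ⊗ C ε′ ⊗ f)                 ≈⟨ ⊗-congˡ (⊗-congʳ (C-* ε ε′)) ⟨
    g ⊗ (C (ε ℤ.* ε′) ⊗ f)               ∎))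

SelfReciprocal-Φ : ∀ n → SelfReciprocal (Φ′ (suc n))
SelfReciprocal-Φ = <-rec (λ n → SelfReciprocal (Φ′ (suc n))) λ n ih →
  SelfReciprocal-quotient (CyclotomicFactorisation.split (cyclotomicFactorisation n)) (SelfReciprocal-Y n)
    (Π-closed SelfReciprocal SelfReciprocal-resp SelfReciprocal-𝟙 SelfReciprocal-⊗ (suc n) n λ d l _ → ih l)

NoCyclotomicFactor : Pol → Set
NoCyclotomicFactor f = ∀ n → ¬ Φ′ (suc n) ∣ₚ f

record CommonFactor {k} (ns : Vec ℕ (suc k)) : Set where
  field
    {e}   : ℕ
    {h}   : Pol
    M     : Monic (suc e) h
    h∣F   : h ∣ₚ S (exponents ns)
    h∣rev : h ∣ₚ rev (top ns) (S (exponents ns))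
    noΦ   : NoCyclotomicFactor h

module Factorisations {p k N : ℕ} (ns : Vec ℕ (suc k)) (gen : Generic p ns) (inc : IncreasingIn[1, N ] ns) where
  open GenericTuple ns gen inc

  -- `G` arises from `F₀` by trading `v` for `v̂`, and their reciprocals trade back, so the products
  -- agree. If `±G = F₀`, cancelling `c u` leaves `v = ± v̂`, so `v` divides `rev D F₀`. If
  -- `±G = rev D F₀`, cancelling `v̂` makes `rev a cu` equal to `± c u`, so `u` does.
  commonFactor : ∀ {dc du dv c u v} → Monic dc c → Monic (suc du) u → Monic (suc dv) v → F₀ ≋ c ⊗ (u ⊗ v) →
                 NoCyclotomicFactor (u ⊗ v) → CommonFactor ns
  commonFactor {dc} {du} {dv} {c} {u} {v} Mc Mu Mv F≋ noΦ = finish (ljunggren G degG GG)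
    where
    a = dc ℕ.+ suc du
    b = suc dv
    cu = c ⊗ u
    Mcu : Monic a cu
    Mcu = Monic-⊗ Mc Mu
    F≋′ : F₀ ≋ cu ⊗ v
    F≋′ = ≋-trans F≋ (≋-sym (ZX.*-assoc c u v))
    D≡ : D ≡ a ℕ.+ b
    D≡ = Monic-unique MonicF (Monic-resp (≋-sym F≋′) (Monic-⊗ Mcu Mv))
    v̂ = rev b v
    G = cu ⊗ v̂
    degG : Deg< (suc D) G
    degG = ≡.subst (λ n → Deg< (suc n) G) (≡.sym D≡) (Deg<-⊗ cu v̂ a b (above Mcu) (Deg<-rev b v))
    revF : rev D F₀ ≋ rev a cu ⊗ v̂
    revF = ≋-trans (≡⇒≋ (≡.cong (λ n → rev n F₀) D≡))
        (≋-trans (rev-cong (a ℕ.+ b) F≋′) (rev-⊗ cu v a b (above Mcu) (above Mv)))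
    revG : rev D G ≋ rev a cu ⊗ v
    revG = ≋-trans (≡⇒≋ (≡.cong (λ n → rev n G) D≡))
        (≋-trans (rev-⊗ cu v̂ a b (above Mcu) (Deg<-rev b v)) (⊗-congˡ (rev-rev b v (above Mv))))
    GG : G ⊗ rev D G ≋ F₀ ⊗ rev D F₀
    GG = begin
      G ⊗ rev D G                    ≈⟨ ⊗-congˡ revG ⟩
      cu ⊗ v̂ ⊗ (rev a cu ⊗ v)        ≈⟨ solve 4 (λ a b c d → a :* b :* (c :* d) := (a :* d) :* (c :* b))
          ≋-refl cu v̂ (rev a cu) v ⟩
      cu ⊗ v ⊗ (rev a cu ⊗ v̂)        ≈⟨ ⊗-cong F≋′ revF ⟨
      F₀ ⊗ rev D F₀                  ∎
    finish : (∃ λ τ → τ ℤ.* τ ≡ + 1 × (C τ ⊗ G ≋ F₀ ⊎ C τ ⊗ G ≋ rev D F₀)) → CommonFactor ns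
    finish (τ , sq , inj₁ e) = record
      { M = Mv ; h∣F = ∣ₚ-respʳ (≋-sym F≋′) (g∣ₚf⊗g cu v)
      ; h∣rev = ∣ₚ-respʳ (≋-sym revF) (∣ₚ-⊗ˡ (rev a cu) v∣v̂)
      ; noΦ = λ n d → noΦ n (∣ₚ-⊗ˡ u d) }
      where
      τv̂≋v : C τ ⊗ v̂ ≋ v
      τv̂≋v = ⊗-cancelˡ cu (Monic⇒≢𝟘 Mcu) (≋-trans (solve 3 (λ a b c → a :* (b :* c) := b :* (a :* c))
          ≋-refl cu (C τ) v̂) (≋-trans e F≋′))
      v∣v̂ : v ∣ₚ v̂
      v∣v̂ = divides (C τ) (≋-trans (⊗-congˡ (≋-sym τv̂≋v)) (≋-sym (σσ-cancel sq v̂)))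
    finish (τ , sq , inj₂ e) = record
      { M = Mu ; h∣F = ∣ₚ-respʳ (≋-sym F≋′) (∣ₚ-⊗ʳ v (g∣ₚf⊗g c u))
      ; h∣rev = ∣ₚ-respʳ (≋-sym revF) (∣ₚ-⊗ʳ v̂ (∣ₚ-respʳ τcu≋ (∣ₚ-⊗ˡ (C τ) (g∣ₚf⊗g c u))))
      ; noΦ = λ n d → noΦ n (∣ₚ-⊗ʳ v d) }
      where
      v̂≢𝟘 : ¬ v̂ ≋ 𝟘
      v̂≢𝟘 z = Monic⇒≢𝟘 Mv (≋-trans (≋-sym (rev-rev b v (above Mv)))
          (≋-trans (rev-cong b (≋-trans z (≋-sym C-0)))
        (≋-trans (rev-C b (+ 0)) (≋-trans (⊗-congˡ C-0) (ZX.zeroʳ _)))))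
      τcu≋ : C τ ⊗ cu ≋ rev a cu
      τcu≋ = ⊗-cancelˡ v̂ v̂≢𝟘 (≋-trans (solve 3 (λ a b c → a :* (b :* c) := b :* (c :* a)) ≋-refl v̂ (C τ)
          cu)
        (≋-trans e (≋-trans revF (ZX.*-comm _ _))))

-- Self-reciprocity would make `D - n₁` an exponent `x`. The relation `n₁ + x = D` is not formal,
-- because `n₁` is not the last exponent of a tuple of length at least 2. This keeps the
-- noncyclotomic part of `F` from being constant.
not-reciprocal : ∀ {p k N} (ns : Vec ℕ (suc (suc k))) → Generic p ns → IncreasingIn[1, N ] ns →
                 ¬ SelfReciprocal (S (exponents ns))
not-reciprocal {k = k} ns gen inc (selfReciprocal {d} M ε sq r) with Monic-unique M
    (GenericTuple.MonicF ns gen inc)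
... | ≡.refl = contradiction′ (∈exponents (co-S≢0 es nz))
  where
  open GenericTuple ns gen inc
  n₁ = lookup ns Fin.zero
  n₁∈ : n₁ ∈ es
  n₁∈ = val∈ ns (just Fin.zero)
  n₁≤D : n₁ ≤ D
  n₁≤D = All.lookup es≤D n₁∈
  nz : co F₀ (D ℕ.∸ n₁) ≢ + 0
  nz z with ≡.trans (≡.sym sq) (≡.cong (ε ℤ.*_) ε≡0)
    where
    ε≡0 : ε ≡ + 0
    ε≡0 = ≡.trans (≡.sym (ℤ.*-identityʳ ε)) (≡.trans (≡.cong (ε ℤ.*_) (≡.sym (∈⇒1 n₁∈)))
      (≡.trans (≡.sym (co-C⊗ ε F₀ n₁)) (≡.trans (≡.sym (at r n₁)) (≡.trans (co-rev D F₀ n₁ n₁≤D) z))))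
  ... | e with ≡.trans e (ℤ.*-zeroʳ ε)
  ...   | ()
  contradiction′ : ∃ (λ x → D ℕ.∸ n₁ ≡ val ns x) → ⊥
  contradiction′ (x , e) with ≡.trans (≡.sym (generic-sums≡ {ns = ns} gen (just Fin.zero ∷ x ∷ [])
      (just (fromℕ (suc k)) ∷ []) (s≤s (s≤s z≤n)) (s≤s z≤n)
      (≡.trans (≡.cong (λ z → n₁ ℕ.+ (z ℕ.+ 0)) (≡.sym e))
          (≡.trans (≡.cong (n₁ ℕ.+_) (ℕ.+-identityʳ _))
              (≡.trans (ℕ.m+[n∸m]≡n n₁≤D) (≡.sym (ℕ.+-identityʳ D))))) Fin.zero)) ≡.refl
  ... | ()

raw⇒∣ₚ : ∀ {f g} → f ℤ[X].∣ g → f ∣ₚ g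
raw⇒∣ₚ {f} (q RawMagma., e) = divides q (≋-trans (≡⇒≋ (≡.sym (⊗-def q f))) (mk≋ e))

∣ₚ⇒raw : ∀ {f g} → f ∣ₚ g → f ℤ[X].∣ g
∣ₚ⇒raw {f} (divides q e) = q RawMagma., at (≋-trans (≡⇒≋ (⊗-def q f)) e)

cyclotomic⇒Φ′ : ∀ c → Cyclotomic c → ∃ λ n → c ≋ Φ′ (suc n)
cyclotomic⇒Φ′ c (suc n , _ , e) = n , ≋-trans (mk≋ e) (≡⇒≋ (Φ′-def (suc n)))

Φ′-cyclotomic : ∀ n → Cyclotomic (Φ′ (suc n))
Φ′-cyclotomic n = suc n , _ , at (≡⇒≋ (≡.sym (Φ′-def (suc n))))

prod-selfReciprocal : ∀ {cs} → All Cyclotomic cs → SelfReciprocal (ℤ[X].prod cs)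
prod-selfReciprocal []                  = SelfReciprocal-resp (≡⇒≋ (≡.sym 𝟙-def)) SelfReciprocal-𝟙
prod-selfReciprocal {c ∷ cs} (cyc ∷ all) = let (n , e) = cyclotomic⇒Φ′ c cyc in
  SelfReciprocal-resp (≡⇒≋ (≡.sym (⊗-def c (ℤ[X].prod cs))))
    (SelfReciprocal-⊗ (SelfReciprocal-resp (≋-sym e) (SelfReciprocal-Φ n)) (prod-selfReciprocal all))

record Removed (f g : Pol) : Set where
  field
    c    : Pol
    rec  : SelfReciprocal c
    f≋   : f ≋ c ⊗ g
    noΦ  : NoCyclotomicFactor g

removed : ∀ {f g} → RemovedOfCyclotomicFactors f g → Removed f g
removed {f} {g} r = record
  { c = ℤ[X].prod cs ; rec = prod-selfReciprocal cyclotomic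
  ; f≋ = ≋-trans (mk≋ quotient) (≡⇒≋ (⊗-def (ℤ[X].prod cs) g))
  ; noΦ = λ n d → exhausted (Φ′ (suc n)) (Φ′-cyclotomic n) (∣ₚ⇒raw d) }
  where
  open RemovedOfCyclotomicFactors r

-- Cyclotomic factors are split off one at a time, each lowering the degree because `φ` is positive.
-- The double negation pays for deciding whether any `Φ′ (suc m)`, with `m` unbounded, divides `f`.
removal-exists : ∀ n f → Monic n f → ¬ ¬ ∃ (RemovedOfCyclotomicFactors f)
removal-exists = <-rec (λ n → ∀ f → Monic n f → ¬ ¬ ∃ (RemovedOfCyclotomicFactors f)) step
  where
  step : ∀ n → (∀ {m} → m < n → ∀ f → Monic m f → ¬ ¬ ∃ (RemovedOfCyclotomicFactors f)) →
         ∀ f → Monic n f → ¬ ¬ ∃ (RemovedOfCyclotomicFactors f)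
  step n ih f M k = ¬¬-excluded-middle cases
    where
    multiply : ∀ m {q g} → q ⊗ Φ′ (suc m) ≋ f → RemovedOfCyclotomicFactors q g → RemovedOfCyclotomicFactors
        f g
    multiply m {q} {g} e r = record
      { cs = Φ′ (suc m) ∷ R.cs ; cyclotomic = Φ′-cyclotomic m ∷ R.cyclotomic
      ; quotient = at (≋-trans (≋-sym e) (≋-trans (⊗-congʳ
          (≋-trans (mk≋ R.quotient) (≡⇒≋ (⊗-def (ℤ[X].prod R.cs) g))))
          (≋-trans (solve 3 (λ c g p → c :* g :* p := p :* c :* g) ≋-refl (ℤ[X].prod R.cs) g (Φ′ (suc m)))
            (≡⇒≋ (≡.trans (≡.cong (_⊗ g) (≡.sym (⊗-def (Φ′ (suc m)) (ℤ[X].prod R.cs))))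
                (≡.sym (⊗-def _ g)))))))
      ; exhausted = R.exhausted }
      where
      module R = RemovedOfCyclotomicFactors r
    cases : Dec (∃ λ m → Φ′ (suc m) ∣ₚ f) → ⊥
    cases (no none) = k (f , record
      { cs = [] ; cyclotomic = []
      ; quotient = at (≋-sym (≋-trans (≡⇒≋ (≡.trans (⊗-def ℤ[X].1ₚ f) (≡.cong (_⊗ f) 𝟙-def)))
          (ZX.*-identityˡ f)))
      ; exhausted = λ c cyc d → none (proj₁ (cyclotomic⇒Φ′ c cyc) , ∣ₚ-respˡ (proj₂ (cyclotomic⇒Φ′ c cyc))
          (raw⇒∣ₚ d)) })
    cases (yes (m , divides q e)) = let (d , Mq , eq) = Monic-quotient (Monic-Φ m) (Monic-resp (≋-sym e) M) in
      ih (≡.subst (d <_) eq (ℕ.m<m+n d (φ≥1 m))) q Mq λ (g , r) → k (g , multiply m e r)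

-- Factorisation over ℚ

module Q = PolyRing ℚ.+-*-commutativeRing
open Q using () renaming (_≋_ to _≋ᵠ_; mk≋ to mk≋ᵠ)

opaque
  ι : ℤ → ℚ
  ι a = a ℚ./ 1

  ι-def : ∀ a → a ℚ./ 1 ≡ ι a
  ι-def a = ≡.refl

  ι-fraction : ∀ a → toℚᵘ (ι a) ≃ mkℚᵘ a 0
  ι-fraction a = ℚ.toℚᵘ-fromℚᵘ (mkℚᵘ a 0)

  ι-0 : ι (+ 0) ≡ 0ℚ
  ι-0 = ≡.refl

  ι-1 : ι (+ 1) ≡ 1ℚ
  ι-1 = ≡.refl

ι-injective : ∀ {a b} → ι a ≡ ι b → a ≡ b
ι-injective {a} {b} e with ℚᵘ.≃-trans (ℚᵘ.≃-sym (ι-fraction a))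
    (ℚᵘ.≃-trans (ℚᵘ.≃-reflexive (≡.cong toℚᵘ e)) (ι-fraction b))
... | *≡* eq = ≡.trans (≡.sym (ℤ.*-identityʳ a)) (≡.trans eq (ℤ.*-identityʳ b))

ι-+ : ∀ a b → ι (a ℤ.+ b) ≡ ι a ℚ.+ ι b
ι-+ a b = ℚ.toℚᵘ-injective (ℚᵘ.≃-trans (ι-fraction (a ℤ.+ b)) (ℚᵘ.≃-trans
  (*≡* (≡.cong₂ (λ x y → (x ℤ.+ y) ℤ.* + 1) (≡.sym (ℤ.*-identityʳ a)) (≡.sym (ℤ.*-identityʳ b))))
  (ℚᵘ.≃-trans (ℚᵘ.+-cong (ℚᵘ.≃-sym (ι-fraction a)) (ℚᵘ.≃-sym (ι-fraction b)))
      (ℚᵘ.≃-sym (ℚ.toℚᵘ-homo-+ (ι a) (ι b))))))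

ι-* : ∀ a b → ι (a ℤ.* b) ≡ ι a ℚ.* ι b
ι-* a b = ℚ.toℚᵘ-injective (ℚᵘ.≃-trans (ι-fraction (a ℤ.* b)) (ℚᵘ.≃-trans (*≡* ≡.refl)
  (ℚᵘ.≃-trans (ℚᵘ.*-cong (ℚᵘ.≃-sym (ι-fraction a)) (ℚᵘ.≃-sym (ι-fraction b)))
      (ℚᵘ.≃-sym (ℚ.toℚᵘ-homo-* (ι a) (ι b))))))

ι-denominator : ∀ q → ι (↧ q) ℚ.* q ≡ ι (↥ q)
ι-denominator q = ℚ.toℚᵘ-injective (ℚᵘ.≃-trans (ℚ.toℚᵘ-homo-* (ι (↧ q)) q) (ℚᵘ.≃-trans
  (ℚᵘ.*-cong (ι-fraction (↧ q)) ℚᵘ.≃-refl) (ℚᵘ.≃-trans (lemma q) (ℚᵘ.≃-sym (ι-fraction (↥ q))))))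
  where
  lemma : ∀ q → mkℚᵘ (↧ q) 0 ℚᵘ.* toℚᵘ q ≃ mkℚᵘ (↥ q) 0
  lemma (ℚ.mkℚ n d c) = *≡* (≡.trans (ℤ.*-identityʳ _)
      (≡.trans (ℤ.*-comm (+ suc d) n) (≡.cong (λ k → n ℤ.* + suc k) (≡.sym (ℕ.+-identityʳ d)))))

coeff-toℚ : ∀ f i → ℚ[X].coeff (toℚ[X] f) i ≡ ι (co f i)
coeff-toℚ []      i       = ≡.sym ι-0
coeff-toℚ (a ∷ f) zero    = ι-def a
coeff-toℚ (a ∷ f) (suc i) = coeff-toℚ f i

toℚ-⊗ : ∀ f g → toℚ[X] (f ⊗ g) ≋ᵠ toℚ[X] f ℚ[X].⊛ toℚ[X] g
toℚ-⊗ []      g = mk≋ᵠ λ i → ≡.trans (coeff-toℚ ([] ⊗ g) i)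
    (≡.trans (≡.cong ι (≡.trans (at (≋-trans (⊗-congʳ (≡⇒≋ 𝟘-def)) (ZX.zeroˡ g)) i) (co-𝟘 i))) ι-0)
toℚ-⊗ (a ∷ f) g = mk≋ᵠ λ i → ≡.trans (coeff-toℚ ((a ∷ f) ⊗ g) i) (go i)
  where
  go : ∀ i → ι (co ((a ∷ f) ⊗ g) i) ≡ ℚ[X].coeff (toℚ[X] (a ∷ f) ℚ[X].⊛ toℚ[X] g) i
  go zero = ≡.trans (≡.cong ι (co-⊗-0 (a ∷ f) g)) (≡.trans (ι-* a (co g 0))
      (≡.sym (≡.trans (Q.coeff-⊛-0 (toℚ[X] (a ∷ f)) (toℚ[X] g))
    (≡.cong₂ ℚ._*_ (ι-def a) (coeff-toℚ g 0)))))
  go (suc i) = ≡.trans (≡.cong ι (≡.trans (≡.cong (λ h → co h (suc i)) (≡.sym (⊗-def (a ∷ f) g)))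
      (≡.trans (Z.coeff-⊛-suc a f g i) (≡.cong (λ h → a ℤ.* co g (suc i) ℤ.+ co h i) (⊗-def f g)))))
    (≡.trans (ι-+ (a ℤ.* co g (suc i)) (co (f ⊗ g) i))
        (≡.sym (≡.trans (Q.coeff-⊛-suc (a ℚ./ 1) (toℚ[X] f) (toℚ[X] g) i)
      (≡.cong₂ ℚ._+_ (≡.trans (≡.cong₂ ℚ._*_ (ι-def a) (coeff-toℚ g (suc i)))
          (≡.sym (ι-* a (co g (suc i)))))
        (≡.trans (≡.sym (Q.at (toℚ-⊗ f g) i)) (coeff-toℚ (f ⊗ g) i))))))

record Cleared (u : ℚ[X].Poly) : Set where
  field
    d     : ℤ
    d≢0   : d ≢ + 0
    u′    : Pol
    clear : ∀ i → ι d ℚ.* ℚ[X].coeff u i ≡ ι (co u′ i)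

clearDenominators : ∀ u → Cleared u
clearDenominators [] = record { d = + 1 ; d≢0 = λ () ; u′ = 𝟘 ; clear = λ i → ≡.trans (ℚ.*-zeroʳ (ι (+ 1)))
    (≡.trans (≡.sym ι-0) (≡.cong ι (≡.sym (co-𝟘 i)))) }
clearDenominators (q ∷ u) = record
  { d = ↧ q ℤ.* d ; d≢0 = i*j≢0 {↧ q} (λ ()) d≢0 ; u′ = ↥ q ℤ.* d ∷ C (↧ q) ⊗ u′ ; clear = clear′ }
  where
  open Cleared (clearDenominators u)
  clear′ : ∀ i → ι (↧ q ℤ.* d) ℚ.* ℚ[X].coeff (q ∷ u) i ≡ ι (co (↥ q ℤ.* d ∷ C (↧ q) ⊗ u′) i)
  clear′ zero = ≡.trans (≡.cong (ℚ._* q) (≡.trans (≡.cong ι (ℤ.*-comm (↧ q) d)) (ι-* d (↧ q))))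
      (≡.trans (ℚ.*-assoc (ι d) (ι (↧ q)) q)
    (≡.trans (≡.cong (ι d ℚ.*_) (ι-denominator q)) (≡.trans (≡.sym (ι-* d (↥ q)))
        (≡.cong ι (ℤ.*-comm d (↥ q))))))
  clear′ (suc i) = ≡.trans (≡.cong (ℚ._* ℚ[X].coeff u i) (ι-* (↧ q) d))
      (≡.trans (ℚ.*-assoc (ι (↧ q)) (ι d) _)
    (≡.trans (≡.cong (ι (↧ q) ℚ.*_) (clear i)) (≡.trans (≡.sym (ι-* (↧ q) (co u′ i)))
        (≡.cong ι (≡.sym (co-C⊗ (↧ q) u′ i))))))

constant-unit : ∀ {u} (cl : Cleared u) {c} → c ≢ + 0 → Cleared.u′ cl ≋ C c → u ℚ[X].∣ ℚ[X].1ₚ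
constant-unit {u} cl {c} c≢0 e = (r ∷ []) RawMagma., λ i → ≡.trans (coeffs i) (value i)
  where
  open Cleared cl
  instance
    ιc-nonZero : ℚ.NonZero (ι c)
    ιc-nonZero = ℚ.≢-nonZero (λ z → c≢0 (ι-injective (≡.trans z (≡.sym ι-0))))
  r : ℚ
  r = ℚ.1/ ι c ℚ.* ι d
  coeffs : ∀ i → ℚ[X].coeff ((r ∷ []) ℚ[X].⊛ u) i ≡ r ℚ.* ℚ[X].coeff u i
  coeffs i = ≡.trans (Q.coeff-+ (r ℚ[X].· u) (0ℚ ∷ []) i)
      (≡.trans (≡.cong₂ ℚ._+_ (Q.coeff-· r u i) (Q.at (Q.0∷[]≋[] {0ℚ} ≡.refl) i)) (ℚ.+-identityʳ _))
  value : ∀ i → r ℚ.* ℚ[X].coeff u i ≡ ℚ[X].coeff ℚ[X].1ₚ i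
  value i = ≡.trans (ℚ.*-assoc (ℚ.1/ ι c) (ι d) (ℚ[X].coeff u i))
      (≡.trans (≡.cong (ℚ.1/ ι c ℚ.*_) (≡.trans (clear i) (≡.cong ι (at e i)))) (go i))
    where
    go : ∀ i → ℚ.1/ ι c ℚ.* ι (co (C c) i) ≡ ℚ[X].coeff ℚ[X].1ₚ i
    go zero    = ≡.trans (≡.cong (λ z → ℚ.1/ ι c ℚ.* ι z) (co-C-0 c)) (ℚ.*-inverseˡ (ι c))
    go (suc i) = ≡.trans (≡.cong (λ z → ℚ.1/ ι c ℚ.* ι z) (co-C-suc c i))
        (≡.trans (≡.cong (ℚ.1/ ι c ℚ.*_) ι-0) (ℚ.*-zeroʳ (ℚ.1/ ι c)))

record NontrivialFactors (g : Pol) : Set where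
  field
    {d e} : ℕ
    {u v} : Pol
    Mu    : Monic (suc d) u
    Mv    : Monic (suc e) v
    g≋    : g ≋ u ⊗ v

-- Clearing denominators and Gauss's lemma turn `x` and `y` into monic integral factors of `g`, up
-- to nonzero constants. A factor of degree 0 makes `x` or `y` a constant, hence a unit over ℚ.
rational-split : ∀ {n g} → Monic n g → ∀ x y → toℚ[X] g ℚ[X].≈ x ℚ[X].⊛ y →
                 x ℚ[X].∣ ℚ[X].1ₚ ⊎ y ℚ[X].∣ ℚ[X].1ₚ ⊎ NontrivialFactors g
rational-split {n} {g} Mg x y e = cases (MF.d) (MF.e) MF.Mf MF.Mg
  where
  cx = clearDenominators x
  cy = clearDenominators y
  module CX = Cleared cx
  module CY = Cleared cy
  clear≋ : ∀ {u} (cl : Cleared u) → toℚ[X] (Cleared.u′ cl) ≋ᵠ ι (Cleared.d cl) ℚ[X].· u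
  clear≋ {u} cl = mk≋ᵠ λ i → ≡.trans (coeff-toℚ u′ i) (≡.sym (≡.trans (Q.coeff-· (ι d) u i) (clear i)))
    where
    open Cleared cl
  product≋ : toℚ[X] (CX.u′ ⊗ CY.u′) ≋ᵠ ι (CX.d ℤ.* CY.d) ℚ[X].· toℚ[X] g
  product≋ = Q.≋-trans (toℚ-⊗ CX.u′ CY.u′) (Q.≋-trans (Q.⊛-cong (clear≋ cx) (clear≋ cy))
    (Q.≋-trans (Q.·-⊛ (ι CX.d) x (ι CY.d ℚ[X].· y)) (Q.≋-trans (Q.·-cong {ι CX.d} ≡.refl
      (Q.≋-trans (Q.⊛-comm x (ι CY.d ℚ[X].· y)) (Q.≋-trans (Q.·-⊛ (ι CY.d) y x)
          (Q.·-cong {ι CY.d} ≡.refl (Q.≋-trans (Q.⊛-comm y x) (Q.≋-sym (mk≋ᵠ e)))))))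
      (Q.≋-trans (Q.≋-sym (Q.·-assoc (ι CX.d) (ι CY.d) (toℚ[X] g)))
          (Q.·-cong (≡.sym (ι-* CX.d CY.d)) (Q.≋-refl {toℚ[X] g}))))))
  integral : C (CX.d ℤ.* CY.d) ⊗ g ≋ CX.u′ ⊗ CY.u′
  integral .at i = ι-injective (≡.trans (≡.cong ι (co-C⊗ (CX.d ℤ.* CY.d) g i))
      (≡.trans (ι-* (CX.d ℤ.* CY.d) (co g i))
    (≡.trans (≡.cong (ι (CX.d ℤ.* CY.d) ℚ.*_) (≡.sym (coeff-toℚ g i)))
        (≡.trans (≡.sym (Q.coeff-· (ι (CX.d ℤ.* CY.d)) (toℚ[X] g) i))
      (≡.trans (≡.sym (Q.at product≋ i)) (coeff-toℚ (CX.u′ ⊗ CY.u′) i))))))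
  module G = ScaledFactorisation (gauss g CX.u′ CY.u′ (i*j≢0 CX.d≢0 CY.d≢0) integral)
  module MF = MonicFactors (monicFactors G.w′ G.t′ (Monic-resp G.g≋ Mg))
  σ≢0 : MF.σ ≢ + 0
  σ≢0 z with ≡.trans (≡.sym MF.σ²≡1) (≡.cong (ℤ._* MF.σ) z)
  ... | ()
  unit : ∀ {u w a} (cl : Cleared u) → a ≢ + 0 → Cleared.u′ cl ≋ C a ⊗ w → Monic 0 (C MF.σ ⊗ w) → u ℚ[X].∣
      ℚ[X].1ₚ
  unit {u} {w} {a} cl a≢0 ew M0 = constant-unit cl (i*j≢0 a≢0 σ≢0) (begin
    Cleared.u′ cl                    ≈⟨ ew ⟩
    C a ⊗ w                          ≈⟨ ⊗-congˡ (σσ-cancel MF.σ²≡1 w) ⟩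
    C a ⊗ (C MF.σ ⊗ (C MF.σ ⊗ w))    ≈⟨ ⊗-congˡ (⊗-congˡ (≋-trans (Monic0⇒≋1 M0) (≡⇒≋ 𝟙-def))) ⟩
    C a ⊗ (C MF.σ ⊗ 𝟙)               ≈⟨ ⊗-congˡ (ZX.*-identityʳ _) ⟩
    C a ⊗ C MF.σ                     ≈⟨ C-* a MF.σ ⟨
    C (a ℤ.* MF.σ)                   ∎)
  cases : ∀ d e → Monic d (C MF.σ ⊗ G.w′) → Monic e (C MF.σ ⊗ G.t′) →
          x ℚ[X].∣ ℚ[X].1ₚ ⊎ y ℚ[X].∣ ℚ[X].1ₚ ⊎ NontrivialFactors g
  cases zero    _       M _  = inj₁ (unit cx G.a≢0 G.w≋ M)
  cases (suc d) zero    _ M  = inj₂ (inj₁ (unit cy G.b≢0 G.t≋ M))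
  cases (suc d) (suc e) M M′ = inj₂ (inj₂ (record { Mu = M ; Mv = M′ ; g≋ = ≋-trans G.g≋ MF.fg≋ }))

toℚ-Monic : ∀ {n g} → Monic n g → Q.Monic n (toℚ[X] g)
toℚ-Monic {n} {g} M = Q.monic (≡.trans (coeff-toℚ g n) (≡.trans (≡.cong ι (lead M)) ι-1))
  λ i l → ≡.trans (coeff-toℚ g i) (≡.trans (≡.cong ι (above M i l)) ι-0)

rational-nonunit : ∀ {n g} → Monic (suc n) g → ¬ toℚ[X] g ℚ[X].∣ ℚ[X].1ₚ
rational-nonunit {n} {g} M (q RawMagma., e) with ≡.trans (≡.sym (e 0)) (Q.at (Q.⊛-zeroˡ (toℚ[X] g)
    (Q.monic-low (toℚ-Monic M) q (λ { (suc i) _ → e (suc i) }))) 0)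
... | ()

module _ {p k N} (ns : Vec ℕ (suc (suc k))) (gen : Generic p ns) (inc : IncreasingIn[1, N ] ns) where
  open GenericTuple ns gen inc
  open Factorisations ns gen inc

  private
    module Part {g} (r : RemovedOfCyclotomicFactors (F ns) g) where
      open Removed (removed r) public
      module Rec = SelfReciprocal rec
      F≋ : F₀ ≋ c ⊗ g
      F≋ = ≋-trans (≋-sym (F≋S ns)) f≋
      Mg : ∃ λ n → Monic n g × n ℕ.+ Rec.d ≡ D
      Mg = Monic-quotient Rec.M (Monic-resp (≋-trans F≋ (ZX.*-comm c g)) MonicF)
      factors : NontrivialFactors g → CommonFactor ns
      factors f = commonFactor Rec.M Mu Mv (≋-trans F≋ (⊗-congˡ g≋)) (λ n d → noΦ n (∣ₚ-respʳ (≋-sym g≋) d))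
        where
        open NontrivialFactors f
      nonunit : ¬ toℚ[X] g ℚ[X].∣ ℚ[X].1ₚ
      nonunit with Mg
      -- If the noncyclotomic part were 1, then `F₀` would equal the self-reciprocal product `c`.
      ... | zero , M , _ = λ _ → not-reciprocal ns gen inc (SelfReciprocal-resp (≋-sym (≋-trans F≋
              (≋-trans (⊗-congˡ (≋-trans (Monic0⇒≋1 M) (≡⇒≋ 𝟙-def))) (ZX.*-identityʳ c)))) rec)
      ... | suc n , M , _ = rational-nonunit M

  reducible⇒commonFactor : ReducibleNoncyclotomicPart ns → CommonFactor ns
  reducible⇒commonFactor (g , r , _ , x , y , e , x∤1 , y∤1) with rational-split (proj₁ (proj₂ (Part.Mg r)))
      x y e
  ... | inj₁ x∣1        = ⊥-elim (x∤1 x∣1)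
  ... | inj₂ (inj₁ y∣1) = ⊥-elim (y∤1 y∣1)
  ... | inj₂ (inj₂ f)   = Part.factors r f

  notIrreducible⇒commonFactor : ¬ IrreducibleNoncyclotomicPart ns → ¬ ¬ CommonFactor ns
  notIrreducible⇒commonFactor ¬irr ¬cf = removal-exists D (F ns) (Monic-resp (≋-sym (F≋S ns)) MonicF) λ
      (g , r) →
    ¬irr (g , r , mkIrred (Part.nonunit r) λ {x} {y} e →
      Sum.map₂ Sum.[ (λ h → h) , (λ f → ⊥-elim (¬cf (Part.factors r f))) ]
          (rational-split (proj₁ (proj₂ (Part.Mg r))) x y e))

-- Common factors for a fixed tail of exponents

-- `Y (suc n)` is a product of cyclotomic polynomials. By their irreducibility, each that does not
-- divide `h` is coprime to it.
coprime-Y : ∀ {h} → NoCyclotomicFactor h → ∀ n → Coprime h (Y (suc n))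
coprime-Y {h} noΦ n = Coprime-resp (≋-sym (CyclotomicFactorisation.Y≋Π (cyclotomicFactorisation n)))
  (Π-closed (Coprime h) Coprime-resp (Coprime-𝟙ʳ h) Coprime-⊗ʳ (suc n) (suc n) λ d _ _ → coprime d
      (Φ-irreducible d h))
  where
  coprime : ∀ d → Φ′ (suc d) ∣ₚ h ⊎ Coprime (Φ′ (suc d)) h → Coprime h (Φ′ (suc d))
  coprime d (inj₁ dv) = ⊥-elim (noΦ d dv)
  coprime d (inj₂ cp) = Coprime-sym cp

-- Stronger than `Coprime`: the Bézout constant is 1, so `f` stays invertible modulo `h` after a
-- further reduction modulo `p`.
record UnitMod (h f : Pol) : Set where
  constructor unitMod
  field
    u z : Pol
    eqn : u ⊗ h ⊕ z ⊗ f ≋ 𝟙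

UnitMod-⊗ : ∀ {h f g} → UnitMod h f → UnitMod h g → UnitMod h (f ⊗ g)
UnitMod-⊗ {h} {f} {g} (unitMod u z e) (unitMod u′ z′ e′) =
  unitMod (u ⊗ u′ ⊗ h ⊕ u ⊗ z′ ⊗ g ⊕ z ⊗ f ⊗ u′) (z ⊗ z′) (begin
    (u ⊗ u′ ⊗ h ⊕ u ⊗ z′ ⊗ g ⊕ z ⊗ f ⊗ u′) ⊗ h ⊕ z ⊗ z′ ⊗ (f ⊗ g)
      ≈⟨ solve 7 (λ u v u′ v′ f g h →
           (u :* u′ :* f :+ u :* v′ :* h :+ v :* g :* u′) :* f :+ v :* v′ :* (g :* h)
           := (u :* f :+ v :* g) :* (u′ :* f :+ v′ :* h)) ≋-refl u z u′ z′ h f g ⟩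
    (u ⊗ h ⊕ z ⊗ f) ⊗ (u′ ⊗ h ⊕ z′ ⊗ g)  ≈⟨ ⊗-cong e e′ ⟩
    𝟙 ⊗ 𝟙                                ≈⟨ ZX.*-identityˡ 𝟙 ⟩
    𝟙                                    ∎)

UnitMod⇒Coprime : ∀ {h f} → UnitMod h f → Coprime h f
UnitMod⇒Coprime (unitMod u z e) = bezout (+ 1) u z (λ ()) e

-- A multiple `1 + X f` of `h` makes `-f` an inverse of `X` modulo `h`.
UnitMod-X1 : ∀ {h} f → co f 0 ≡ + 1 → h ∣ₚ f → UnitMod h (X 1)
UnitMod-X1 []      () _
UnitMod-X1 {h} (.(+ 1) ∷ f) ≡.refl (divides q e) = unitMod q (⊖ f) (begin
  q ⊗ h ⊕ ⊖ f ⊗ X 1              ≈⟨ ⊕-congʳ (≋-trans e (∷-def (+ 1) f)) ⟩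
  𝟙 ⊕ X 1 ⊗ f ⊕ ⊖ f ⊗ X 1        ≈⟨ solve 2 (λ x f → con (+ 1) :+ x :* f :+ :- f :* x := con (+ 1)) ≋-refl
      (X 1) f ⟩
  𝟙                              ∎)

UnitMod-X : ∀ {h} → UnitMod h (X 1) → ∀ n → UnitMod h (X n)
UnitMod-X {h} U zero    = unitMod 𝟘 𝟙 (≋-trans (⊕-cong (ZX.zeroˡ h) (≋-trans (ZX.*-identityˡ _) X-0))
    (ZX.+-identityˡ 𝟙))
UnitMod-X {h} U (suc n) = resp (UnitMod-⊗ U (UnitMod-X U n))
  where
  resp : UnitMod h (X 1 ⊗ X n) → UnitMod h (X (suc n))
  resp (unitMod u z e) = unitMod u z (≋-trans (⊕-congˡ (⊗-congˡ (X-+ 1 n))) e)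

MonicPoly : Set
MonicPoly = ∃ λ d → ∃ (Monic d)

deg : MonicPoly → ℕ
deg (d , _) = d

poly : MonicPoly → Pol
poly (_ , f , _) = f

productM : List MonicPoly → MonicPoly
productM []                  = 0 , 𝟙 , Monic-𝟙
productM ((d , f , M) ∷ fs) = let (e , g , M′) = productM fs in d ℕ.+ e , f ⊗ g , Monic-⊗ M M′

coprime-productM : ∀ {h} fs → All (λ f → Coprime h (poly f)) fs → Coprime h (poly (productM fs))
coprime-productM []       []         = Coprime-𝟙ʳ _
coprime-productM (f ∷ fs) (cp ∷ cps) = Coprime-⊗ʳ cp (coprime-productM fs cps)

productM-∣ : ∀ {P} fs → AllPairs (λ f g → Coprime (poly f) (poly g)) fs → All (λ f → poly f ∣ₚ P) fs → poly
    (productM fs) ∣ₚ P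
productM-∣ {P} [] _ _ = divides P (ZX.*-identityʳ P)
productM-∣ ((d , f , M) ∷ fs) (cp ∷ cps) (dv ∷ dvs) =
  coprime-∣-⊗ M (proj₂ (proj₂ (productM fs))) (coprime-productM fs cp) dv (productM-∣ fs cps dvs)

productM-deg : ∀ T fs → All (λ f → T ≤ deg f) fs → length fs ℕ.* T ≤ deg (productM fs)
productM-deg T []       []       = z≤n
productM-deg T (f ∷ fs) (l ∷ ls) = ℕ.+-mono-≤ l (productM-deg T fs ls)

∣ₚ⇒deg≤ : ∀ {m n f g} → Monic m f → Monic n g → f ∣ₚ g → m ≤ n
∣ₚ⇒deg≤ {m} Mf Mg (divides q e) = let (d , _ , eq) = Monic-quotient Mf (Monic-resp (≋-sym e) Mg) in
  ℕ.≤-trans (ℕ.m≤n+m m d) (ℕ.≤-reflexive eq)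

-- The ideals (v^n, p) and the operators X d/dX - e

record InIdeal (v : Pol) (p : ℤ) (n : ℕ) (f : Pol) : Set where
  constructor inIdeal
  field
    a b : Pol
    eqn : f ≋ v ^ n ⊗ a ⊕ C p ⊗ b

InIdeal-resp : ∀ {v p n f g} → f ≋ g → InIdeal v p n f → InIdeal v p n g
InIdeal-resp e (inIdeal a b e′) = inIdeal a b (≋-trans (≋-sym e) e′)

InIdeal-⊗ : ∀ {v p n f} q → InIdeal v p n f → InIdeal v p n (q ⊗ f)
InIdeal-⊗ {v} {p} {n} q (inIdeal a b e) = inIdeal (q ⊗ a) (q ⊗ b) (≋-trans (⊗-congˡ e)
  (solve 5 (λ q w a c b → q :* (w :* a :+ c :* b) := w :* (q :* a) :+ c :* (q :* b)) ≋-refl q (v ^ n) a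
      (C p) b))

InIdeal-drop : ∀ {v p f} m n → InIdeal v p (m ℕ.+ n) f → InIdeal v p n f
InIdeal-drop {v} {p} m n (inIdeal a b e) = inIdeal (v ^ m ⊗ a) b
    (≋-trans e (⊕-congʳ (≋-trans (⊗-congʳ (^-homo-* v m n))
  (solve 3 (λ x y a → x :* y :* a := y :* (x :* a)) ≋-refl (v ^ m) (v ^ n) a))))

Congruent : ℤ → Pol → Pol → Set
Congruent p h v = ∃ λ r → h ≋ v ⊕ C p ⊗ r

InIdeal-product : ∀ {v p} fs → All (λ f → Congruent p (poly f) v) fs → InIdeal v p (length fs)
    (poly (productM fs))
InIdeal-product {v} {p} []       []             = inIdeal 𝟙 𝟘
  (≋-sym (≋-trans (⊕-cong (ZX.*-identityˡ 𝟙) (ZX.zeroʳ (C p))) (ZX.+-identityʳ 𝟙)))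
InIdeal-product {v} {p} ((d , f , M) ∷ fs) ((r , e) ∷ cs) = go (InIdeal-product fs cs)
  where
  g = poly (productM fs)
  w = v ^ length fs
  go : InIdeal v p (length fs) g → InIdeal v p (suc (length fs)) (f ⊗ g)
  go (inIdeal a b e′) = inIdeal a (r ⊗ w ⊗ a ⊕ v ⊗ b ⊕ C p ⊗ r ⊗ b) (≋-trans (⊗-cong e e′)
    (solve 6 (λ v p r w a b → (v :+ p :* r) :* (w :* a :+ p :* b)
       := v :* w :* a :+ p :* (r :* w :* a :+ v :* b :+ p :* r :* b)) ≋-refl v (C p) r w a b))

θ-power : ∀ v n → ∃ λ w → θ (v ^ suc n) ≋ v ^ n ⊗ w
θ-power v zero    = θ (v ^ 1) , ≋-sym (ZX.*-identityˡ _)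
θ-power v (suc n) = let (w , e) = θ-power v n in θ v ⊕ w , (begin
  θ (v ⊗ v ^ suc n)                           ≈⟨ θ-⊗ v (v ^ suc n) ⟩
  θ v ⊗ (v ⊗ v ^ n) ⊕ v ⊗ θ (v ^ suc n)       ≈⟨ ⊕-congˡ (⊗-congˡ e) ⟩
  θ v ⊗ (v ⊗ v ^ n) ⊕ v ⊗ (v ^ n ⊗ w)         ≈⟨ solve 4
      (λ t v x w → t :* (v :* x) :+ v :* (x :* w) := v :* x :* (t :+ w)) ≋-refl (θ v) v (v ^ n) w ⟩
  v ^ suc n ⊗ (θ v ⊕ w)                       ∎)

-- Annihilates `X^e`. By the product rule it lowers the exponent of `v` in a membership `InIdeal` by
-- only one, and it preserves multiples of `p`.
𝒟 : ℕ → Pol → Pol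
𝒟 e f = θ f ⊕ ⊖ (C (+ e) ⊗ f)

InIdeal-𝒟 : ∀ {v p n f} e → InIdeal v p (suc n) f → InIdeal v p n (𝒟 e f)
InIdeal-𝒟 {v} {p} {n} {f} e (inIdeal a b eq) = let (w , ew) = θ-power v n in
  inIdeal (w ⊗ a ⊕ v ⊗ θ a ⊕ ⊖ (C (+ e) ⊗ v ⊗ a)) (θ b ⊕ ⊖ (C (+ e) ⊗ b)) (begin
    θ f ⊕ ⊖ (C (+ e) ⊗ f)    ≈⟨ ⊕-cong (θ-cong eq) (⊖-cong (⊗-congˡ eq)) ⟩
    θ (v ^ suc n ⊗ a ⊕ C p ⊗ b) ⊕ ⊖ (C (+ e) ⊗ (v ^ suc n ⊗ a ⊕ C p ⊗ b))
      ≈⟨ ⊕-congʳ (≋-trans (θ-⊕ _ _) (⊕-cong (≋-trans (θ-⊗ (v ^ suc n) a) (⊕-congʳ (⊗-congʳ ew)))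
          (θ-C⊗ p b))) ⟩
    v ^ n ⊗ w ⊗ a ⊕ v ⊗ v ^ n ⊗ θ a ⊕ C p ⊗ θ b ⊕ ⊖ (C (+ e) ⊗ (v ⊗ v ^ n ⊗ a ⊕ C p ⊗ b))
      ≈⟨ solve 9 (λ x w a v a′ p b′ e b → x :* w :* a :+ v :* x :* a′ :+ p :* b′ :+ :-
          (e :* (v :* x :* a :+ p :* b))
           := x :* (w :* a :+ v :* a′ :+ :- (e :* v :* a)) :+ p :* (b′ :+ :- (e :* b))) ≋-refl
           (v ^ n) w a v (θ a) (C p) (θ b) (C (+ e)) b ⟩
    v ^ n ⊗ (w ⊗ a ⊕ v ⊗ θ a ⊕ ⊖ (C (+ e) ⊗ v ⊗ a)) ⊕ C p ⊗ (θ b ⊕ ⊖ (C (+ e) ⊗ b)) ∎)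

Δ : List ℕ → Pol → Pol
Δ []       f = f
Δ (e ∷ es) f = Δ es (𝒟 e f)

InIdeal-Δ : ∀ {v p n f} es → InIdeal v p (length es ℕ.+ n) f → InIdeal v p n (Δ es f)
InIdeal-Δ []       i = i
InIdeal-Δ (e ∷ es) i = InIdeal-Δ es (InIdeal-𝒟 e i)

𝒟-cong : ∀ e {f g} → f ≋ g → 𝒟 e f ≋ 𝒟 e g
𝒟-cong e h = ⊕-cong (θ-cong h) (⊖-cong (⊗-congˡ h))

𝒟-⊕ : ∀ e f g → 𝒟 e (f ⊕ g) ≋ 𝒟 e f ⊕ 𝒟 e g
𝒟-⊕ e f g = ≋-trans (⊕-congʳ (θ-⊕ f g)) (solve 5 (λ a b e f g → (a :+ b) :+ :- (e :* (f :+ g)) :=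
    (a :+ :- (e :* f)) :+ (b :+ :- (e :* g)))
  ≋-refl (θ f) (θ g) (C (+ e)) f g)

𝒟-C⊗ : ∀ e c f → 𝒟 e (C c ⊗ f) ≋ C c ⊗ 𝒟 e f
𝒟-C⊗ e c f = ≋-trans (⊕-congʳ (θ-C⊗ c f)) (solve 4 (λ c t e f → c :* t :+ :- (e :* (c :* f)) := c :*
    (t :+ :- (e :* f))) ≋-refl (C c) (θ f) (C (+ e)) f)

𝒟-X : ∀ e j → 𝒟 e (X j) ≋ C (+ j ℤ.- + e) ⊗ X j
𝒟-X e j = ≋-trans (⊕-congʳ (θ-X j)) (≋-trans (solve 3 (λ j e x → j :* x :+ :- (e :* x) := (j :+ :- e) :* x)
    ≋-refl (C (+ j)) (C (+ e)) (X j))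
  (⊗-congʳ (≋-sym (≋-trans (C-+ (+ j) (ℤ.- + e)) (⊕-congˡ (C-neg (+ e)))))))

Δ-cong : ∀ es {f g} → f ≋ g → Δ es f ≋ Δ es g
Δ-cong []       h = h
Δ-cong (e ∷ es) h = Δ-cong es (𝒟-cong e h)

Δ-⊕ : ∀ es f g → Δ es (f ⊕ g) ≋ Δ es f ⊕ Δ es g
Δ-⊕ []       f g = ≋-refl
Δ-⊕ (e ∷ es) f g = ≋-trans (Δ-cong es (𝒟-⊕ e f g)) (Δ-⊕ es (𝒟 e f) (𝒟 e g))

Δ-C⊗ : ∀ es c f → Δ es (C c ⊗ f) ≋ C c ⊗ Δ es f
Δ-C⊗ []       c f = ≋-refl
Δ-C⊗ (e ∷ es) c f = ≋-trans (Δ-cong es (𝒟-C⊗ e c f)) (Δ-C⊗ es c (𝒟 e f))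

-- The eigenvalue of `Δ es` at `X^j`: zero if `j` is listed, and not divisible by a prime `p` if `j`
-- differs from all listed exponents modulo `p`.
differences : ℕ → List ℕ → ℤ
differences j []       = + 1
differences j (e ∷ es) = (+ j ℤ.- + e) ℤ.* differences j es

Δ-X : ∀ es j → Δ es (X j) ≋ C (differences j es) ⊗ X j
Δ-X []       j = ≋-sym (ZX.*-identityˡ (X j))
Δ-X (e ∷ es) j = ≋-trans (Δ-cong es (𝒟-X e j)) (≋-trans (Δ-C⊗ es (+ j ℤ.- + e) (X j))
    (≋-trans (⊗-congˡ (Δ-X es j))
  (≋-trans (≋-sym (ZX.*-assoc _ _ _)) (⊗-congʳ (≋-sym (C-* (+ j ℤ.- + e) (differences j es)))))))

differences-∈ : ∀ {j es} → j ∈ es → differences j es ≡ + 0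
differences-∈ {j} {.j ∷ es} (here ≡.refl) = ≡.trans (≡.cong (ℤ._* differences j es) (ℤ.+-inverseʳ (+ j)))
    (ℤ.*-zeroˡ (differences j es))
differences-∈ {j} {e ∷ es} (there j∈)     = ≡.trans (≡.cong ((+ j ℤ.- + e) ℤ.*_) (differences-∈ j∈))
    (ℤ.*-zeroʳ (+ j ℤ.- + e))

Δ-X∈ : ∀ {j es} → j ∈ es → Δ es (X j) ≋ 𝟘
Δ-X∈ {j} {es} j∈ = ≋-trans (Δ-X es j) (≋-trans (⊗-congʳ (≋-trans (≡⇒≋ (≡.cong C (differences-∈ j∈))) C-0))
    (ZX.zeroˡ _))

Δ-S : ∀ {es} fs → (∀ {f} → f ∈ fs → f ∈ es) → Δ es (S fs) ≋ 𝟘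
Δ-S {es} []       sub = ≋-trans (Δ-cong es (≋-trans (≋-sym (ZX.zeroˡ 𝟘)) (⊗-congʳ (≋-sym C-0))))
  (≋-trans (Δ-C⊗ es (+ 0) 𝟘) (≋-trans (⊗-congʳ C-0) (ZX.zeroˡ _)))
Δ-S {es} (f ∷ fs) sub = ≋-trans (Δ-⊕ es (X f) (S fs))
  (≋-trans (⊕-cong (Δ-X∈ (sub (here ≡.refl))) (Δ-S fs (λ f∈ → sub (there f∈)))) (ZX.+-identityˡ 𝟘))

prime-∣-* : ∀ {p} → Prime p → ∀ i j → + p ℤ.∣ i ℤ.* j → + p ℤ.∣ i ⊎ + p ℤ.∣ j
prime-∣-* {p} pp i j d = Sum.map ℤ.∣ᵤ⇒∣ ℤ.∣ᵤ⇒∣ (euclidsLemma ∣ i ∣ ∣ j ∣ pp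
    (≡.subst (p ℕ∣_) (ℤ.abs-* i j) (ℤ.∣⇒∣ᵤ d)))

prime-∤-differences : ∀ {p j} → Prime p → ∀ es → (∀ {e} → e ∈ es → ¬ + p ℤ.∣ + j ℤ.- + e) → ¬ + p ℤ.∣
    differences j es
prime-∤-differences pp []       h d = prime∤1 pp (ℤ.∣⇒∣ᵤ d)
prime-∤-differences {p} {j} pp (e ∷ es) h d = Sum.[ h (here ≡.refl) , prime-∤-differences pp es
    (λ e∈ → h (there e∈)) ]
  (prime-∣-* pp (+ j ℤ.- + e) (differences j es) d)

-- Multiplying by an inverse of X^j modulo h turns the hypothesis into c ≡ p ρ modulo h with deg ρ < deg h.
no-multiple : ∀ {p e h v c j} → Monic (suc e) h → Congruent (+ p) h v → UnitMod h (X j) →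
              InIdeal v (+ p) 1 (C c ⊗ X j) → + p ℤ.∣ c
no-multiple {p} {e} {h} {v} {c} {j} M (r , h≋) (unitMod u z uz) (inIdeal a b eq) = go
    (monic-divide M (z ⊗ b′))
  where
  P = C (+ p)
  b′ = b ⊕ ⊖ (r ⊗ a)
  cX≋ : C c ⊗ X j ≋ a ⊗ h ⊕ P ⊗ b′
  cX≋ = begin
    C c ⊗ X j                                 ≈⟨ eq ⟩
    v ^ 1 ⊗ a ⊕ P ⊗ b                         ≈⟨ ⊕-congʳ (⊗-congʳ (ZX.*-identityʳ v)) ⟩
    v ⊗ a ⊕ P ⊗ b                             ≈⟨ solve 5
        (λ v a p b r → v :* a :+ p :* b := a :* (v :+ p :* r) :+ p :* (b :+ :- (r :* a))) ≋-refl v a P b r ⟩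
    a ⊗ (v ⊕ P ⊗ r) ⊕ P ⊗ b′                  ≈⟨ ⊕-congʳ (⊗-congˡ (≋-sym h≋)) ⟩
    a ⊗ h ⊕ P ⊗ b′                            ∎
  c≋ : C c ≋ (C c ⊗ u ⊕ z ⊗ a) ⊗ h ⊕ P ⊗ (z ⊗ b′)
  c≋ = begin
    C c                                       ≈⟨ ZX.*-identityʳ (C c) ⟨
    C c ⊗ 𝟙                                   ≈⟨ ⊗-congˡ uz ⟨
    C c ⊗ (u ⊗ h ⊕ z ⊗ X j)                   ≈⟨ solve 5
        (λ c u h z x → c :* (u :* h :+ z :* x) := c :* u :* h :+ z :* (c :* x)) ≋-refl (C c) u h z (X j) ⟩
    C c ⊗ u ⊗ h ⊕ z ⊗ (C c ⊗ X j)             ≈⟨ ⊕-congˡ (⊗-congˡ cX≋) ⟩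
    C c ⊗ u ⊗ h ⊕ z ⊗ (a ⊗ h ⊕ P ⊗ b′)        ≈⟨ solve 6
        (λ y h z a p b → y :* h :+ z :* (a :* h :+ p :* b) := (y :+ z :* a) :* h :+ p :* (z :* b)) ≋-refl
            (C c ⊗ u) h z a P b′ ⟩
    (C c ⊗ u ⊕ z ⊗ a) ⊗ h ⊕ P ⊗ (z ⊗ b′)      ∎
  go : (∃ λ q → ∃ λ ρ → z ⊗ b′ ≋ q ⊗ h ⊕ ρ × Deg< (suc e) ρ) → + p ℤ.∣ c
  go (q , ρ , e′ , low) = ℤ.divides (co ρ 0) (≡.trans (≡.sym (co-C-0 c))
      (≡.trans (at c≋pρ 0) (≡.trans (co-C⊗ (+ p) ρ 0) (ℤ.*-comm (+ p) (co ρ 0)))))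
    where
    h∣ : h ∣ₚ C c ⊕ ⊖ (P ⊗ ρ)
    h∣ = divides (C c ⊗ u ⊕ z ⊗ a ⊕ P ⊗ q) (begin
      (C c ⊗ u ⊕ z ⊗ a ⊕ P ⊗ q) ⊗ h           ≈⟨ solve 5
          (λ w p q h ρ → (w :+ p :* q) :* h := (w :* h :+ p :* (q :* h :+ ρ)) :+ :- (p :* ρ)) ≋-refl
              (C c ⊗ u ⊕ z ⊗ a) P q h ρ ⟩
      (C c ⊗ u ⊕ z ⊗ a) ⊗ h ⊕ P ⊗ (q ⊗ h ⊕ ρ) ⊕ ⊖ (P ⊗ ρ)
        ≈⟨ ⊕-congʳ (≋-trans (⊕-congˡ (⊗-congˡ (≋-sym e′))) (≋-sym c≋)) ⟩
      C c ⊕ ⊖ (P ⊗ ρ)                         ∎)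
    c≋pρ : C c ≋ P ⊗ ρ
    c≋pρ = x-y≋𝟘⇒x≋y (C c) (P ⊗ ρ) (monic-∣-low M h∣
        (Deg<-⊕ (C c) _ (Deg<-C c) (Deg<-⊖ (P ⊗ ρ) (Deg<-C⊗ (+ p) ρ low))))

module Tail {k : ℕ} (t : Vec ℕ (suc k)) where
  m : ℕ
  m = top t

  A : Pol
  A = S (exponents t)

  P : Pol
  P = A ⊗ rev m A ⊕ ⊖ X m

  F-head : ∀ y → S (exponents (y ∷ t)) ≋ X y ⊕ A
  F-head y = solve 3 (λ o x s → o :+ (x :+ s) := x :+ (o :+ s)) ≋-refl (X 0) (X y) (S (toList t))

  module _ {N y} (inc : IncreasingIn[1, N ] (y ∷ t)) (cf : CommonFactor (y ∷ t)) where
    open CommonFactor cf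

    y≤m : y ≤ m
    y≤m = All.head (≤top {ns = y ∷ t} (proj₂ inc))

    h∣Xy+A : h ∣ₚ X y ⊕ A
    h∣Xy+A = ∣ₚ-respʳ (F-head y) h∣F

    -- Modulo `h`, `A` is `-X^y` and `rev m A` is `-X^(m-y)`. Their product is `X^m`, from which `y`
    -- has disappeared.
    h∣P : h ∣ₚ P
    h∣P = ∣ₚ-respʳ (begin
      (X y ⊕ A) ⊗ rev m A ⊕ ⊖ (X y ⊗ (X (m ℕ.∸ y) ⊕ rev m A))
        ≈⟨ solve 4 (λ x a â x′ → (x :+ a) :* â :+ :- (x :* (x′ :+ â)) := a :* â :+ :- (x :* x′)) ≋-refl
            (X y) A (rev m A) (X (m ℕ.∸ y)) ⟩
      A ⊗ rev m A ⊕ ⊖ (X y ⊗ X (m ℕ.∸ y))   ≈⟨ ⊕-congˡ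
          (⊖-cong (≋-trans (≋-sym (X-+ y (m ℕ.∸ y))) (≡⇒≋ (≡.cong X (ℕ.m+[n∸m]≡n y≤m))))) ⟩
      P ∎) (∣ₚ-⊕ (∣ₚ-⊗ʳ (rev m A) h∣Xy+A) (∣ₚ-⊖ (∣ₚ-⊗ˡ (X y) (∣ₚ-respʳ
        (≋-trans (rev-cong m (F-head y)) (≋-trans (rev-⊕ m (X y) A) (⊕-congʳ (rev-X m y y≤m)))) h∣rev))))

    unitX : ∀ n → UnitMod h (X n)
    unitX = UnitMod-X (UnitMod-X1 (S (exponents (y ∷ t))) co-F h∣F)
      where
      co-F : co (S (exponents (y ∷ t))) 0 ≡ + 1
      co-F with S-bits (exponents-sorted inc) 0
      ... | inj₂ e = e
      ... | inj₁ z with ≡.subst (+ 1 ℤ.≤_) z (co-S∈ {exponents (y ∷ t)} (here ≡.refl))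
      ...   | ℤ.+≤+ ()

  -- The difference of `X^y′ + A` and `X^y + A` is `X^y (X^(y′-y) - 1)` and lies in the ideal of the
  -- two factors. Modulo the first of them `X^y` is invertible, and `coprime-Y` handles the rest.
  coprime-heads< : ∀ {N y y′} → (inc : IncreasingIn[1, N ] (y ∷ t)) → IncreasingIn[1, N ] (y′ ∷ t) →
                   (cf : CommonFactor (y ∷ t)) (cf′ : CommonFactor (y′ ∷ t)) → y < y′ →
                   Coprime (CommonFactor.h cf) (CommonFactor.h cf′)
  coprime-heads< {y = y} {y′} inc inc′ cf cf′ y<y′ = go (ℕ.m≤n⇒∃[o]m+o≡n y<y′)
    where
    go : ∃ (λ o → suc y ℕ.+ o ≡ y′) → Coprime (CommonFactor.h cf) (CommonFactor.h cf′)
    go (o , eq) = Coprime-ideal {a = ⊖ 𝟙} {b = 𝟙} (h∣Xy+A inc cf) (h∣Xy+A inc′ cf′) (begin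
      ⊖ 𝟙 ⊗ (X y ⊕ A) ⊕ 𝟙 ⊗ (X y′ ⊕ A)
        ≈⟨ ⊕-congˡ (⊗-congˡ (⊕-congʳ (≋-trans (≡⇒≋ (≡.cong X (≡.trans (≡.sym eq) (≡.sym (ℕ.+-suc y o)))))
            (X-+ y (suc o))))) ⟩
      ⊖ 𝟙 ⊗ (X y ⊕ A) ⊕ 𝟙 ⊗ (X y ⊗ X (suc o) ⊕ A)
        ≈⟨ solve 3 (λ x z a → :- con (+ 1) :* (x :+ a) :+ con (+ 1) :* (x :* z :+ a) := x :*
            (z :+ :- con (+ 1))) ≋-refl (X y) (X (suc o)) A ⟩
      X y ⊗ Y (suc o) ∎)
      (Coprime-⊗ʳ (UnitMod⇒Coprime (unitX inc cf y)) (coprime-Y (CommonFactor.noΦ cf) o))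

  coprime-heads : ∀ {N y y′} → IncreasingIn[1, N ] (y ∷ t) → IncreasingIn[1, N ] (y′ ∷ t) →
                  (cf : CommonFactor (y ∷ t)) (cf′ : CommonFactor (y′ ∷ t)) → y ≢ y′ →
                  Coprime (CommonFactor.h cf) (CommonFactor.h cf′)
  coprime-heads {y = y} {y′} inc inc′ cf cf′ ne with ℕ.<-cmp y y′
  ... | tri< l _ _ = coprime-heads< inc inc′ cf cf′ l
  ... | tri≈ _ e _ = ⊥-elim (ne e)
  ... | tri> _ _ l = Coprime-sym (coprime-heads< inc′ inc cf′ cf l)

  Monic-P : ∀ {N y} → IncreasingIn[1, N ] (y ∷ t) → Monic (m ℕ.+ m) P
  Monic-P {N} {y} inc = Monic-⊕-low (Monic-⊗ MA MrevA)
      (Deg<-⊖ (X m) (λ i l → above (Monic-X m) i (ℕ.≤-trans (ℕ.m<m+n m 0<m) l)))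
    where
    t-sorted : AllPairs _<_ (exponents t)
    t-sorted with exponents-sorted inc
    ... | (_ ∷ 0<) ∷ _ ∷ rest = 0< ∷ rest
    0<m : 0 < m
    0<m = ℕ.<-≤-trans (proj₁ (VAll.head (proj₁ inc))) (All.head (≤top {ns = y ∷ t} (proj₂ inc)))
    co-A : ∀ {i} → i ∈ exponents t → co A i ≡ + 1
    co-A {i} i∈ with S-bits t-sorted i
    ... | inj₂ e = e
    ... | inj₁ z with ≡.subst (+ 1 ℤ.≤_) z (co-S∈ i∈)
    ...   | ℤ.+≤+ ()
    t≤m : All (_≤ m) (exponents t)
    t≤m = z≤n ∷ All.tail (≤top {ns = y ∷ t} (proj₂ inc))
    degA : Deg< (suc m) A
    degA i l with co A i ℤ.≟ + 0
    ... | yes z = z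
    ... | no nz = ⊥-elim (ℕ.<⇒≱ l (All.lookup t≤m (co-S≢0 (exponents t) nz)))
    MA : Monic m A
    MA = monic (co-A (val∈ t (just (fromℕ k)))) degA
    MrevA : Monic m (rev m A)
    MrevA = monic (≡.trans (co-rev m A m ℕ.≤-refl) (≡.trans (≡.cong (co A) (ℕ.n∸n≡0 m))
        (co-A (here ≡.refl)))) (Deg<-rev m A)

-- Bounding the number of common factors

-- A bound on all duplicate-free lists makes sense without a decision procedure or a known
-- cardinality, and it applies directly to the list inside `HasCardinality`.
AtMost : {A : Set} → (A → Set) → ℕ → Set
AtMost Q B = ∀ xs → Unique xs → All Q xs → length xs ≤ B

AtMost-⊆ : ∀ {A : Set} {Q Q′ : A → Set} {B} → (∀ {x} → Q x → Q′ x) → AtMost Q′ B → AtMost Q B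
AtMost-⊆ sub am xs u qs = am xs u (All.map sub qs)

split-⊎ : ∀ {A : Set} {Q Q′ : A → Set} xs → Unique xs → All (λ x → Q x ⊎ Q′ x) xs →
          ∃ λ ys → ∃ λ zs → (Unique ys × All Q ys × (∀ {y} → y ∈ ys → y ∈ xs)) ×
                            (Unique zs × All Q′ zs × (∀ {z} → z ∈ zs → z ∈ xs)) ×
                            length xs ≡ length ys ℕ.+ length zs
split-⊎ []       []      []       = [] , [] , ([] , [] , λ ()) , ([] , [] , λ ()) , ≡.refl
split-⊎ (x ∷ xs) (n ∷ u) (q ∷ qs) with split-⊎ xs u qs | q
... | ys , zs , (uy , qy , sy) , (uz , qz , sz) , l | inj₁ q₁ =
  x ∷ ys , zs , (All.tabulate (λ y∈ → All.lookup n (sy y∈)) ∷ uy , q₁ ∷ qy , λ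
      { (here e) → here e ; (there y∈) → there (sy y∈) }) ,
  (uz , qz , there ∘ sz) , ≡.cong suc l
... | ys , zs , (uy , qy , sy) , (uz , qz , sz) , l | inj₂ q₂ =
  ys , x ∷ zs , (uy , qy , there ∘ sy) ,
  (All.tabulate (λ z∈ → All.lookup n (sz z∈)) ∷ uz , q₂ ∷ qz , λ
      { (here e) → here e ; (there z∈) → there (sz z∈) }) ,
  ≡.trans (≡.cong suc l) (≡.sym (ℕ.+-suc (length ys) (length zs)))

AtMost-⊎ : ∀ {A : Set} {Q Q′ : A → Set} {B B′} → AtMost Q B → AtMost Q′ B′ → AtMost (λ x → Q x ⊎ Q′ x)
    (B ℕ.+ B′)
AtMost-⊎ am am′ xs u qs = let (ys , zs , (uy , qy , _) , (uz , qz , _) , l) = split-⊎ xs u qs in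
  ℕ.≤-trans (ℕ.≤-reflexive l) (ℕ.+-mono-≤ (am ys uy qy) (am′ zs uz qz))

-- For a given list only finitely many double negations have to be removed, and the conclusion is a
-- decidable inequality.
AtMost-¬¬ : ∀ {A : Set} {Q : A → Set} {B} → AtMost Q B → AtMost (λ x → ¬ ¬ Q x) B
AtMost-¬¬ {Q = Q} {B} am xs u qs with length xs ℕ.≤? B
... | yes l = l
... | no ¬l = ⊥-elim (all xs qs λ qs′ → ¬l (am xs u qs′))
  where
  all : ∀ xs → All (λ x → ¬ ¬ Q x) xs → ¬ ¬ All Q xs
  all []       []       k = k []
  all (x ∷ xs) (q ∷ qs) k = q λ q′ → all xs qs λ qs′ → k (q′ ∷ qs′)

AtMost-fibres : ∀ {A I : Set} {Q : I → A → Set} {B} → (∀ i → AtMost (Q i) B) →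
                ∀ is → AtMost (λ x → ∃ λ i → i ∈ is × Q i x) (length is ℕ.* B)
AtMost-fibres am []       [] _ _  = z≤n
AtMost-fibres am []       (x ∷ _) _ ((_ , () , _) ∷ _)
AtMost-fibres {Q = Q} am (i ∷ is) = AtMost-⊆ locate (AtMost-⊎ (am i) (AtMost-fibres am is))
  where
  locate : ∀ {x} → (∃ λ j → j ∈ i ∷ is × Q j x) → Q i x ⊎ (∃ λ j → j ∈ is × Q j x)
  locate (j , here ≡.refl , q) = inj₁ q
  locate (j , there j∈ , q)    = inj₂ (j , j∈ , q)

AtMost-singleton : ∀ {A : Set} (a : A) → AtMost (_≡ a) 1
AtMost-singleton a []           _               _                    = z≤n
AtMost-singleton a (x ∷ [])     _               _                    = ℕ.≤-refl
AtMost-singleton a (x ∷ y ∷ xs) ((x≢y ∷ _) ∷ _) (≡.refl ∷ ≡.refl ∷ _) = ⊥-elim (x≢y ≡.refl)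

AtMost-∈ : ∀ {A : Set} (ys : List A) → AtMost (_∈ ys) (length ys)
AtMost-∈ ys xs u qs = ℕ.≤-trans (AtMost-fibres AtMost-singleton ys xs u
    (All.map (λ {x} x∈ → x , x∈ , ≡.refl) qs))
  (ℕ.≤-reflexive (ℕ.*-identityʳ (length ys)))

AtMost-map : ∀ {A A′ : Set} {Q : A → Set} {Q′ : A′ → Set} {B} (f : A → A′) → (∀ {x} → Q x → Q′ (f x)) →
             (∀ {x y} → Q x → Q y → f x ≡ f y → x ≡ y) → AtMost Q′ B → AtMost Q B
AtMost-map {Q = Q} {Q′} f q inj am xs u qs = ≡.subst (_≤ _) (List.length-map f xs)
    (am (map f xs) (unique xs u qs) (images xs qs))
  where
  images : ∀ xs → All Q xs → All Q′ (map f xs)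
  images []       []       = []
  images (x ∷ xs) (p ∷ ps) = q p ∷ images xs ps
  fresh : ∀ {x} → Q x → ∀ ys → All (x ≢_) ys → All Q ys → All (f x ≢_) (map f ys)
  fresh p []       []       []        = []
  fresh p (y ∷ ys) (n ∷ ns) (p′ ∷ ps) = (λ e → n (inj p p′ e)) ∷ fresh p ys ns ps
  unique : ∀ xs → Unique xs → All Q xs → Unique (map f xs)
  unique []       []      []       = []
  unique (x ∷ xs) (n ∷ u) (p ∷ ps) = fresh p xs n ps ∷ unique xs u ps

length-cartesianProductWith : ∀ {A B C : Set} (f : A → B → C) xs ys → length (cartesianProductWith f xs ys)
    ≡ length xs ℕ.* length ys
length-cartesianProductWith f []       ys = ≡.refl
length-cartesianProductWith f (x ∷ xs) ys = ≡.trans (List.length-++ (map (f x) ys))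
  (≡.cong₂ ℕ._+_ (List.length-map (f x) ys) (length-cartesianProductWith f xs ys))

module Expansion {k : ℕ} (t₀ : ℕ) (rest : Vec ℕ k) where
  open Tail (t₀ ∷ rest) public

  -- `A = X^t₀ + S a₀` and `rev m A = X^m + S a₁`, so `low` lists the exponents of their product
  -- with one occurrence of `t₀ + m` left out; `others` adds the exponent of `- X^m`. Applying
  -- `Δ others` to `P` thus isolates `X^(t₀+m)`.
  a₀ a₁ low others : List ℕ
  a₀     = 0 ∷ toList rest
  a₁     = map (m ℕ.∸_) (t₀ ∷ toList rest)
  low    = map (t₀ ℕ.+_) a₁ ++ cartesianProductWith ℕ._+_ a₀ (m ∷ a₁)
  others = m ∷ low

  P-expand : All (_≤ m) (exponents (t₀ ∷ rest)) → P ≋ X (t₀ ℕ.+ m) ⊕ S low ⊕ C -[1+ 0 ] ⊗ X m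
  P-expand ≤m = begin
    A ⊗ rev m A ⊕ ⊖ X m
      ≈⟨ ⊕-cong (⊗-cong (solve 3 (λ o x s → o :+ (x :+ s) := x :+ (o :+ s)) ≋-refl (X 0) (X t₀)
          (S (toList rest))) (rev-S m (exponents (t₀ ∷ rest)) ≤m))
           (solve 1 (λ x → :- x := con -[1+ 0 ] :* x) ≋-refl (X m)) ⟩
    (X t₀ ⊕ S a₀) ⊗ (X m ⊕ S a₁) ⊕ C -[1+ 0 ] ⊗ X m
      ≈⟨ ⊕-congʳ (solve 4 (λ x s y z → (x :+ s) :* (y :+ z) := x :* y :+ (x :* z :+ s :* (y :+ z))) ≋-refl
          (X t₀) (S a₀) (X m) (S a₁)) ⟩
    X t₀ ⊗ X m ⊕ (X t₀ ⊗ S a₁ ⊕ S a₀ ⊗ S (m ∷ a₁)) ⊕ C -[1+ 0 ] ⊗ X m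
      ≈⟨ ⊕-congʳ (⊕-cong (≋-sym (X-+ t₀ m)) (≋-trans (⊕-cong (X⊗S t₀ a₁) (S⊗S a₀ (m ∷ a₁)))
          (≋-sym (S-++ (map (t₀ ℕ.+_) a₁) _)))) ⟩
    X (t₀ ℕ.+ m) ⊕ S low ⊕ C -[1+ 0 ] ⊗ X m ∎

  Δ-P : All (_≤ m) (exponents (t₀ ∷ rest)) → Δ others P ≋ C (differences (t₀ ℕ.+ m) others) ⊗ X (t₀ ℕ.+ m)
  Δ-P ≤m = begin
    Δ others P   ≈⟨ Δ-cong others (P-expand ≤m) ⟩
    Δ others (X (t₀ ℕ.+ m) ⊕ S low ⊕ C -[1+ 0 ] ⊗ X m)
      ≈⟨ ≋-trans (Δ-⊕ others (X (t₀ ℕ.+ m) ⊕ S low) (C -[1+ 0 ] ⊗ X m))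
          (⊕-congʳ (Δ-⊕ others (X (t₀ ℕ.+ m)) (S low))) ⟩
    Δ others (X (t₀ ℕ.+ m)) ⊕ Δ others (S low) ⊕ Δ others (C -[1+ 0 ] ⊗ X m)
      ≈⟨ ⊕-cong (⊕-cong (Δ-X others (t₀ ℕ.+ m)) (Δ-S {others} low there))
          (≋-trans (Δ-C⊗ others -[1+ 0 ] (X m)) (≋-trans (⊗-congˡ (Δ-X∈ {m} {others} (here ≡.refl)))
              (ZX.zeroʳ _))) ⟩
    C (differences (t₀ ℕ.+ m) others) ⊗ X (t₀ ℕ.+ m) ⊕ 𝟘 ⊕ 𝟘  ≈⟨ ≋-trans (ZX.+-identityʳ _)
        (ZX.+-identityʳ _) ⟩
    C (differences (t₀ ℕ.+ m) others) ⊗ X (t₀ ℕ.+ m) ∎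

  others-length : length others ≡ suc (suc k ℕ.+ suc k ℕ.* suc (suc k))
  others-length = ≡.cong suc (≡.trans (List.length-++ (map (t₀ ℕ.+_) a₁)) (≡.cong₂ ℕ._+_
      (≡.trans (List.length-map (t₀ ℕ.+_) a₁) la₁)
      (≡.trans (length-cartesianProductWith ℕ._+_ a₀ (m ∷ a₁))
          (≡.cong₂ ℕ._*_ (≡.cong suc (Vec.length-toList rest)) (≡.cong suc la₁)))))
    where
    la₁ : length a₁ ≡ suc k
    la₁ = ≡.trans (List.length-map (m ℕ.∸_) (t₀ ∷ toList rest)) (≡.cong suc (Vec.length-toList rest))

  module _ {p y N} (gen : Generic p (y ∷ t₀ ∷ rest)) (inc : IncreasingIn[1, N ] (y ∷ t₀ ∷ rest)) where
    private
      ns : Vec ℕ (suc (suc k))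
      ns = y ∷ t₀ ∷ rest
      E′ = t₀ ℕ.+ m
      τ : Fin (suc (suc k))
      τ = Fin.suc Fin.zero

    tail≤m : All (_≤ m) (exponents (t₀ ∷ rest))
    tail≤m = z≤n ∷ All.tail (≤top {ns = ns} (proj₂ inc))

    no-single : ∀ i → ¬ + p ℤ.∣ + lookup ns i
    no-single i d = ℕ.1+n≢0 (≡.trans (≡.cong (ℕ._+ 0) (≡.sym (δ-refl i)))
      (generic-sums {ns = ns} gen (just i ∷ []) [] (s≤s z≤n) z≤n
        (≡.subst (+ p ℤ.∣_) (≡.trans (≡.cong +_ (≡.sym (ℕ.+-identityʳ _))) (≡.sym (ℤ.+-identityʳ _))) d) i))

    tail-index : ∀ {x} → x ∈ t₀ ∷ toList rest → ∃ λ i → x ≡ lookup ns (Fin.suc i)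
    tail-index x∈ with ∈exponents {ns = t₀ ∷ rest} (there x∈)
    ... | just i  , e = i , e
    ... | nothing , ≡.refl = ⊥-elim (ℕ.<-irrefl ≡.refl (All.lookup pos x∈))
      where
      pos : All (0 <_) (t₀ ∷ toList rest)
      pos with exponents-sorted inc
      ... | (_ ∷ pos) ∷ _ = pos

    rest-index : ∀ {x} → x ∈ a₀ → ∃ λ (i : Index k) → x ≡ val rest i
    rest-index = ∈exponents

    lift : Index k → Index (suc (suc k))
    lift nothing  = nothing
    lift (just i) = just (Fin.suc (Fin.suc i))

    val-lift : ∀ i → val ns (lift i) ≡ val rest i
    val-lift nothing  = ≡.refl
    val-lift (just i) = ≡.refl

    δ-lift : ∀ i → δ (lift i) τ ≡ 0
    δ-lift nothing  = ≡.refl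
    δ-lift (just i) = ≡.refl

    lift₁ : Index (suc k) → Index (suc (suc k))
    lift₁ nothing  = nothing
    lift₁ (just i) = just (Fin.suc i)

    val-lift₁ : ∀ i → val ns (lift₁ i) ≡ val (t₀ ∷ rest) i
    val-lift₁ nothing  = ≡.refl
    val-lift₁ (just i) = ≡.refl

    -- Here `lift a` is 0 or an exponent of `rest`, so `t₀` has multiplicity 0 in the subtrahend but
    -- at least 1 in the minuend.
    no-triple : ∀ a x → ¬ + p ℤ.∣ + (t₀ ℕ.+ (val ns x ℕ.+ 0)) ℤ.- + (val ns (lift a) ℕ.+ 0)
    no-triple a x d = ℕ.1+n≢0 (≡.trans (≡.cong (ℕ._+ (δ x τ ℕ.+ 0)) (≡.sym (δ-refl τ)))
      (≡.trans (generic-sums {ns = ns} gen (just τ ∷ x ∷ []) (lift a ∷ []) (s≤s (s≤s z≤n)) (s≤s z≤n) d τ)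
          (≡.cong (ℕ._+ 0) (δ-lift a))))

    -- Subtracting the three kinds of listed exponents from `t₀ + m` cancels `m` and leaves `t₀`,
    -- some exponent `x`, or `t₀ + x - a` with `a` from `a₀`. Genericity makes each nonzero modulo
    -- `p`.
    no-low : ∀ {e} → e ∈ others → ¬ + p ℤ.∣ + E′ ℤ.- + e
    no-low (here ≡.refl) d = no-single τ (≡.subst (+ p ℤ.∣_)
        (≡.trans (≡.cong (ℤ._- + m) (ℤ.pos-+ t₀ m)) (lemma (+ t₀) (+ m))) d)
      where
      lemma : ∀ a b → a ℤ.+ b ℤ.- b ≡ a
      lemma = solveℤ 2 (λ a b → a ℤ:+ b ℤ:- b ℤ:= a) ≡.refl
    no-low {e} (there e∈) d = cases (∈-++⁻ (map (t₀ ℕ.+_) a₁) e∈)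
      where
      diff : ∀ x → x ≤ m → + (m ℕ.∸ x) ≡ + m ℤ.- + x
      diff x x≤m = ≡.sym (≡.trans (ℤ.[+m]-[+n]≡m⊖n m x) (ℤ.⊖-≥ x≤m))
      cases : e ∈ map (t₀ ℕ.+_) a₁ ⊎ e ∈ cartesianProductWith ℕ._+_ a₀ (m ∷ a₁) → ⊥
      cases (inj₁ e∈₁) with ∈-map⁻ (t₀ ℕ.+_) e∈₁
      ... | z , z∈ , ≡.refl with ∈-map⁻ (m ℕ.∸_) {xs = t₀ ∷ toList rest} z∈
      ...   | x , x∈ , ≡.refl with tail-index x∈
      ...     | i , x≡ = no-single (Fin.suc i) (≡.subst (+ p ℤ.∣_) (≡.trans (≡.trans
                  (≡.cong₂ ℤ._-_ (ℤ.pos-+ t₀ m) (≡.trans (ℤ.pos-+ t₀ (m ℕ.∸ x))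
                      (≡.cong (λ w → + t₀ ℤ.+ w) (diff x (All.lookup tail≤m (there x∈))))))
                  (solveℤ 3 (λ t m x → (t ℤ:+ m) ℤ:- (t ℤ:+ (m ℤ:- x)) ℤ:= x) ≡.refl (+ t₀) (+ m) (+ x)))
                      (≡.cong +_ x≡)) d)
      cases (inj₂ e∈₂) with ∈-cartesianProductWith⁻ ℕ._+_ a₀ (m ∷ a₁) e∈₂
      ... | a , z , a∈ , z∈ , ≡.refl with ∈-map⁻ (m ℕ.∸_) {xs = exponents (t₀ ∷ rest)} z∈ | rest-index a∈
      ...   | x , x∈ , ≡.refl | ia , a≡ with ∈exponents {ns = t₀ ∷ rest} x∈
      ...     | ix , x≡ = no-triple ia (lift₁ ix) (≡.subst (+ p ℤ.∣_) (≡.trans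
                  (≡.cong₂ ℤ._-_ (ℤ.pos-+ t₀ m) (≡.trans (ℤ.pos-+ a (m ℕ.∸ x))
                      (≡.cong (λ w → + a ℤ.+ w) (diff x (All.lookup tail≤m x∈)))))
                  (≡.trans (solveℤ 4 (λ t m a x → (t ℤ:+ m) ℤ:- (a ℤ:+ (m ℤ:- x)) ℤ:= (t ℤ:+ x) ℤ:- a)
                      ≡.refl (+ t₀) (+ m) (+ a) (+ x))
                    (≡.cong₂ ℤ._-_ (≡.trans (≡.sym (ℤ.pos-+ t₀ x))
                        (≡.cong (λ w → + (t₀ ℕ.+ w))
                            (≡.sym (≡.trans (ℕ.+-identityʳ _) (≡.trans (val-lift₁ ix) (≡.sym x≡))))))
                      (≡.cong +_ (≡.sym (≡.trans (ℕ.+-identityʳ _) (≡.trans (val-lift ia) (≡.sym a≡))))))))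
                          d)

record Bad (p N : ℕ) {k} (t : Vec ℕ (suc k)) (y : ℕ) : Set where
  field
    gen : Generic p (y ∷ t)
    inc : IncreasingIn[1, N ] (y ∷ t)
    cf  : CommonFactor (y ∷ t)

  monicPoly : MonicPoly
  monicPoly = _ , _ , CommonFactor.M cf

module BadHeads {p N k : ℕ} (t₀ : ℕ) (rest : Vec ℕ k) where
  open Expansion t₀ rest
  private
    t : Vec ℕ (suc k)
    t = t₀ ∷ rest

  polys : ∀ {ys} → All (Bad p N t) ys → List MonicPoly
  polys []       = []
  polys (b ∷ bs) = Bad.monicPoly b ∷ polys bs

  polys-length : ∀ {ys} (bs : All (Bad p N t) ys) → length (polys bs) ≡ length ys
  polys-length []       = ≡.refl
  polys-length (b ∷ bs) = ≡.cong suc (polys-length bs)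

  polys-coprime : ∀ {ys} → Unique ys → (bs : All (Bad p N t) ys) → AllPairs
      (λ f g → Coprime (poly f) (poly g)) (polys bs)
  polys-coprime []      []       = []
  polys-coprime (n ∷ u) (b ∷ bs) = fresh n bs ∷ polys-coprime u bs
    where
    fresh : ∀ {ys} → All (_ ≢_) ys → (bs : All (Bad p N t) ys) → All
        (λ g → Coprime (poly (Bad.monicPoly b)) (poly g)) (polys bs)
    fresh []       []        = []
    fresh (n ∷ ns) (b′ ∷ bs) = coprime-heads (Bad.inc b) (Bad.inc b′) (Bad.cf b) (Bad.cf b′) n ∷ fresh ns bs

  polys-∣P : ∀ {ys} (bs : All (Bad p N t) ys) → All (λ f → poly f ∣ₚ P) (polys bs)
  polys-∣P []       = []
  polys-∣P (b ∷ bs) = h∣P (Bad.inc b) (Bad.cf b) ∷ polys-∣P bs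

  module _ {Q : ℕ → Set} {R : MonicPoly → Set} (bad : ∀ {y} → Q y → Bad p N t y) (prop : ∀ {y} (q : Q y) → R (Bad.monicPoly (bad q))) where
    polys-prop : ∀ {ys} (qs : All Q ys) → All R (polys (All.map bad qs))
    polys-prop []       = []
    polys-prop (q ∷ qs) = prop q ∷ polys-prop qs

  m≤N : ∀ {y} → Bad p N t y → m ≤ N
  m≤N b = proj₂ (VAll.lookup⁺ (VAll.tail (proj₁ (Bad.inc b))) (fromℕ k))

  High : ℕ → ℕ → Set
  High T y = ∃ λ (b : Bad p N t y) → T ≤ suc (CommonFactor.e (Bad.cf b))

  high-bound : ∀ T .{{_ : ℕ.NonZero T}} → AtMost (High T) ((N ℕ.+ N) / T)
  high-bound T []         u []         = z≤n
  high-bound T ys@(_ ∷ _) u qs@(q ∷ _) = ≡.subst (_≤ (N ℕ.+ N) / T) (m*n/n≡m (length ys) T)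
      (/-mono-≤ (ℕ.≤-trans
    (≡.subst (λ l → l ℕ.* T ≤ deg (productM fs)) (polys-length bs)
        (productM-deg T fs (polys-prop proj₁ proj₂ qs)))
    (ℕ.≤-trans (∣ₚ⇒deg≤ (proj₂ (proj₂ (productM fs))) (Monic-P (Bad.inc (proj₁ q)))
        (productM-∣ fs (polys-coprime u bs) (polys-∣P bs)))
      (ℕ.+-mono-≤ (m≤N (proj₁ q)) (m≤N (proj₁ q))))) (ℕ.≤-refl {T}))
    where
    bs = All.map proj₁ qs
    fs = polys bs

  Low : Pol → ℕ → Set
  Low v y = ∃ λ (b : Bad p N t y) → Congruent (+ p) (CommonFactor.h (Bad.cf b)) v

  -- With `length others + 1` congruent factors, `P` lies in the ideal of that power of `v` and `p`.
  -- `Δ others` spends one power per operator and leaves a multiple of `X^(t₀+m)` with one power of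
  -- `v`, enough for `no-multiple` to contradict `no-low`.
  low-bound : Prime p → ∀ v → AtMost (Low v) (length others)
  low-bound pp v []         u []         = z≤n
  low-bound pp v ys@(_ ∷ _) u qs@(q ∷ _) = ℕ.≮⇒≥ λ l → absurd (ℕ.m≤n⇒∃[o]m+o≡n l)
    where
    bs = All.map proj₁ qs
    fs = polys bs
    b = proj₁ q
    prod∣P : poly (productM fs) ∣ₚ P
    prod∣P = productM-∣ fs (polys-coprime u bs) (polys-∣P bs)
    absurd : ∃ (λ o → suc (length others) ℕ.+ o ≡ length ys) → ⊥
    absurd (o , eq) = prime-∤-differences pp others (no-low (Bad.gen b) (Bad.inc b))
      (no-multiple (CommonFactor.M (Bad.cf b)) (proj₂ q) (unitX (Bad.inc b) (Bad.cf b) (t₀ ℕ.+ m))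
        (InIdeal-resp (Δ-P (tail≤m (Bad.gen b) (Bad.inc b)))
            (InIdeal-Δ others (InIdeal-drop o (length others ℕ.+ 1)
          (≡.subst (λ n → InIdeal v (+ p) n P) count
              (InIdeal-resp (_∣ₚ_.eqn prod∣P) (InIdeal-⊗ (_∣ₚ_.quo prod∣P)
                  (InIdeal-product fs (polys-prop proj₁ proj₂ qs)))))))))
      where
      count : length fs ≡ o ℕ.+ (length others ℕ.+ 1)
      count = ≡.trans (polys-length bs) (≡.trans (≡.sym eq)
          (≡.trans (ℕ.+-comm (suc (length others)) o) (≡.cong (o ℕ.+_) (ℕ.+-comm 1 (length others)))))

residues : ℕ → ℕ → List Pol
residues p zero    = [] ∷ []
residues p (suc n) = cartesianProductWith _∷_ (map +_ (upTo p)) (residues p n)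

residues-length : ∀ p n → length (residues p n) ≡ p ℕ.^ n
residues-length p zero    = ≡.refl
residues-length p (suc n) = ≡.trans (length-cartesianProductWith _∷_ (map +_ (upTo p)) (residues p n))
  (≡.cong₂ ℕ._*_ (≡.trans (List.length-map +_ (upTo p)) (List.length-upTo p)) (residues-length p n))

residue : ∀ p .{{_ : ℕ.NonZero p}} n h → Deg< n h → ∃ λ v → v ∈ residues p n × Congruent (+ p) h v
residue p n h d = let (v , r , v∈ , e) = go n h d in v , v∈ , r , mk≋ λ i → ≡.trans (e i) (≡.sym (≡.trans (co-⊕ v (C (+ p) ⊗ r) i)
    (≡.cong (λ z → co v i ℤ.+ z) (co-C⊗ (+ p) r i))))
  where
  digit : ∀ a → a ≡ + (a ℤ.%ℕ p) ℤ.+ + p ℤ.* (a ℤ./ℕ p)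
  digit a = ≡.trans (ℤ.a≡a%ℕn+[a/ℕn]*n a p) (≡.cong (λ z → + (a ℤ.%ℕ p) ℤ.+ z) (ℤ.*-comm (a ℤ./ℕ p) (+ p)))
  go : ∀ n h → Deg< n h → ∃ λ v → ∃ λ r → v ∈ residues p n × ∀ i → co h i ≡ co v i ℤ.+ + p ℤ.* co r i
  go zero    h       d = [] , [] , here ≡.refl , λ i → ≡.trans (d i z≤n)
      (≡.sym (≡.trans (ℤ.+-identityˡ _) (ℤ.*-zeroʳ (+ p))))
  go (suc n) []      d = let (v , r , v∈ , e) = go n [] (λ i _ → ≡.refl) in
    _ ∷ v , _ ∷ r , ∈-cartesianProductWith⁺ _∷_ (∈-map⁺ +_ (∈-upTo⁺ (ℤ.n%ℕd<d (+ 0) p))) v∈ , λ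
        { zero → digit (+ 0) ; (suc i) → e i }
  go (suc n) (a ∷ h) d = let (v , r , v∈ , e) = go n h (λ i l → d (suc i) (s≤s l)) in
    _ ∷ v , _ ∷ r , ∈-cartesianProductWith⁺ _∷_ (∈-map⁺ +_ (∈-upTo⁺ (ℤ.n%ℕd<d a p))) v∈ , λ
        { zero → digit a ; (suc i) → e i }

-- Equals `(k + 2)²`, the number of pairs of terms in `A ⊗ rev m A`: the omitted `X^(t₀+m)` is made
-- up for by `- X^m`.
termCount : ℕ → ℕ
termCount k = suc (suc k ℕ.+ suc k ℕ.* suc (suc k))

bad-heads-bound : ∀ {p N k} → Prime p → ∀ T .{{_ : ℕ.NonZero T}} (t : Vec ℕ (suc k)) →
                  AtMost (Bad p N t) ((N ℕ.+ N) / T ℕ.+ p ℕ.^ T ℕ.* termCount k)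
bad-heads-bound {p} {N} {k} pp T (t₀ ∷ rest) = ≡.subst
    (λ B → AtMost (Bad p N (t₀ ∷ rest)) ((N ℕ.+ N) / T ℕ.+ B))
    (≡.cong₂ ℕ._*_ (residues-length p T) others-length)
    (AtMost-⊆ classify (AtMost-⊎ (high-bound T) (AtMost-fibres (low-bound pp) (residues p T))))
  where
  open Expansion t₀ rest using (others; others-length)
  open BadHeads {p} {N} t₀ rest
  classify : ∀ {y} → Bad p N (t₀ ∷ rest) y → High T y ⊎ (∃ λ v → v ∈ residues p T × Low v y)
  classify b with T ℕ.≤? suc (CommonFactor.e (Bad.cf b))
  ... | yes l = inj₁ (b , l)
  ... | no ¬l = inj₂ (let (v , v∈ , c) = residue p {{prime⇒nonZero pp}} T (CommonFactor.h (Bad.cf b))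
                             (Deg<-mono {p = CommonFactor.h (Bad.cf b)} (ℕ.≰⇒> ¬l)
                                 (above (CommonFactor.M (Bad.cf b)))) in v , v∈ , b , c)

-- Density of the exceptional tuples

infinitely-many-primes : ∀ n → ∃ λ p → Prime p × n < p
infinitely-many-primes n = pick factors isFactorisation factorsPrime
  where
  open PrimeFactorisation (factorise (suc (n !)))
  ∣! : ∀ p → p ≢ 0 → p ≤ n → p ℕ∣ n !
  ∣! zero    p≢0 _   = ⊥-elim (p≢0 ≡.refl)
  ∣! (suc p) _   p≤n = ℕ∣.∣-trans (ℕ∣.m∣m*n (p !)) (ℕ∣.m≤n⇒m!∣n! p≤n)
  pick : ∀ ps → suc (n !) ≡ product ps → All Prime ps → ∃ λ p → Prime p × n < p
  pick []       e _        = ⊥-elim (ℕ.≢-nonZero⁻¹ (n !) {{ℕ._!≢0 n}} (ℕ.suc-injective e))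
  pick (p ∷ ps) e (pp ∷ _) = p , pp , ℕ.≰⇒> λ p≤n → prime∤1 pp (ℕ∣.∣m+n∣m⇒∣n
    (≡.subst (p ℕ∣_) (≡.trans (≡.sym e) (ℕ.+-comm 1 (n !))) (ℕ∣.m∣m*n (product ps)))
    (∣! p (ℕ.≢-nonZero⁻¹ p {{prime⇒nonZero pp}}) p≤n))

interval : ℕ → List ℕ
interval N = map suc (upTo N)

∈-interval : ∀ {N n} → 1 ≤ n × n ≤ N → n ∈ interval N
∈-interval {n = suc n} (_ , l) = ∈-map⁺ suc (∈-upTo⁺ l)

interval-length : ∀ N → length (interval N) ≡ N
interval-length N = ≡.trans (List.length-map suc (upTo N)) (List.length-upTo N)

vectors : {A : Set} → List A → ∀ k → List (Vec A k)
vectors xs zero    = [] ∷ []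
vectors xs (suc k) = cartesianProductWith _∷_ xs (vectors xs k)

vectors-length : ∀ {A : Set} (xs : List A) k → length (vectors xs k) ≡ length xs ℕ.^ k
vectors-length xs zero    = ≡.refl
vectors-length xs (suc k) = ≡.trans (length-cartesianProductWith _∷_ xs (vectors xs k))
    (≡.cong (length xs ℕ.*_) (vectors-length xs k))

∈-vectors : ∀ {A : Set} {xs : List A} {k} {v : Vec A k} → VAll.All (_∈ xs) v → v ∈ vectors xs k
∈-vectors VAll.[]        = here ≡.refl
∈-vectors (x∈ VAll.∷ v∈) = ∈-cartesianProductWith⁺ _∷_ x∈ (∈-vectors v∈)

InBox : ℕ → ∀ {k} → Vec ℕ k → Set
InBox N = VAll.All (λ n → 1 ≤ n × n ≤ N)

boxes : ℕ → ∀ k → List (Vec ℕ k)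
boxes N = vectors (interval N)

boxes-length : ∀ N k → length (boxes N k) ≡ N ℕ.^ k
boxes-length N k = ≡.trans (vectors-length (interval N) k) (≡.cong (ℕ._^ k) (interval-length N))

∈-boxes : ∀ {N k} {ns : Vec ℕ k} → InBox N ns → ns ∈ boxes N k
∈-boxes b = ∈-vectors (VAll.map ∈-interval b)

AtMost-≡ : ∀ {A : Set} {Q : A → Set} {B B′} → B ≡ B′ → AtMost Q B → AtMost Q B′
AtMost-≡ ≡.refl am = am

AtMost-tails : ∀ {N k B} {Q : Vec ℕ k → ℕ → Set} → (∀ t → AtMost (Q t) B) →
               AtMost (λ (ns : Vec ℕ (suc k)) → InBox N (Vec.tail ns) × Q (Vec.tail ns) (Vec.head ns))
                   (N ℕ.^ k ℕ.* B)
AtMost-tails {N} {k} {B} {Q} am = AtMost-≡ (≡.cong (ℕ._* B) (boxes-length N k))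
  (AtMost-⊆ (λ {ns} (b , q) → Vec.tail ns , ∈-boxes b , ≡.refl , q) (AtMost-fibres fibre (boxes N k)))
  where
  fibre : ∀ t → AtMost (λ ns → Vec.tail ns ≡ t × Q (Vec.tail ns) (Vec.head ns)) B
  fibre t = AtMost-map Vec.head (λ { (≡.refl , q) → q })
      (λ { {_ ∷ _} {_ ∷ _} (≡.refl , _) (≡.refl , _) ≡.refl → ≡.refl }) (am t)

AtMost-heads : ∀ {N k B} {Q : ℕ → Vec ℕ k → Set} → (∀ x → AtMost (Q x) B) →
               AtMost (λ (ns : Vec ℕ (suc k)) → (1 ≤ Vec.head ns × Vec.head ns ≤ N) × Q (Vec.head ns)
                   (Vec.tail ns)) (N ℕ.* B)
AtMost-heads {N} {k} {B} {Q} am = AtMost-≡ (≡.cong (ℕ._* B) (interval-length N))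
  (AtMost-⊆ (λ {ns} (b , q) → Vec.head ns , ∈-interval b , ≡.refl , q) (AtMost-fibres fibre (interval N)))
  where
  fibre : ∀ x → AtMost (λ ns → Vec.head ns ≡ x × Q (Vec.head ns) (Vec.tail ns)) B
  fibre x = AtMost-map Vec.tail (λ { (≡.refl , q) → q })
      (λ { {_ ∷ _} {_ ∷ _} (≡.refl , _) (≡.refl , _) ≡.refl → ≡.refl }) (am x)

-- Lets a bound use data that only an element provides, such as the index of a nonzero coefficient
-- inside a `Relation`.
AtMost-inhabited : ∀ {A : Set} {Q : A → Set} {B} → (∀ {x} → Q x → AtMost Q B) → AtMost Q B
AtMost-inhabited am []       u qs       = z≤n
AtMost-inhabited am (x ∷ xs) u (q ∷ qs) = am q (x ∷ xs) u (q ∷ qs)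

-- Tuples satisfying a linear congruence

residues-injective : ∀ {p a b} → a < p → b < p → + p ℤ.∣ + a ℤ.- + b → a ≡ b
residues-injective {p} {a} {b} a<p b<p d = ℤ.+-injective
    (ℤ.i-j≡0⇒i≡j (+ a) (+ b) (ℤ.∣i∣≡0⇒i≡0 (small ∣ + a ℤ.- + b ∣ lt (ℤ.∣⇒∣ᵤ d))))
  where
  lt : ∣ + a ℤ.- + b ∣ < p
  lt = ℕ.≤-<-trans (ℕ.≤-trans (ℕ.≤-reflexive (≡.cong ∣_∣ (ℤ.[+m]-[+n]≡m⊖n a b))) (ℤ.∣m⊝n∣≤m⊔n a b))
      (ℕ.⊔-lub a<p b<p)
  small : ∀ n → n < p → p ℕ∣ n → n ≡ 0
  small zero    _ _ = ≡.refl
  small (suc n) l d = ⊥-elim (ℕ∣.>⇒∤ l d)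

module _ {p : ℕ} (pp : Prime p) where
  private instance
    p-nonZero : ℕ.NonZero p
    p-nonZero = prime⇒nonZero pp

  -- `c` is invertible modulo `p`, so the congruence fixes `x` modulo `p`. Then `x` is determined by
  -- `x / p`, which takes values from 0 to `N / p`.
  line : ∀ N {c} r → ¬ + p ℤ.∣ c → AtMost (λ x → (1 ≤ x × x ≤ N) × + p ℤ.∣ r ℤ.+ c ℤ.* + x) (suc (N / p))
  line N {c} r p∤c = AtMost-map (_/ p) (λ ((_ , x≤N) , _) → ∈-upTo⁺ (s≤s (/-monoˡ-≤ p x≤N))) same
    (≡.subst (AtMost (_∈ upTo (suc (N / p)))) (List.length-upTo (suc (N / p)))
        (AtMost-∈ (upTo (suc (N / p)))))
    where
    same : ∀ {x y} → (1 ≤ x × x ≤ N) × + p ℤ.∣ r ℤ.+ c ℤ.* + x → (1 ≤ y × y ≤ N) × + p ℤ.∣ r ℤ.+ c ℤ.* + y →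
        x / p ≡ y / p → x ≡ y
    same {x} {y} (_ , dx) (_ , dy) e = ≡.trans (m≡m%n+[m/n]*n x p)
        (≡.trans (≡.cong₂ (λ a b → a ℕ.+ b ℕ.* p) x%≡y% e) (≡.sym (m≡m%n+[m/n]*n y p)))
      where
      p∣c*[x-y] : + p ℤ.∣ c ℤ.* (+ x ℤ.- + y)
      p∣c*[x-y] = ≡.subst (+ p ℤ.∣_) (solveℤ 4 (λ r c x y → (r ℤ:+ c ℤ:* x) ℤ:- (r ℤ:+ c ℤ:* y) ℤ:= c ℤ:*
          (x ℤ:- y)) ≡.refl r c (+ x) (+ y)) (ℤ.∣m∣n⇒∣m-n dx dy)
      p∣x-y : + p ℤ.∣ + x ℤ.- + y
      p∣x-y = Sum.[ (λ d → ⊥-elim (p∤c d)) , (λ d → d) ] (prime-∣-* pp c (+ x ℤ.- + y) p∣c*[x-y])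
      expand : ∀ z → + z ≡ + (z % p) ℤ.+ + (z / p) ℤ.* + p
      expand z = ≡.trans (≡.cong +_ (m≡m%n+[m/n]*n z p))
          (≡.trans (ℤ.pos-+ (z % p) (z / p ℕ.* p)) (≡.cong (λ w → + (z % p) ℤ.+ w) (ℤ.pos-* (z / p) p)))
      x%≡y% : x % p ≡ y % p
      x%≡y% = residues-injective (m%n<n x p) (m%n<n y p) (≡.subst (+ p ℤ.∣_)
        (≡.trans (≡.cong₂ ℤ._-_ (expand x) (≡.trans (expand y)
            (≡.cong (λ q → + (y % p) ℤ.+ + q ℤ.* + p) (≡.sym e))))
          (solveℤ 3 (λ a b q → (a ℤ:+ q) ℤ:- (b ℤ:+ q) ℤ:= a ℤ:- b) ≡.refl (+ (x % p)) (+ (y % p))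
              (+ (x / p) ℤ.* + p))) p∣x-y)

  -- If `p` does not divide the first coefficient, the other coordinates are free and the first lies
  -- on a `line`. Otherwise the first coordinate is free and is absorbed into `r`, which is why the
  -- congruence has a constant term.
  hyperplane : ∀ N K (c : Fin (suc K) → ℤ) r → (∃ λ i → ¬ + p ℤ.∣ c i) →
               AtMost (λ ns → InBox N ns × + p ℤ.∣ r ℤ.+ dot c ns) (N ℕ.^ K ℕ.* suc (N / p))
  hyperplane N K c r (i , p∤ci) = cases (+ p ℤ.∣? c Fin.zero)
    where
    c′ = c ∘ Fin.suc
    by-tail : ∀ {ns : Vec ℕ (suc K)} → InBox N ns × + p ℤ.∣ r ℤ.+ dot c ns →
              InBox N (Vec.tail ns) × ((1 ≤ Vec.head ns × Vec.head ns ≤ N) × + p ℤ.∣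
                  (r ℤ.+ dot c′ (Vec.tail ns)) ℤ.+ c Fin.zero ℤ.* + Vec.head ns)
    by-tail {x ∷ t} ((bx VAll.∷ bt) , d) = bt , bx , ≡.subst (+ p ℤ.∣_)
        (solveℤ 3 (λ r a b → r ℤ:+ (a ℤ:+ b) ℤ:= (r ℤ:+ b) ℤ:+ a) ≡.refl r (c Fin.zero ℤ.* + x) (dot c′ t))
            d
    by-head : ∀ {ns : Vec ℕ (suc K)} → InBox N ns × + p ℤ.∣ r ℤ.+ dot c ns →
              (1 ≤ Vec.head ns × Vec.head ns ≤ N) ×
                  (InBox N (Vec.tail ns) × + p ℤ.∣ (r ℤ.+ c Fin.zero ℤ.* + Vec.head ns) ℤ.+ dot c′
                      (Vec.tail ns))
    by-head {x ∷ t} ((bx VAll.∷ bt) , d) = bx , bt , ≡.subst (+ p ℤ.∣_)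
        (≡.sym (ℤ.+-assoc r (c Fin.zero ℤ.* + x) (dot c′ t))) d
    inner : ∀ {K} (c : Fin (suc K) → ℤ) i → ¬ + p ℤ.∣ c i → + p ℤ.∣ c Fin.zero → ∃ λ K′ → K ≡ suc K′
    inner {zero}  c Fin.zero n d = ⊥-elim (n d)
    inner {suc K} c i        n d = K , ≡.refl
    later : ∀ i → ¬ + p ℤ.∣ c i → + p ℤ.∣ c Fin.zero → ∃ λ j → ¬ + p ℤ.∣ c′ j
    later Fin.zero    n d = ⊥-elim (n d)
    later (Fin.suc j) n d = j , n
    cases : Dec (+ p ℤ.∣ c Fin.zero) → AtMost (λ ns → InBox N ns × + p ℤ.∣ r ℤ.+ dot c ns)
        (N ℕ.^ K ℕ.* suc (N / p))
    cases (no p∤c₀)  = AtMost-⊆ by-tail (AtMost-tails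
        {Q = λ t x → (1 ≤ x × x ≤ N) × + p ℤ.∣ (r ℤ.+ dot c′ t) ℤ.+ c Fin.zero ℤ.* + x}
      λ t → line N (r ℤ.+ dot c′ t) p∤c₀)
    cases (yes p∣c₀) with inner c i p∤ci p∣c₀
    ... | K′ , ≡.refl = AtMost-≡ (≡.sym (ℕ.*-assoc N (N ℕ.^ K′) (suc (N / p))))
      (AtMost-⊆ by-head (AtMost-heads {Q = λ x t → InBox N t × + p ℤ.∣ (r ℤ.+ c Fin.zero ℤ.* + x) ℤ.+ dot c′
          t}
        λ x → hyperplane N K′ c′ (r ℤ.+ c Fin.zero ℤ.* + x) (later i p∤ci p∣c₀)))

coefficients : List ℤ
coefficients = -[1+ 2 ] ∷ -[1+ 1 ] ∷ -[1+ 0 ] ∷ + 0 ∷ + 1 ∷ + 2 ∷ + 3 ∷ []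

∈-coefficients : ∀ c → ∣ c ∣ ≤ 3 → c ∈ coefficients
∈-coefficients -[1+ 2 ] _ = here ≡.refl
∈-coefficients -[1+ 1 ] _ = there (here ≡.refl)
∈-coefficients -[1+ 0 ] _ = there (there (here ≡.refl))
∈-coefficients (+ 0)    _ = there (there (there (here ≡.refl)))
∈-coefficients (+ 1)    _ = there (there (there (there (here ≡.refl))))
∈-coefficients (+ 2)    _ = there (there (there (there (there (here ≡.refl)))))
∈-coefficients (+ 3)    _ = there (there (there (there (there (there (here ≡.refl))))))
∈-coefficients -[1+ suc (suc (suc _)) ]   (s≤s (s≤s (s≤s ())))
∈-coefficients (+ suc (suc (suc (suc _)))) (s≤s (s≤s (s≤s ())))

record Relation (p N : ℕ) {k} (v : Vec ℤ k) (ns : Vec ℕ k) : Set where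
  field
    i       : Fin k
    nonzero : lookup v i ≢ + 0
    small   : ∣ lookup v i ∣ ≤ 3
    box     : InBox N ns
    divis   : + p ℤ.∣ dot (lookup v) ns

NonGeneric : (p N : ℕ) → ∀ {k} → Vec ℕ k → Set
NonGeneric p N {k} ns = ∃ λ v → v ∈ vectors coefficients k × Relation p N v ns

-- There are `7 ^ suc K` coefficient vectors with entries in [-3,3], and each nonzero one gives a
-- `hyperplane`: by `3 < p` its nonzero entries are prime to `p`.
nonGeneric-bound : ∀ {p} (pp : Prime p) → 3 < p → ∀ N K →
  AtMost (NonGeneric p N {suc K}) (7 ℕ.^ suc K ℕ.* (N ℕ.^ K ℕ.* suc ((N / p) {{prime⇒nonZero pp}})))
nonGeneric-bound {p} pp 3<p N K = AtMost-≡ (≡.cong (ℕ._* B) (vectors-length coefficients (suc K)))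
  (AtMost-fibres fibre (vectors coefficients (suc K)))
  where
  B = N ℕ.^ K ℕ.* suc ((N / p) {{prime⇒nonZero pp}})
  p∤ : ∀ {c} → c ≢ + 0 → ∣ c ∣ ≤ 3 → ¬ + p ℤ.∣ c
  p∤ {c} c≢0 l d = ℕ∣.>⇒∤ {{ℤ.≢-nonZero c≢0}} (ℕ.≤-<-trans l 3<p) (ℤ.∣⇒∣ᵤ d)
  fibre : ∀ v → AtMost (Relation p N v) B
  fibre v = AtMost-inhabited λ r → AtMost-⊆
    (λ r′ → Relation.box r′ , ≡.subst (+ p ℤ.∣_) (≡.sym (ℤ.+-identityˡ _)) (Relation.divis r′))
    (hyperplane pp N K (lookup v) (+ 0) (Relation.i r , p∤ (Relation.nonzero r) (Relation.small r)))

¬generic⇒nonGeneric : ∀ {p N k} {ns : Vec ℕ k} → InBox N ns → ¬ Generic p ns → ¬ ¬ NonGeneric p N ns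
¬generic⇒nonGeneric {p} {N} {k} {ns} b ¬gen none = ¬gen λ c small d i → vanish c small d i (c i ℤ.≟ + 0)
  where
  vanish : ∀ c → (∀ i → ∣ c i ∣ ≤ 3) → + p ℤ.∣ dot c ns → ∀ i → Dec (c i ≡ + 0) → c i ≡ + 0
  vanish c small d i (yes z) = z
  vanish c small d i (no nz) = ⊥-elim (none (tabulate c , ∈-vectors
      (all-tabulate (λ i → ∈-coefficients (c i) (small i))) , record
    { i = i ; nonzero = λ z → nz (≡.trans (≡.sym (Vec.lookup∘tabulate c i)) z)
    ; small = ≡.subst (λ z → ∣ z ∣ ≤ 3) (≡.sym (Vec.lookup∘tabulate c i)) (small i) ; box = b
    ; divis = ≡.subst (+ p ℤ.∣_) (dot-cong (λ i → ≡.sym (Vec.lookup∘tabulate c i)) ns) d }))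
    where
    all-tabulate : ∀ {k} {c : Fin k → ℤ} → (∀ i → c i ∈ coefficients) → VAll.All (_∈ coefficients)
        (tabulate c)
    all-tabulate {zero}  h = VAll.[]
    all-tabulate {suc k} h = h Fin.zero VAll.∷ all-tabulate (h ∘ Fin.suc)

BadTuple : (p N : ℕ) → ∀ {k} → Vec ℕ (suc (suc k)) → Set
BadTuple p N ns = InBox N (Vec.tail ns) × Bad p N (Vec.tail ns) (Vec.head ns)

classify : ∀ p {N k} (ns : Vec ℕ (suc (suc k))) → IncreasingIn[1, N ] ns →
    (Generic p ns → ¬ ¬ CommonFactor ns) →
           ¬ ¬ (NonGeneric p N ns ⊎ BadTuple p N ns)
classify p {N} ns@(y ∷ t) inc cf none = ¬¬-excluded-middle cases
  where
  cases : Dec (Generic p ns) → ⊥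
  cases (no ¬gen) = ¬generic⇒nonGeneric (proj₁ inc) ¬gen (λ ng → none (inj₁ ng))
  cases (yes gen) = cf gen λ c → none (inj₂ (VAll.tail (proj₁ inc) , record
      { gen = gen ; inc = inc ; cf = c }))

-- Once `V` is factored out, three contributions remain: `s q` from the linear relations, `w` from
-- the factors of large degree, and the constant `s + R` from rounding `N / p` up and from the
-- factors of small degree. Multiplied by `M`, each is at most a quarter of `N`.
arithmetic : ∀ M N s q w R V → 4 ℕ.* (M ℕ.* s ℕ.* q) ≤ N → 4 ℕ.* (M ℕ.* w) ≤ N → 4 ℕ.* (M ℕ.* (s ℕ.+ R)) ≤ N
    →
             M ℕ.* (s ℕ.* (V ℕ.* suc q) ℕ.+ V ℕ.* (w ℕ.+ R)) ≤ N ℕ.* V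
arithmetic M N s q w R V h₁ h₂ h₃ = ℕ.≤-trans (ℕ.≤-reflexive (rearrange M s q w R V))
    (ℕ.*-monoˡ-≤ V {M ℕ.* s ℕ.* q ℕ.+ M ℕ.* w ℕ.+ M ℕ.* (s ℕ.+ R)} {N} (ℕ.*-cancelˡ-≤ 4 (ℕ.≤-trans
    (ℕ.≤-reflexive (distribute (M ℕ.* s ℕ.* q) (M ℕ.* w) (M ℕ.* (s ℕ.+ R))))
    (ℕ.≤-trans (ℕ.+-mono-≤ (ℕ.+-mono-≤ h₁ h₂) h₃) (ℕ.≤-trans (ℕ.m≤m+n (N ℕ.+ N ℕ.+ N) N)
        (ℕ.≤-reflexive (four N)))))))
  where
  rearrange : ∀ M s q w R V → M ℕ.* (s ℕ.* (V ℕ.* suc q) ℕ.+ V ℕ.* (w ℕ.+ R)) ≡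
      (M ℕ.* s ℕ.* q ℕ.+ M ℕ.* w ℕ.+ M ℕ.* (s ℕ.+ R)) ℕ.* V
  rearrange = solveℕ 6 (λ M s q w R V → M ℕ:* (s ℕ:* (V ℕ:* (ℕcon 1 ℕ:+ q)) ℕ:+ V ℕ:* (w ℕ:+ R)) ℕ:=
      (M ℕ:* s ℕ:* q ℕ:+ M ℕ:* w ℕ:+ M ℕ:* (s ℕ:+ R)) ℕ:* V) ≡.refl
  distribute : ∀ a b c → 4 ℕ.* (a ℕ.+ b ℕ.+ c) ≡ 4 ℕ.* a ℕ.+ 4 ℕ.* b ℕ.+ 4 ℕ.* c
  distribute = solveℕ 3 (λ a b c → ℕcon 4 ℕ:* (a ℕ:+ b ℕ:+ c) ℕ:= ℕcon 4 ℕ:* a ℕ:+ ℕcon 4 ℕ:* b ℕ:+ ℕcon 4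
      ℕ:* c) ≡.refl
  four : ∀ N → N ℕ.+ N ℕ.+ N ℕ.+ N ≡ 4 ℕ.* N
  four = solveℕ 1 (λ N → N ℕ:+ N ℕ:+ N ℕ:+ N ℕ:= ℕcon 4 ℕ:* N) ≡.refl

-- Common to both conclusions of the theorem: all that matters about `P` is that for a generic tuple
-- it produces a common factor, up to double negation.
rare : ∀ {k} (P : Vec ℕ (suc (suc k)) → Set) →
       (∀ {p N} ns → Generic p ns → IncreasingIn[1, N ] ns → P ns → ¬ ¬ CommonFactor ns) →
       (λ N → Number (suc (suc k)) N P) =o[N^ suc (suc k) ]
rare {k} P common M M≢0 = N₀ , λ N N₀≤N c (xs , u , iff , e) → ≡.subst (λ c → M ℕ.* c ≤ N ℕ.^ suc (suc k)) e
    (ℕ.≤-trans (ℕ.*-monoʳ-≤ M (bound N xs u (All.tabulate λ x∈ → Equivalence.to (iff _) x∈)))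
      (arithmetic M N s (N / p) ((N ℕ.+ N) / T) R (N ℕ.^ suc k) (h₁ N) (h₂ N) N₀≤N))
  where
  K = suc (suc k)
  s = 7 ℕ.^ K
  -- Makes `M` times `2N / T` at most a quarter of `N`.
  T = 8 ℕ.* M
  -- Beyond 3 for `nonGeneric-bound`, and beyond `4 M s` so that `M s` times `N / p` is at most a
  -- quarter of `N`.
  prime = infinitely-many-primes (3 ℕ.+ 4 ℕ.* (M ℕ.* s))
  p = proj₁ prime
  pp = proj₁ (proj₂ prime)
  p-large : 3 ℕ.+ 4 ℕ.* (M ℕ.* s) < p
  p-large = proj₂ (proj₂ prime)
  R = p ℕ.^ T ℕ.* termCount k
  -- By now `p` and `T` are fixed, so `R`, although of size `p ^ T`, is a constant that a large `N`
  -- outgrows.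
  N₀ = 4 ℕ.* (M ℕ.* (s ℕ.+ R))
  instance
    p-nonZero : ℕ.NonZero p
    p-nonZero = prime⇒nonZero pp
    T-nonZero : ℕ.NonZero T
    T-nonZero = ℕ.m*n≢0 8 M {{_}} {{M≢0}}
  bound : ∀ N → AtMost (λ ns → IncreasingIn[1, N ] ns × P ns)
      (s ℕ.* (N ℕ.^ suc k ℕ.* suc (N / p)) ℕ.+ N ℕ.^ suc k ℕ.* ((N ℕ.+ N) / T ℕ.+ R))
  bound N = AtMost-⊆ (λ {ns} (inc , Pns) → classify p ns inc (λ gen → common ns gen inc Pns))
      (AtMost-¬¬ (AtMost-⊎
    (nonGeneric-bound pp (ℕ.≤-<-trans (ℕ.m≤m+n 3 (4 ℕ.* (M ℕ.* s))) p-large) N (suc k))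
    (AtMost-tails (bad-heads-bound pp T))))
  h₁ : ∀ N → 4 ℕ.* (M ℕ.* s ℕ.* (N / p)) ≤ N
  h₁ N = ℕ.≤-trans (ℕ.≤-reflexive (≡.trans (≡.sym (ℕ.*-assoc 4 (M ℕ.* s) (N / p)))
      (ℕ.*-comm (4 ℕ.* (M ℕ.* s)) (N / p))))
    (ℕ.≤-trans (ℕ.*-monoʳ-≤ (N / p) (ℕ.<⇒≤ (ℕ.≤-<-trans (ℕ.m≤n+m (4 ℕ.* (M ℕ.* s)) 3) p-large)))
        (m/n*n≤m N p))
  h₂ : ∀ N → 4 ℕ.* (M ℕ.* ((N ℕ.+ N) / T)) ≤ N
  h₂ N = ℕ.*-cancelˡ-≤ 2 (ℕ.≤-trans (ℕ.≤-reflexive (lemma M ((N ℕ.+ N) / T)))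
      (ℕ.≤-trans (m/n*n≤m (N ℕ.+ N) T)
    (ℕ.≤-reflexive (≡.cong (N ℕ.+_) (≡.sym (ℕ.+-identityʳ N))))))
    where
    lemma : ∀ M w → 2 ℕ.* (4 ℕ.* (M ℕ.* w)) ≡ w ℕ.* (8 ℕ.* M)
    lemma = solveℕ 2 (λ M w → ℕcon 2 ℕ:* (ℕcon 4 ℕ:* (M ℕ:* w)) ℕ:= w ℕ:* (ℕcon 8 ℕ:* M)) ≡.refl

theorem2 : ∀ (k : ℕ) → 2 ≤ k → (E k =o[N^ k ]) × ForAlmostAllTuples k IrreducibleNoncyclotomicPart
theorem2 (suc (suc k)) (s≤s (s≤s z≤n)) =
  rare ReducibleNoncyclotomicPart (λ ns gen inc red none → none (reducible⇒commonFactor ns gen inc red)) ,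
  rare (λ ns → ¬ IrreducibleNoncyclotomicPart ns) (λ ns gen inc ¬irr → notIrreducible⇒commonFactor ns gen
      inc ¬irr)
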